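{- Let $m$ be a natural number, let $s \geq 2$, and let $A$ be a non-empty subset of $S_{3,m}$. Writing $\eta_{s} = 2^{ -1} \cdot 3^{ -s+2}$, for every $\epsilon>0$ we have \[ E_{s,2}(A) \ll_{s, \epsilon} m^{\epsilon} |A|^{2s -3 + 1/2 + \eta_{s}}. \]
   Context: For natural numbers $d,m$, $S_{d,m} = \{\mathbf{x} \in \mathbb{Z}^d : x_1^2+\dots+x_d^2 = m\}$. For a finite set $A \subseteq \mathbb{R}^d$ and $s \in \mathbb{N}$, $E_{s,2}(A)$ denotes the number of tuples $(\mathbf{x}_1,\dots,\mathbf{x}_{2s}) \in A^{2s}$ with $\mathbf{x}_1+\dots+\mathbf{x}_s = \mathbf{x}_{s+1}+\dots+\mathbf{x}_{2s}$. The notation $X \ll_{z} Y$ means $|X| \leq C_z Y$ for a positive constant $C_z$ depending only on $z$. -}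

module Defs where

open import Data.Nat using (ℕ; zero; suc; _+_; _*_; _^_; _∸_)
open import Data.Integer as ℤ using (ℤ; +_)
open import Data.Vec as Vec using (Vec; []; _∷_)
open import Data.Vec.Properties using (≡-dec)
open import Data.List using (List; []; _∷_; map; concatMap; filter; length; cartesianProduct; foldr)
open import Data.Product using (_×_; _,_; proj₁; proj₂)
open import Relation.Binary.PropositionalEquality using (_≡_)

Point : ℕ → Set
Point d = Vec ℤ d

normSq : ∀ {d} → Point d → ℤ
normSq []       = + 0
normSq (x ∷ xs) = x ℤ.* x ℤ.+ normSq xs

InSphere : (d m : ℕ) → Point d → Set
InSphere d m x = normSq x ≡ + m

zeroP : ∀ {d} → Point d
zeroP = Vec.replicate _ (+ 0)

addP : ∀ {d} → Point d → Point d → Point d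
addP = Vec.zipWith ℤ._+_

sumP : ∀ {d} → List (Point d) → Point d
sumP = foldr addP zeroP

tuples : ∀ {X : Set} → ℕ → List X → List (List X)
tuples zero    A = [] ∷ []
tuples (suc k) A = concatMap (λ a → map (a ∷_) (tuples k A)) A

E : ∀ {d} → ℕ → List (Point d) → ℕ
E s A = length (filter (λ p → ≡-dec ℤ._≟_ (sumP (proj₁ p)) (sumP (proj₂ p)))
                       (cartesianProduct (tuples s A) (tuples s A)))

module Submission where

-- Write r_s(n) for the number of representations of n as a sum of s elements of A. Since r_s(n) is the sum of
-- r_{s-1}(u) over the u with n − u ∈ A, the energy E_s counts weighted incidences between points u and spheres of
-- radius √m around points n, and two distinct points lie on only m^ε of these spheres, because a plane section of
-- the sphere is governed by a form x² + d z².
-- In place of a cell decomposition of real space, the points are sorted into their residue classes modulo q for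
-- q ≤ K. The sphere around n meets on average at most K^{2+ε} classes, and if it meets the class of u without passing
-- through u, then q divides the non-zero number |n − u|² − m, which by the divisor bound happens for at most m^ε
-- of the q. Cauchy–Schwarz inside every class and averaging over q ≤ K give, with N = |A| and M = N^{s-1},
--   E_s ≪ m^ε (M max_n #{u : |n − u|² = m} + M² / K + N E_{s-1} K²),
-- and the optimal K yields E_s³ ≪ m^ε E_{s-1} N^{4s-3} unless the first term dominates. The exponents η_s = η_{s-1} / 3
-- come from iterating this.

open import Defs
open import Data.Nat
open import Data.Nat.Properties
open import Data.Nat.Coprimality as Coprime using (Coprime; coprime-divisor)
open import Data.Nat.Divisibility
open import Data.Nat.DivMod using (_/_; _%_; m≡m%n+[m/n]*n; m%n<n; m/n*n≤m)
open import Data.Nat.GCD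
open import Data.Nat.Induction using (<-rec)
open import Data.Nat.ListAction using (product)
open import Data.Nat.Primality using (Prime; _Rough_; rough⇒≤; ∤⇒rough-suc; rough∧∣⇒rough; rough∧∣⇒prime; 2-rough; prime⇒nonZero; prime⇒nonTrivial; prime⇒irreducible)
open import Data.Nat.Primality.Factorisation using (factorise; module PrimeFactorisation)
import Data.Nat.Tactic.RingSolver as ℕ-Solver
import Data.Integer as ℤ
open import Data.Integer using (ℤ; +_; ∣_∣)
import Data.Integer.Properties as ℤ
import Data.Integer.Divisibility.Signed as ∣ℤ
open import Data.Integer.DivMod using (_%ℕ_; _/ℕ_; n%ℕd<d; a≡a%ℕn+[a/ℕn]*n)
import Data.Integer.Tactic.RingSolver as ℤ-Solver
open import Data.List using (List; []; _∷_; _++_; map; concatMap; filter; length; cartesianProduct; upTo; deduplicate)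
import Data.List.Properties as List
open import Data.List.Membership.Propositional using (_∈_; _∉_; lose; find)
open import Data.List.Membership.Propositional.Properties
open import Data.List.Relation.Unary.All as All using (All; []; _∷_)
open import Data.List.Relation.Unary.AllPairs using ([]; _∷_)
open import Data.List.Relation.Unary.Any using (here; there)
open import Data.List.Relation.Unary.Unique.Propositional using (Unique)
import Data.List.Relation.Unary.Unique.Propositional.Properties as Unique
open import Data.List.Relation.Unary.Unique.DecPropositional.Properties using (deduplicate-!)
open import Data.Product using (∃; ∃-syntax; _×_; _,_; proj₁; proj₂)
open import Data.Product.Properties using () renaming (≡-dec to ×-≡-dec)
open import Data.Sum using (_⊎_; inj₁; inj₂; [_,_]′)
open import Data.Vec using ([]; _∷_; zipWith; head; tail)
open import Data.Vec.Properties using (≡-dec)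
open import Function using (_∘_; id)
open import Relation.Binary.Definitions using (DecidableEquality)
open import Relation.Binary.PropositionalEquality
open import Relation.Nullary using (¬_; Dec; yes; no; contradiction)

-- Finite sums and counting

-- The two sides of the inequality are linked by E_s itself: Cauchy-Schwarz keeps the weights
-- r_s(n)² on one side, so E_s² is bounded by sums of r_s(n)² ψ_q(n), and the sum of ψ_q(n) over q ≤
-- K is bounded uniformly in n. Hence one factor E_s cancels. Every loss m^ε is a power of one
-- number H, a common bound for the numbers of divisors of all integers up to some W. For W to be
-- polynomial in m, so must be K, and this follows from |A| ≤ (3m)³. Powers of H are exchanged for
-- powers of m only at the very end. In E_s³ ≪ E_{s-1} N^{4s-3} the exponent 2s - 5/2 is stationary,
-- and a deviation η from it is divided by 3 in each step. The start E_1 = N means η_1 = 3/2, so s =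
-- 2 comes out of the same inequality with E_2 ≪ m^ε N². The term M max_n is about N^{2s-3}, below
-- the stationary exponent, except for s = 2, where the sphere around 0 contains A and the term is
-- N².

private variable
  I I′ : Set
  Φ Ψ : I → Set

⟦_⟧ : {B : Set} → Dec B → ℕ
⟦ yes _ ⟧ = 1
⟦ no  _ ⟧ = 0

⟦⟧-yes : {B : Set} (b? : Dec B) → B → ⟦ b? ⟧ ≡ 1
⟦⟧-yes (yes _) _ = refl
⟦⟧-yes (no ¬b) b = contradiction b ¬b

⟦⟧-no : {B : Set} (b? : Dec B) → ¬ B → ⟦ b? ⟧ ≡ 0
⟦⟧-no (yes b) ¬b = contradiction b ¬b
⟦⟧-no (no _)  _  = refl

⟦⟧≤1 : {B : Set} (b? : Dec B) → ⟦ b? ⟧ ≤ 1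
⟦⟧≤1 (yes _) = ≤-refl
⟦⟧≤1 (no _)  = z≤n

⟦⟧-mono : {B C : Set} (b? : Dec B) (c? : Dec C) → (B → C) → ⟦ b? ⟧ ≤ ⟦ c? ⟧
⟦⟧-mono (no _)  _  _ = z≤n
⟦⟧-mono (yes b) c? f = ≤-reflexive (sym (⟦⟧-yes c? (f b)))

⟦⟧-cong : {B C : Set} (b? : Dec B) (c? : Dec C) → (B → C) → (C → B) → ⟦ b? ⟧ ≡ ⟦ c? ⟧
⟦⟧-cong b? c? f g = ≤-antisym (⟦⟧-mono b? c? f) (⟦⟧-mono c? b? g)

⟦⟧-*-mono : {B : Set} (b? : Dec B) {x y : ℕ} → (B → x ≤ y) → ⟦ b? ⟧ * x ≤ ⟦ b? ⟧ * y
⟦⟧-*-mono (yes b) f = *-monoʳ-≤ 1 (f b)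
⟦⟧-*-mono (no _)  _ = z≤n

∑ : List I → (I → ℕ) → ℕ
∑ []       f = 0
∑ (x ∷ xs) f = f x + ∑ xs f

infixr 5 ∑
syntax ∑ xs (λ x → e) = ∑[ x ← xs ] e

∑-mono∈ : ∀ (xs : List I) {f g : I → ℕ} → (∀ {x} → x ∈ xs → f x ≤ g x) → ∑ xs f ≤ ∑ xs g
∑-mono∈ []       _ = z≤n
∑-mono∈ (x ∷ xs) h = +-mono-≤ (h (here refl)) (∑-mono∈ xs (h ∘ there))

∑-mono : ∀ (xs : List I) {f g : I → ℕ} → (∀ x → f x ≤ g x) → ∑ xs f ≤ ∑ xs g
∑-mono xs h = ∑-mono∈ xs λ {x} _ → h x

∑-cong∈ : ∀ (xs : List I) {f g : I → ℕ} → (∀ {x} → x ∈ xs → f x ≡ g x) → ∑ xs f ≡ ∑ xs g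
∑-cong∈ []       _ = refl
∑-cong∈ (x ∷ xs) h = cong₂ _+_ (h (here refl)) (∑-cong∈ xs (h ∘ there))

∑-cong : ∀ (xs : List I) {f g : I → ℕ} → (∀ x → f x ≡ g x) → ∑ xs f ≡ ∑ xs g
∑-cong xs h = ∑-cong∈ xs λ {x} _ → h x

∑-const : ∀ (xs : List I) c → (∑[ _ ← xs ] c) ≡ length xs * c
∑-const []       c = refl
∑-const (x ∷ xs) c = cong (_+_ c) (∑-const xs c)

∑-≤const : ∀ (xs : List I) {f : I → ℕ} {c} → (∀ {x} → x ∈ xs → f x ≤ c) → ∑ xs f ≤ length xs * c
∑-≤const xs {c = c} h = ≤-trans (∑-mono∈ xs h) (≤-reflexive (∑-const xs c))

∑-+ : ∀ (xs : List I) (f g : I → ℕ) → (∑[ x ← xs ] (f x + g x)) ≡ ∑ xs f + ∑ xs g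
∑-+ []       f g = refl
∑-+ (x ∷ xs) f g rewrite ∑-+ xs f g = interchange (f x) (g x) (∑ xs f) (∑ xs g)
  where
  interchange : ∀ a b c d → a + b + (c + d) ≡ a + c + (b + d)
  interchange = ℕ-Solver.solve-∀

∑-*ˡ : ∀ (xs : List I) c (f : I → ℕ) → c * ∑ xs f ≡ (∑[ x ← xs ] (c * f x))
∑-*ˡ []       c f = *-zeroʳ c
∑-*ˡ (x ∷ xs) c f rewrite sym (∑-*ˡ xs c f) = *-distribˡ-+ c (f x) (∑ xs f)

∑-*ʳ : ∀ (xs : List I) c (f : I → ℕ) → ∑ xs f * c ≡ (∑[ x ← xs ] (f x * c))
∑-*ʳ xs c f = trans (*-comm (∑ xs f) c) (trans (∑-*ˡ xs c f) (∑-cong xs λ x → *-comm c (f x)))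

∑-++ : ∀ (xs ys : List I) (f : I → ℕ) → ∑ (xs ++ ys) f ≡ ∑ xs f + ∑ ys f
∑-++ []       ys f = refl
∑-++ (x ∷ xs) ys f rewrite ∑-++ xs ys f = sym (+-assoc (f x) _ _)

∑-swap : ∀ (xs : List I) (ys : List I′) (f : I → I′ → ℕ) →
         (∑[ x ← xs ] ∑[ y ← ys ] f x y) ≡ (∑[ y ← ys ] ∑[ x ← xs ] f x y)
∑-swap []       ys f = sym (trans (∑-const ys 0) (*-zeroʳ (length ys)))
∑-swap (x ∷ xs) ys f rewrite ∑-swap xs ys f = sym (∑-+ ys (f x) λ y → ∑ xs λ x → f x y)

∑-map : ∀ (h : I → I′) (xs : List I) (f : I′ → ℕ) → ∑ (map h xs) f ≡ ∑ xs (f ∘ h)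
∑-map h []       f = refl
∑-map h (x ∷ xs) f = cong (_+_ (f (h x))) (∑-map h xs f)

∑-concatMap : ∀ (h : I → List I′) (xs : List I) (f : I′ → ℕ) → ∑ (concatMap h xs) f ≡ (∑[ x ← xs ] ∑ (h x) f)
∑-concatMap h []       f = refl
∑-concatMap h (x ∷ xs) f = trans (∑-++ (h x) (concatMap h xs) f) (cong (_+_ (∑ (h x) f)) (∑-concatMap h xs f))

∑-cartesianProduct : ∀ (xs : List I) (ys : List I′) (f : I × I′ → ℕ) →
                     ∑ (cartesianProduct xs ys) f ≡ (∑[ x ← xs ] ∑[ y ← ys ] f (x , y))
∑-cartesianProduct []       ys f = refl
∑-cartesianProduct (x ∷ xs) ys f = trans (∑-++ (map (x ,_) ys) (cartesianProduct xs ys) f)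
  (cong₂ _+_ (∑-map (x ,_) ys f) (∑-cartesianProduct xs ys f))

length-filter-∑ : (P? : ∀ x → Dec (Φ x)) (xs : List I) → length (filter P? xs) ≡ (∑[ x ← xs ] ⟦ P? x ⟧)
length-filter-∑ P? []       = refl
length-filter-∑ P? (x ∷ xs) with P? x
... | yes _ = cong suc (length-filter-∑ P? xs)
... | no  _ = length-filter-∑ P? xs

∑-⊆ : ∀ {xs ys : List I} (f : I → ℕ) → Unique xs → (∀ {x} → x ∈ xs → x ∈ ys) → ∑ xs f ≤ ∑ ys f
∑-⊆ {xs = []} f [] _ = z≤n
∑-⊆ {xs = x ∷ xs} f (x∉ ∷ u) sub with ∈-∃++ (sub (here refl))
... | as , bs , refl = begin
  f x + ∑ xs f           ≤⟨ +-monoʳ-≤ (f x) (∑-⊆ f u sub′) ⟩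
  f x + ∑ (as ++ bs) f   ≡⟨ cong (_+_ (f x)) (∑-++ as bs f) ⟩
  f x + (∑ as f + ∑ bs f) ≡⟨ rearrange (f x) (∑ as f) (∑ bs f) ⟩
  ∑ as f + (f x + ∑ bs f) ≡⟨ ∑-++ as (x ∷ bs) f ⟨
  ∑ (as ++ x ∷ bs) f ∎
  where
  open ≤-Reasoning
  rearrange : ∀ a b c → a + (b + c) ≡ b + (a + c)
  rearrange = ℕ-Solver.solve-∀
  sub′ : ∀ {y} → y ∈ xs → y ∈ as ++ bs
  sub′ y∈ with ∈-++⁻ as (sub (there y∈))
  ... | inj₁ p = ∈-++⁺ˡ p
  ... | inj₂ (here refl) = contradiction refl (All.lookup x∉ y∈)
  ... | inj₂ (there p) = ∈-++⁺ʳ as p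

module _ (_≟ˣ_ : DecidableEquality I) where

  ∑-pick-∉ : ∀ (xs : List I) {p} (f : I → ℕ) → p ∉ xs → (∑[ x ← xs ] (⟦ x ≟ˣ p ⟧ * f x)) ≡ 0
  ∑-pick-∉ []       f _ = refl
  ∑-pick-∉ (x ∷ xs) {p} f p∉ rewrite ⟦⟧-no (x ≟ˣ p) (λ { refl → p∉ (here refl) }) = ∑-pick-∉ xs f (p∉ ∘ there)

  ∑-pick : ∀ {xs : List I} {p} (f : I → ℕ) → Unique xs → p ∈ xs → (∑[ x ← xs ] (⟦ x ≟ˣ p ⟧ * f x)) ≡ f p
  ∑-pick {x ∷ xs} f u@(_ ∷ _) (here refl)
    rewrite ⟦⟧-yes (x ≟ˣ x) refl | ∑-pick-∉ xs f (Unique.Unique[x∷xs]⇒x∉xs u) = trans (+-identityʳ _) (+-identityʳ _)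
  ∑-pick {x ∷ xs} {p} f (x∉ ∷ u) (there p∈) rewrite ⟦⟧-no (x ≟ˣ p) (All.lookup x∉ p∈) = ∑-pick f u p∈

  ∑-pick-≤ : ∀ {xs : List I} p (f : I → ℕ) → Unique xs → (∑[ x ← xs ] (⟦ x ≟ˣ p ⟧ * f x)) ≤ f p
  ∑-pick-≤ {[]} p f _ = z≤n
  ∑-pick-≤ {x ∷ xs} p f u@(_ ∷ u′) with x ≟ˣ p
  ... | yes refl rewrite ∑-pick-∉ xs f (Unique.Unique[x∷xs]⇒x∉xs u) = ≤-reflexive (trans (+-identityʳ _) (+-identityʳ _))
  ... | no _ = ∑-pick-≤ p f u′

  ∑-⟦≟⟧-≤1 : ∀ {xs : List I} p → Unique xs → (∑[ x ← xs ] ⟦ x ≟ˣ p ⟧) ≤ 1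
  ∑-⟦≟⟧-≤1 {xs} p u = ≤-trans (≤-reflexive (∑-cong xs λ x → sym (*-identityʳ ⟦ x ≟ˣ p ⟧))) (∑-pick-≤ p (λ _ → 1) u)

m²≤n²⇒m≤n : ∀ {m n} → m * m ≤ n * n → m ≤ n
m²≤n²⇒m≤n {m} {n} h = ≮⇒≥ λ n<m → <⇒≱ (*-mono-< n<m n<m) h

-- AM-GM without square roots: after squaring, the gap between `4 * (p * q)` and the square of
-- `p + q` is the square of their difference.
z²≤pq⇒2z≤p+q : ∀ {z p q} → z * z ≤ p * q → 2 * z ≤ p + q
z²≤pq⇒2z≤p+q {z} {p} {q} h = m²≤n²⇒m≤n (begin
  2 * z * (2 * z)      ≡⟨ expand z ⟩
  4 * (z * z)          ≤⟨ *-monoʳ-≤ 4 h ⟩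
  4 * (p * q)          ≤⟨ [ lem p q , (λ q≤p → ≤-trans (≤-reflexive (cong (4 *_) (*-comm p q)))
                            (≤-trans (lem q p q≤p) (≤-reflexive (cong₂ _*_ (+-comm q p) (+-comm q p))))) ]′ (≤-total p q) ⟩
  (p + q) * (p + q) ∎)
  where
  open ≤-Reasoning
  expand : ∀ z → 2 * z * (2 * z) ≡ 4 * (z * z)
  expand = ℕ-Solver.solve-∀
  square : ∀ p r → 4 * (p * (p + r)) + r * r ≡ (p + (p + r)) * (p + (p + r))
  square = ℕ-Solver.solve-∀
  lem : ∀ p q → p ≤ q → 4 * (p * q) ≤ (p + q) * (p + q)
  lem p q p≤q with m≤n⇒∃[o]m+o≡n p≤q
  ... | r , refl = ≤-trans (m≤m+n _ (r * r)) (≤-reflexive (square p r))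

-- Domination of `f` is assumed through the products `a x * b x`, so that no roots are taken; the
-- cross terms of the induction are AM-GM. The factor `k` clears the denominator of a normalised
-- weight.
cauchy-schwarz : ∀ k (xs : List I) (f a b : I → ℕ) → (∀ x → k * (f x * f x) ≤ a x * b x) →
                 k * (∑ xs f * ∑ xs f) ≤ ∑ xs a * ∑ xs b
cauchy-schwarz k []       f a b h = ≤-reflexive (*-zeroʳ k)
cauchy-schwarz k (x ∷ xs) f a b h =
  step k (f x) (∑ xs f) (a x) (b x) (∑ xs a) (∑ xs b) (h x) (cauchy-schwarz k xs f a b h)
  where
  open ≤-Reasoning
  expand : ∀ k u v → k * ((u + v) * (u + v)) ≡ k * (u * u) + 2 * (k * (u * v)) + k * (v * v)
  expand = ℕ-Solver.solve-∀
  regroup : ∀ k u v → k * (u * v) * (k * (u * v)) ≡ k * (u * u) * (k * (v * v))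
  regroup = ℕ-Solver.solve-∀
  regroup′ : ∀ p q r s → p * q * (r * s) ≡ p * s * (r * q)
  regroup′ = ℕ-Solver.solve-∀
  factor : ∀ p q r s → p * q + (p * s + r * q) + r * s ≡ (p + r) * (q + s)
  factor = ℕ-Solver.solve-∀
  step : ∀ k u v p q r s → k * (u * u) ≤ p * q → k * (v * v) ≤ r * s →
         k * ((u + v) * (u + v)) ≤ (p + r) * (q + s)
  step k u v p q r s h₁ h₂ = begin
    k * ((u + v) * (u + v))                       ≡⟨ expand k u v ⟩
    k * (u * u) + 2 * (k * (u * v)) + k * (v * v) ≤⟨ +-mono-≤ (+-mono-≤ h₁ cross) h₂ ⟩
    p * q + (p * s + r * q) + r * s               ≡⟨ factor p q r s ⟩
    (p + r) * (q + s) ∎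
    where
    cross : 2 * (k * (u * v)) ≤ p * s + r * q
    cross = z²≤pq⇒2z≤p+q {k * (u * v)} {p * s} {r * q} (begin
      k * (u * v) * (k * (u * v)) ≡⟨ regroup k u v ⟩
      k * (u * u) * (k * (v * v)) ≤⟨ *-mono-≤ h₁ h₂ ⟩
      p * q * (r * s)             ≡⟨ regroup′ p q r s ⟩
      p * s * (r * q) ∎)

-- At most b elements satisfy Φ; stated through lists because Φ need not be decidable.
Small : ℕ → (I → Set) → Set
Small b Φ = ∀ xs → Unique xs → All Φ xs → length xs ≤ b

Small-weaken : ∀ {b c} → b ≤ c → Small b Φ → Small c Φ
Small-weaken b≤c s xs u ps = ≤-trans (s xs u ps) b≤c

length-∑ : ∀ (xs : List I) → (∑[ _ ← xs ] 1) ≡ length xs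
length-∑ xs = trans (∑-const xs 1) (*-identityʳ _)

Small-∈ : ∀ (ys : List I) → (∀ {x} → Φ x → x ∈ ys) → Small (length ys) Φ
Small-∈ ys f xs u ps = subst₂ _≤_ (length-∑ xs) (length-∑ ys) (∑-⊆ (λ _ → 1) u (f ∘ All.lookup ps))

-- Provides a base point against which all other elements can be measured; only the empty list has
-- none, and it is short anyway.
Small-based : ∀ {b} → (∀ x → Φ x → Small b Φ) → Small b Φ
Small-based h []       _ _          = z≤n
Small-based h (x ∷ xs) u ps@(p ∷ _) = h x p (x ∷ xs) u ps

-- A relation takes the place of a function because the image may be a quotient that is only known
-- to exist.
Small-inj : ∀ {I I′ : Set} {Φ : I → Set} {Ψ : I′ → Set} {b} (R : I → I′ → Set) → (∀ x → Φ x → ∃[ y ] R x y × Ψ y) →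
            (∀ {x x′ y} → Φ x → Φ x′ → R x y → R x′ y → x ≡ x′) → Small b Ψ → Small b Φ
Small-inj {I} {I′} {Φ} {Ψ} {b} R image inj s xs u ps =
  let ys , l , u′ , qs , _ = images xs u ps in subst (_≤ b) l (s ys u′ qs)
  where
  images : ∀ xs → Unique xs → All Φ xs →
           ∃[ ys ] length ys ≡ length xs × Unique ys × All Ψ ys × (∀ {y} → y ∈ ys → ∃[ x ] x ∈ xs × R x y)
  images []       _ _ = [] , refl , [] , [] , λ ()
  images (x ∷ xs) (x∉ ∷ u) (p ∷ ps) with images xs u ps | image x p
  ... | ys , l , u′ , qs , back | y , r , q =
    y ∷ ys , cong suc l , All.tabulate fresh ∷ u′ , q ∷ qs , back′
    where
    fresh : ∀ {z} → z ∈ ys → y ≢ z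
    fresh z∈ refl = let x′ , x′∈ , r′ = back z∈ in
      All.lookup x∉ x′∈ (inj p (All.lookup ps x′∈) r r′)
    back′ : ∀ {z} → z ∈ y ∷ ys → ∃[ x′ ] x′ ∈ x ∷ xs × R x′ z
    back′ (here refl) = x , here refl , r
    back′ (there z∈)  = let x′ , x′∈ , r′ = back z∈ in x′ , there x′∈ , r′

∑⟦⟧≤ : ∀ {b} (P? : ∀ x → Dec (Φ x)) {xs : List I} → Unique xs → (∀ {x} → x ∈ xs → Φ x → Ψ x) → Small b Ψ →
       (∑[ x ← xs ] ⟦ P? x ⟧) ≤ b
∑⟦⟧≤ P? {xs} u f s = subst (_≤ _) (length-filter-∑ P? xs)
  (s (filter P? xs) (Unique.filter⁺ P? u) (All.tabulate λ x∈ → let x∈xs , p = ∈-filter⁻ P? x∈ in f x∈xs p))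

Small-fibred : ∀ {I I′ : Set} {Φ : I → Set} {Ψ : I′ → Set} {h b} (_≟ʸ_ : DecidableEquality I′) (key : I → I′) → (∀ {x} → Φ x → Ψ (key x)) → Small h Ψ →
               (∀ y → Ψ y → Small b λ x → Φ x × key x ≡ y) → Small (h * b) Φ
Small-fibred {Φ = Φ} {Ψ} {h} {b} _≟ʸ_ key f sQ sF xs u ps = begin
  length xs                                     ≡⟨ length-∑ xs ⟨
  (∑[ x ← xs ] 1)                               ≡⟨ ∑-cong∈ xs (λ x∈ → ∑-pick _≟ʸ_ (λ _ → 1) ks! (∈-deduplicate⁺ _≟ʸ_ (∈-map⁺ key x∈))) ⟨
  (∑[ x ← xs ] ∑[ y ← ks ] (⟦ y ≟ʸ key x ⟧ * 1)) ≡⟨ ∑-swap xs ks _ ⟩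
  (∑[ y ← ks ] ∑[ x ← xs ] (⟦ y ≟ʸ key x ⟧ * 1)) ≤⟨ ∑-≤const ks (λ {y} y∈ → ≤-trans (≤-reflexive (∑-cong xs λ x → *-identityʳ _))
                                                      (∑⟦⟧≤ (λ x → y ≟ʸ key x) u (λ x∈ eq → All.lookup ps x∈ , sym eq) (sF y (All.lookup ksQ y∈)))) ⟩
  length ks * b                                 ≤⟨ *-monoˡ-≤ b (sQ ks ks! ksQ) ⟩
  h * b ∎
  where
  open ≤-Reasoning
  ks = deduplicate _≟ʸ_ (map key xs)
  ks! : Unique ks
  ks! = deduplicate-! _≟ʸ_ (map key xs)
  ksQ : All Ψ ks
  ksQ = All.tabulate λ y∈ → let x , x∈ , eq = ∈-map⁻ key (∈-deduplicate⁻ _≟ʸ_ (map key xs) y∈) in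
    subst Ψ (sym eq) (f (All.lookup ps x∈))

-- The divisor bound

divisors : ℕ → List ℕ
divisors n = filter (_∣? n) (upTo (suc n))

τ : ℕ → ℕ
τ n = length (divisors n)

∈-divisors : ∀ {n q} .{{_ : NonZero n}} → q ∣ n → q ∈ divisors n
∈-divisors {n} q∣n = ∈-filter⁺ (_∣? n) (∈-upTo⁺ (s≤s (∣⇒≤ q∣n))) q∣n

Small-divisors : ∀ n .{{_ : NonZero n}} → Small (τ n) (_∣ n)
Small-divisors n = Small-∈ (divisors n) ∈-divisors

τ-≤ : ∀ {n b} → Small b (_∣ n) → τ n ≤ b
τ-≤ {n} s = s (divisors n) (Unique.filter⁺ (_∣? n) (Unique.upTo⁺ (suc n)))
  (All.tabulate λ q∈ → proj₂ (∈-filter⁻ (_∣? n) {xs = upTo (suc n)} q∈))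

∣p^e*n : ∀ {p q} n → Prime p → ∀ e → q ∣ p ^ e * n → ∃[ i ] ∃[ d ] i ≤ e × d ∣ n × q ≡ p ^ i * d
∣p^e*n {p} {q} n pp zero    q∣ = 0 , q , z≤n , subst (q ∣_) (+-identityʳ n) q∣ , sym (+-identityʳ q)
∣p^e*n {p} {q} n pp (suc e) q∣ with p ∣? q
... | yes (divides-refl q′) =
  let instance _ = prime⇒nonZero pp
      i , d , i≤e , d∣n , q′≡ = ∣p^e*n n pp e (*-cancelˡ-∣ p (subst₂ _∣_ (*-comm q′ p) (*-assoc p (p ^ e) n) q∣))
  in suc i , d , s≤s i≤e , d∣n , trans (*-comm q′ p) (trans (cong (p *_) q′≡) (sym (*-assoc p (p ^ i) d)))
... | no p∤q =
  let i , d , i≤e , d∣n , q≡ = ∣p^e*n n pp e (coprime-divisor coprime (subst (q ∣_) (*-assoc p (p ^ e) n) q∣))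
  in i , d , ≤-trans i≤e (n≤1+n e) , d∣n , q≡
  where
  coprime : Coprime q p
  coprime (d∣q , d∣p) with prime⇒irreducible pp d∣p
  ... | inj₁ d≡1  = d≡1
  ... | inj₂ refl = contradiction d∣q p∤q

-- Only an inequality, since `n` may itself contain `p`. This allows `τ-rough` to split off prime
-- factors one at a time, with repetition.
τ-prime-power : ∀ {p} n .{{_ : NonZero n}} → Prime p → ∀ e → τ (p ^ e * n) ≤ suc e * τ n
τ-prime-power {p} n pp e = τ-≤ (Small-weaken (≤-reflexive len) (Small-∈ candidates λ q∣ →
  let i , d , i≤e , d∣n , q≡ = ∣p^e*n n pp e q∣ in
  subst (_∈ candidates) (sym q≡) (∈-concatMap⁺ multiples (lose (∈-upTo⁺ (s≤s i≤e)) (∈-map⁺ (p ^ i *_) (∈-divisors d∣n))))))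
  where
  multiples : ℕ → List ℕ
  multiples i = map (p ^ i *_) (divisors n)
  candidates = concatMap multiples (upTo (suc e))
  len : length candidates ≡ suc e * τ n
  len = begin
    length candidates                                 ≡⟨ length-∑ candidates ⟨
    (∑[ _ ← candidates ] 1)                           ≡⟨ ∑-concatMap multiples (upTo (suc e)) (λ _ → 1) ⟩
    (∑[ i ← upTo (suc e) ] ∑[ _ ← multiples i ] 1)     ≡⟨ ∑-cong (upTo (suc e)) (λ i →
                                                           trans (length-∑ (multiples i)) (List.length-map (p ^ i *_) (divisors n))) ⟩
    (∑[ i ← upTo (suc e) ] τ n)                       ≡⟨ ∑-const (upTo (suc e)) (τ n) ⟩
    length (upTo (suc e)) * τ n                       ≡⟨ cong (_* τ n) (List.length-upTo (suc e)) ⟩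
    suc e * τ n ∎
    where open ≡-Reasoning

^-distribʳ-* : ∀ m n k → (m * n) ^ k ≡ m ^ k * n ^ k
^-distribʳ-* m n zero    = refl
^-distribʳ-* m n (suc k) rewrite ^-distribʳ-* m n k = interchange m n (m ^ k) (n ^ k)
  where
  interchange : ∀ a b c d → a * b * (c * d) ≡ a * c * (b * d)
  interchange = ℕ-Solver.solve-∀

1+n≤2^n : ∀ n → suc n ≤ 2 ^ n
1+n≤2^n zero    = ≤-refl
1+n≤2^n (suc n) = begin
  suc (suc n)     ≤⟨ s≤s (1+n≤2^n n) ⟩
  1 + 2 ^ n       ≤⟨ +-monoˡ-≤ (2 ^ n) (m^n>0 2 n) ⟩
  2 ^ n + 2 ^ n   ≡⟨ cong (_+_ (2 ^ n)) (+-identityʳ (2 ^ n)) ⟨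
  2 ^ suc n ∎
  where open ≤-Reasoning

-- Division with remainder gives `suc e ≤ k * suc (e / k)`, and the last factor is at most
-- `2 ^ (e / k)`. So a small prime costs only the constant `k ^ k`, whatever its exponent.
[1+e]^k≤k^k*2^e : ∀ k .{{_ : NonZero k}} e → suc e ^ k ≤ k ^ k * 2 ^ e
[1+e]^k≤k^k*2^e k e = begin
  suc e ^ k                     ≤⟨ ^-monoˡ-≤ k suc-e ⟩
  (k * 2 ^ (e / k)) ^ k         ≡⟨ ^-distribʳ-* k (2 ^ (e / k)) k ⟩
  k ^ k * (2 ^ (e / k)) ^ k     ≡⟨ cong (k ^ k *_) (^-*-assoc 2 (e / k) k) ⟩
  k ^ k * 2 ^ (e / k * k)       ≤⟨ *-monoʳ-≤ (k ^ k) (^-monoʳ-≤ 2 (m/n*n≤m e k)) ⟩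
  k ^ k * 2 ^ e ∎
  where
  open ≤-Reasoning
  suc-e : suc e ≤ k * 2 ^ (e / k)
  suc-e = begin
    suc e                       ≡⟨ cong suc (m≡m%n+[m/n]*n e k) ⟩
    suc (e % k) + e / k * k     ≤⟨ +-monoˡ-≤ (e / k * k) (m%n<n e k) ⟩
    suc (e / k) * k             ≡⟨ *-comm (suc (e / k)) k ⟩
    k * suc (e / k)             ≤⟨ *-monoʳ-≤ k (1+n≤2^n (e / k)) ⟩
    k * 2 ^ (e / k) ∎

-- A prime factor at most doubles `τ`, hence multiplies `τ n ^ k` by at most `2 ^ k`, which is no
-- more than the prime itself.
τ-rough : ∀ k n .{{_ : NonZero n}} → (2 ^ k) Rough n → τ n ^ k ≤ n
τ-rough k n {{nz}} = <-rec (λ n → .(NonZero n) → (2 ^ k) Rough n → τ n ^ k ≤ n) step n nz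
  where
  open ≤-Reasoning
  step : ∀ n → (∀ {n′} → n′ < n → .(NonZero n′) → (2 ^ k) Rough n′ → τ n′ ^ k ≤ n′) → .(NonZero n) → (2 ^ k) Rough n → τ n ^ k ≤ n
  step n rec nz rough with factorise n {{nz}}
  ... | record { factors = [] ; isFactorisation = refl } = ≤-reflexive (^-zeroˡ k)
  ... | record { factors = p ∷ ps ; isFactorisation = refl ; factorsPrime = pp ∷ _ } = begin
    τ (p * n′) ^ k            ≡⟨ cong (λ z → τ (z * n′) ^ k) (^-identityʳ p) ⟨
    τ (p ^ 1 * n′) ^ k        ≤⟨ ^-monoˡ-≤ k (τ-prime-power n′ pp 1) ⟩
    (2 * τ n′) ^ k            ≡⟨ ^-distribʳ-* 2 (τ n′) k ⟩
    2 ^ k * τ n′ ^ k          ≤⟨ *-mono-≤ (rough⇒≤ (rough∧∣⇒rough rough (m∣m*n {p} n′))) (rec n′< nz′ (rough∧∣⇒rough rough (n∣m*n p))) ⟩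
    p * n′ ∎
    where
    n′ = product ps
    .nz′ : NonZero n′
    nz′ = m*n≢0⇒n≢0 p {{nz}}
    instance
      _ = m*n≢0⇒n≢0 p {{nz}}
      _ = prime⇒nonTrivial pp
    n′< : n′ < p * n′
    n′< = subst (n′ <_) (*-comm n′ p) (m<m*n n′ p (nonTrivial⇒n>1 p))

strip : ∀ p n .{{_ : NonTrivial p}} .{{_ : NonZero n}} → ∃[ e ] ∃[ n′ ] n ≡ p ^ e * n′ × p ∤ n′
strip p n {{_}} {{nz}} = <-rec (λ n → .(NonZero n) → ∃[ e ] ∃[ n′ ] n ≡ p ^ e * n′ × p ∤ n′) step n nz
  where
  step : ∀ n → (∀ {n′} → n′ < n → .(NonZero n′) → ∃[ e ] ∃[ m ] n′ ≡ p ^ e * m × p ∤ m) → .(NonZero n) →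
         ∃[ e ] ∃[ m ] n ≡ p ^ e * m × p ∤ m
  step n rec nz with p ∣? n
  ... | no  p∤n = 0 , n , sym (+-identityʳ n) , p∤n
  ... | yes (divides-refl n′) =
    let instance _ = m*n≢0⇒m≢0 n′ {{nz}}
        e , m , eq , p∤m = rec (m<m*n n′ p (nonTrivial⇒n>1 p)) (m*n≢0⇒m≢0 n′ {{nz}})
    in suc e , m , trans (*-comm n′ p) (trans (cong (p *_) eq) (sym (*-assoc p (p ^ e) m))) , p∤m

-- A divisor `j` of a `j`-rough number is prime. Removing its full power leaves a `suc j`-rough
-- number and costs `suc e ^ k ≤ k ^ k * j ^ e`. The maximum with 1 covers the case where `j` does
-- not divide `n`.
τ-bound-descend : ∀ k .{{_ : NonZero k}} j .{{_ : NonTrivial j}} C →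
                  (∀ n .{{_ : NonZero n}} → suc j Rough n → τ n ^ k ≤ C * n) →
                  ∀ n .{{_ : NonZero n}} → j Rough n → τ n ^ k ≤ (1 ⊔ k ^ k) * C * n
τ-bound-descend k j C h n rough with j ∣? n
... | no j∤n = ≤-trans (h n (∤⇒rough-suc j∤n rough)) (*-monoˡ-≤ n (≤-trans (≤-reflexive (sym (*-identityˡ C))) (*-monoˡ-≤ C (m≤m⊔n 1 (k ^ k)))))
... | yes j∣n with strip j n
...   | e , n′ , refl , j∤n′ = begin
  τ (j ^ e * n′) ^ k                  ≤⟨ ^-monoˡ-≤ k (τ-prime-power n′ (rough∧∣⇒prime rough j∣n) e) ⟩
  (suc e * τ n′) ^ k                  ≡⟨ ^-distribʳ-* (suc e) (τ n′) k ⟩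
  suc e ^ k * τ n′ ^ k                ≤⟨ *-mono-≤ ([1+e]^k≤k^k*2^e k e) (h n′ (∤⇒rough-suc j∤n′ (rough∧∣⇒rough rough (n∣m*n (j ^ e))))) ⟩
  k ^ k * 2 ^ e * (C * n′)            ≤⟨ *-monoˡ-≤ (C * n′) (*-mono-≤ (m≤n⊔m 1 (k ^ k)) (^-monoˡ-≤ e (nonTrivial⇒n>1 j))) ⟩
  (1 ⊔ k ^ k) * j ^ e * (C * n′)      ≡⟨ regroup (1 ⊔ k ^ k) (j ^ e) C n′ ⟩
  (1 ⊔ k ^ k) * C * (j ^ e * n′) ∎
  where
  open ≤-Reasoning
  instance _ = m*n≢0⇒n≢0 (j ^ e) {n′}
  regroup : ∀ a b c d → a * b * (c * d) ≡ a * c * (b * d)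
  regroup = ℕ-Solver.solve-∀

-- Descending induction on the roughness, from `2 ^ k`, where the constant is 1, down to 2; `i` is
-- the distance still to go.
τ-bound-rough : ∀ k .{{_ : NonZero k}} i j → suc (suc j) + i ≡ 2 ^ k →
                ∃[ C ] ∀ n .{{_ : NonZero n}} → suc (suc j) Rough n → τ n ^ k ≤ C * n
τ-bound-rough k zero    j eq = 1 , λ n rough →
  ≤-trans (τ-rough k n (subst (_Rough n) (trans (sym (+-identityʳ _)) eq) rough)) (≤-reflexive (sym (*-identityˡ n)))
τ-bound-rough k (suc i) j eq =
  let C , h = τ-bound-rough k i (suc j) (trans (sym (+-suc (suc (suc j)) i)) eq)
  in (1 ⊔ k ^ k) * C , τ-bound-descend k (suc (suc j)) C h

τ-bound : ∀ k .{{_ : NonZero k}} → ∃[ C ] ∀ n .{{_ : NonZero n}} → τ n ^ k ≤ C * n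
τ-bound k@(suc k′) =
  let C , h = τ-bound-rough k (2 ^ k ∸ 2) 0 (m+[n∸m]≡n (*-mono-≤ (≤-refl {2}) (m^n>0 2 k′)))
  in C , λ n → h n 2-rough

-- Primitive representations by x² + d z²

square-abs : ∀ x → x ℤ.* x ≡ + (∣ x ∣ * ∣ x ∣)
square-abs (+ n)        = sym (ℤ.pos-* n n)
square-abs ℤ.-[1+ n ] = refl

squares-≡ : ∀ x y → x ℤ.* x ≡ y ℤ.* y → x ≡ y ⊎ x ≡ ℤ.- y
squares-≡ x y eq with ℤ.i*j≡0⇒i≡0∨j≡0 (x ℤ.- y) (trans (factor x y) (ℤ.i≡j⇒i-j≡0 {x ℤ.* x} {y ℤ.* y} eq))
  where
  factor : ∀ x y → (x ℤ.- y) ℤ.* (x ℤ.+ y) ≡ x ℤ.* x ℤ.- y ℤ.* y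
  factor = ℤ-Solver.solve-∀
... | inj₁ p = inj₁ (ℤ.i-j≡0⇒i≡j x y p)
... | inj₂ p = inj₂ (ℤ.i-j≡0⇒i≡j x (ℤ.- y) (trans (cong (ℤ._+_ x) (ℤ.neg-involutive y)) p))

∣-combination : ∀ {g} a x b y → g ∣ ∣ x ∣ → g ∣ ∣ y ∣ → g ∣ ∣ a ℤ.* x ℤ.+ b ℤ.* y ∣
∣-combination {g} a x b y p q = ∣ℤ.∣⇒∣ᵤ {+ g} {a ℤ.* x ℤ.+ b ℤ.* y}
  (∣ℤ.∣m∣n⇒∣m+n (∣ℤ.∣n⇒∣m*n a (∣ℤ.∣ᵤ⇒∣ {+ g} {x} p)) (∣ℤ.∣n⇒∣m*n b (∣ℤ.∣ᵤ⇒∣ {+ g} {y} q)))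

-- `n` divides both `a * b` and `b * n`, hence `b * gcd a n`.
cofactor-∣ : ∀ {n a b h} → n ∣ a * b → n ≡ h * gcd a n → .{{NonZero n}} → h ∣ b
cofactor-∣ {n} {a} {b} {h} n∣ab eq {{nz}} = *-cancelʳ-∣ (gcd a n) {{gcd≢0}} (subst (_∣ b * gcd a n) eq
  (subst (n ∣_) (sym (c*gcd[m,n]≡gcd[cm,cn] b a n)) (gcd-greatest (subst (n ∣_) (*-comm a b) n∣ab) (n∣m*n b))))
  where
  .gcd≢0 : NonZero (gcd a n)
  gcd≢0 = m*n≢0⇒n≢0 h {{subst NonZero eq nz}}

-- `h * g` divides both `D * g` and `D * h`, hence `D * gcd g h`.
*-∣-gcd-* : ∀ {g h D} → g ∣ D → h ∣ D → h * g ∣ gcd g h * D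
*-∣-gcd-* {g} {h} {D} g∣D h∣D = subst (h * g ∣_) (trans (sym (c*gcd[m,n]≡gcd[cm,cn] D g h)) (*-comm D (gcd g h)))
  (gcd-greatest (*-monoˡ-∣ g h∣D) (subst (h * g ∣_) (*-comm h D) (*-monoʳ-∣ h g∣D)))

coprime-∣ : ∀ {m n k} → k ∣ m → Coprime m n → Coprime k n
coprime-∣ k∣m c (d∣k , d∣n) = c (∣-trans d∣k k∣m , d∣n)

Small-subsingleton : ∀ {X : Set} {P : X → Set} → (∀ {x y} → P x → P y → x ≡ y) → Small 1 P
Small-subsingleton eq []           _        _             = z≤n
Small-subsingleton eq (_ ∷ [])     _        _             = ≤-refl
Small-subsingleton eq (_ ∷ _ ∷ _) ((x≢y ∷ _) ∷ _) (p ∷ q ∷ _) = contradiction (eq p q) x≢y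

Small-roots : ∀ v → Small 2 (λ x → x ℤ.* x ≡ v)
Small-roots v = Small-based λ x₀ eq₀ → Small-∈ (x₀ ∷ ℤ.- x₀ ∷ []) λ {x} eq →
  [ (λ { refl → here refl }) , (λ { refl → there (here refl) }) ]′ (squares-≡ x x₀ (trans eq (sym eq₀)))

Rep : ℕ → ℕ → ℤ × ℤ → Set
Rep d n (x , z) = x ℤ.* x ℤ.+ + d ℤ.* (z ℤ.* z) ≡ + n

rep-ℕ : ∀ {n} d x z → Rep d n (x , z) → n ≡ ∣ x ∣ * ∣ x ∣ + d * (∣ z ∣ * ∣ z ∣)
rep-ℕ {n} d x z r = sym (ℤ.+-injective (begin
  + (∣ x ∣ * ∣ x ∣ + d * (∣ z ∣ * ∣ z ∣))             ≡⟨ ℤ.pos-+ (∣ x ∣ * ∣ x ∣) _ ⟩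
  + (∣ x ∣ * ∣ x ∣) ℤ.+ + (d * (∣ z ∣ * ∣ z ∣))       ≡⟨ cong₂ ℤ._+_ (sym (square-abs x)) (ℤ.pos-* d _) ⟩
  x ℤ.* x ℤ.+ + d ℤ.* + (∣ z ∣ * ∣ z ∣)               ≡⟨ cong (λ w → x ℤ.* x ℤ.+ + d ℤ.* w) (sym (square-abs z)) ⟩
  x ℤ.* x ℤ.+ + d ℤ.* (z ℤ.* z)                       ≡⟨ r ⟩
  + n ∎))
  where open ≡-Reasoning

Primitive : ℤ × ℤ → Set
Primitive (x , z) = Coprime ∣ x ∣ ∣ z ∣

-- A common divisor of `n` and `z` divides x², but is coprime to `x`; so it divides `x` too and is
-- 1.
primitive⇒coprime : ∀ {n} d x z → Rep d n (x , z) → Primitive (x , z) → Coprime n ∣ z ∣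
primitive⇒coprime {n} d x z r prim {c} (c∣n , c∣z) = prim (c∣x , c∣z)
  where
  c∣d*z² : c ∣ d * (∣ z ∣ * ∣ z ∣)
  c∣d*z² = ∣n⇒∣m*n d (∣m⇒∣m*n ∣ z ∣ c∣z)
  c∣x² : c ∣ ∣ x ∣ * ∣ x ∣
  c∣x² = ∣m+n∣m⇒∣n (subst (c ∣_) (trans (rep-ℕ d x z r) (+-comm (∣ x ∣ * ∣ x ∣) _)) c∣n) c∣d*z²
  c∣x : c ∣ ∣ x ∣
  c∣x = coprime-divisor (coprime-∣ c∣z (Coprime.sym prim)) c∣x²

-- For primitive p = (x, z) and p′ = (x′, z′), n divides (x z′ − x′ z)(x z′ + x′ z), so p′ determines a divisor
-- g = gcd(x z′ − x′ z, n) of n. Two solutions q, q′ with the same g have determinant D with n ∣ e D, where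
-- e = gcd(g, n / g). As e² ∣ 4 d and d D² ≤ n², only the five values e D ∈ {0, ±n, ±2n} remain, and D together
-- with the dot product of q and q′ recovers q′ from q.
module _ (d n : ℕ) .{{_ : NonZero d}} .{{_ : NonZero n}} where

  private
    PRep : ℤ × ℤ → Set
    PRep p = Rep d n p × Primitive p

    minus plus dot : ℤ × ℤ → ℤ × ℤ → ℤ
    minus (x , z) (x′ , z′) = x ℤ.* z′ ℤ.- x′ ℤ.* z
    plus  (x , z) (x′ , z′) = x ℤ.* z′ ℤ.+ x′ ℤ.* z
    dot   (x , z) (x′ , z′) = x ℤ.* x′ ℤ.+ + d ℤ.* (z ℤ.* z′)

    key : ℤ × ℤ → ℤ × ℤ → ℕ
    key p p′ = gcd ∣ minus p p′ ∣ n

    -- Eliminating `d` from the two representations: z′² n - z² n = (x z′)² - (x′ z)².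
    n∣minus*plus : ∀ p p′ → Rep d n p → Rep d n p′ → n ∣ ∣ minus p p′ ∣ * ∣ plus p p′ ∣
    n∣minus*plus p@(x , z) p′@(x′ , z′) r r′ =
      subst (n ∣_) (trans (cong ∣_∣ eq) (ℤ.abs-* (minus p p′) (plus p p′))) (∣-combination (z′ ℤ.* z′) (+ n) (ℤ.- (z ℤ.* z)) (+ n) (∣-refl {n}) (∣-refl {n}))
      where
      ring : ∀ d x z x′ z′ → z′ ℤ.* z′ ℤ.* (x ℤ.* x ℤ.+ d ℤ.* (z ℤ.* z)) ℤ.+ ℤ.- (z ℤ.* z) ℤ.* (x′ ℤ.* x′ ℤ.+ d ℤ.* (z′ ℤ.* z′))
             ≡ (x ℤ.* z′ ℤ.- x′ ℤ.* z) ℤ.* (x ℤ.* z′ ℤ.+ x′ ℤ.* z)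
      ring = ℤ-Solver.solve-∀
      eq : z′ ℤ.* z′ ℤ.* + n ℤ.+ ℤ.- (z ℤ.* z) ℤ.* + n ≡ minus p p′ ℤ.* plus p p′
      eq = trans (cong₂ (λ u v → z′ ℤ.* z′ ℤ.* u ℤ.+ ℤ.- (z ℤ.* z) ℤ.* v) (sym r) (sym r′)) (ring (+ d) x z x′ z′)

    -- Brahmagupta's identity: `dot` and `minus` are the coordinates of the conjugate of x + z √-d
    -- times x′ + z′ √-d.
    dot²+d*minus² : ∀ p p′ → Rep d n p → Rep d n p′ → Rep d (n * n) (dot p p′ , minus p p′)
    dot²+d*minus² (x , z) (x′ , z′) r r′ = trans (ring (+ d) x z x′ z′) (trans (cong₂ ℤ._*_ r r′) (sym (ℤ.pos-* n n)))
      where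
      ring : ∀ d x z x′ z′ → (x ℤ.* x′ ℤ.+ d ℤ.* (z ℤ.* z′)) ℤ.* (x ℤ.* x′ ℤ.+ d ℤ.* (z ℤ.* z′))
               ℤ.+ d ℤ.* ((x ℤ.* z′ ℤ.- x′ ℤ.* z) ℤ.* (x ℤ.* z′ ℤ.- x′ ℤ.* z))
             ≡ (x ℤ.* x ℤ.+ d ℤ.* (z ℤ.* z)) ℤ.* (x′ ℤ.* x′ ℤ.+ d ℤ.* (z′ ℤ.* z′))
      ring = ℤ-Solver.solve-∀

    -- Multiplying that product by x + z √-d again gives `n` times `q`.
    dot,minus-injective : ∀ p q q′ → Rep d n p → minus p q ≡ minus p q′ → dot p q ≡ dot p q′ → q ≡ q′
    dot,minus-injective p@(x , z) q@(y , w) q′@(y′ , w′) r m≡ s≡ =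
      cong₂ _,_ (ℤ.*-cancelˡ-≡ (+ n) y y′ (begin
          + n ℤ.* y                                   ≡⟨ cong (ℤ._* y) r ⟨
          (x ℤ.* x ℤ.+ + d ℤ.* (z ℤ.* z)) ℤ.* y        ≡⟨ ring₁ (+ d) x z y w ⟩
          x ℤ.* dot p q ℤ.- + d ℤ.* z ℤ.* minus p q    ≡⟨ cong₂ (λ s m → x ℤ.* s ℤ.- + d ℤ.* z ℤ.* m) s≡ m≡ ⟩
          x ℤ.* dot p q′ ℤ.- + d ℤ.* z ℤ.* minus p q′  ≡⟨ ring₁ (+ d) x z y′ w′ ⟨
          (x ℤ.* x ℤ.+ + d ℤ.* (z ℤ.* z)) ℤ.* y′       ≡⟨ cong (ℤ._* y′) r ⟩
          + n ℤ.* y′ ∎))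
        (ℤ.*-cancelˡ-≡ (+ n) w w′ (begin
          + n ℤ.* w                                   ≡⟨ cong (ℤ._* w) r ⟨
          (x ℤ.* x ℤ.+ + d ℤ.* (z ℤ.* z)) ℤ.* w        ≡⟨ ring₂ (+ d) x z y w ⟩
          z ℤ.* dot p q ℤ.+ x ℤ.* minus p q            ≡⟨ cong₂ (λ s m → z ℤ.* s ℤ.+ x ℤ.* m) s≡ m≡ ⟩
          z ℤ.* dot p q′ ℤ.+ x ℤ.* minus p q′          ≡⟨ ring₂ (+ d) x z y′ w′ ⟨
          (x ℤ.* x ℤ.+ + d ℤ.* (z ℤ.* z)) ℤ.* w′       ≡⟨ cong (ℤ._* w′) r ⟩
          + n ℤ.* w′ ∎))
      where
      open ≡-Reasoning
      ring₁ : ∀ d x z y w → (x ℤ.* x ℤ.+ d ℤ.* (z ℤ.* z)) ℤ.* y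
            ≡ x ℤ.* (x ℤ.* y ℤ.+ d ℤ.* (z ℤ.* w)) ℤ.- d ℤ.* z ℤ.* (x ℤ.* w ℤ.- y ℤ.* z)
      ring₁ = ℤ-Solver.solve-∀
      ring₂ : ∀ d x z y w → (x ℤ.* x ℤ.+ d ℤ.* (z ℤ.* z)) ℤ.* w
            ≡ z ℤ.* (x ℤ.* y ℤ.+ d ℤ.* (z ℤ.* w)) ℤ.+ x ℤ.* (x ℤ.* w ℤ.- y ℤ.* z)
      ring₂ = ℤ-Solver.solve-∀

    module _ (p₀ : ℤ × ℤ) (P₀ : PRep p₀) (p₁ : ℤ × ℤ) (P₁ : PRep p₁) where

      private
        x₀ = proj₁ p₀ ; z₀ = proj₂ p₀
        x₁ = proj₁ p₁ ; z₁ = proj₂ p₁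
        r₀ = proj₁ P₀ ; r₁ = proj₁ P₁
        g = key p₀ p₁
        g∣n : g ∣ n
        g∣n = gcd[m,n]∣n ∣ minus p₀ p₁ ∣ n
        h = quotient g∣n
        n≡h*g : n ≡ h * g
        n≡h*g = _∣_.equality g∣n
        e = gcd g h

        e∣g : e ∣ g
        e∣g = gcd[m,n]∣m g h

        e²∣n : e * e ∣ n
        e²∣n = subst (e * e ∣_) (sym (trans n≡h*g (*-comm h g))) (*-pres-∣ e∣g (gcd[m,n]∣n g h))

        instance
          e≢0 : NonZero e
          e≢0 = m*n≢0⇒m≢0 e {{nonzero}}
            where
            nonzero : NonZero (e * e)
            nonzero = ≢-nonZero λ e²≡0 → ≢-nonZero⁻¹ n (0∣⇒≡0 (subst (_∣ n) e²≡0 e²∣n))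

        h∣plus : ∀ q → Rep d n q → key p₀ q ≡ g → h ∣ ∣ plus p₀ q ∣
        h∣plus q r k≡ = cofactor-∣ {n} {∣ minus p₀ q ∣} (n∣minus*plus p₀ q r₀ r) (trans n≡h*g (cong (h *_) (sym k≡)))

        g∣minus : ∀ q → key p₀ q ≡ g → g ∣ ∣ minus p₀ q ∣
        g∣minus q k≡ = subst (_∣ ∣ minus p₀ q ∣) k≡ (gcd[m,n]∣m ∣ minus p₀ q ∣ n)

        -- `e` divides `minus p₀ p₁` through `g` and `plus p₀ p₁` through `h`. Their sum is 2 x₀ z₁,
        -- and z₁ is coprime to `n`.
        e∣2x₀ : e ∣ ∣ + 2 ℤ.* x₀ ∣
        e∣2x₀ = coprime-divisor (coprime-∣ (∣-trans e∣g g∣n) (primitive⇒coprime d x₁ z₁ r₁ (proj₂ P₁)))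
          (subst (e ∣_) (trans (cong ∣_∣ (ring x₀ z₀ x₁ z₁)) (ℤ.abs-* z₁ (+ 2 ℤ.* x₀)))
            (∣-combination (+ 1) (minus p₀ p₁) (+ 1) (plus p₀ p₁) (∣-trans e∣g (g∣minus p₁ refl)) (∣-trans (gcd[m,n]∣n g h) (h∣plus p₁ r₁ refl))))
          where
          ring : ∀ x z x′ z′ → + 1 ℤ.* (x ℤ.* z′ ℤ.- x′ ℤ.* z) ℤ.+ + 1 ℤ.* (x ℤ.* z′ ℤ.+ x′ ℤ.* z) ≡ z′ ℤ.* (+ 2 ℤ.* x)
          ring = ℤ-Solver.solve-∀

        -- e² divides `n` and (2 x₀)², hence 4 n - (2 x₀)² = 4 d z₀², and it is coprime to z₀.
        e²≤4d : e * e ≤ 4 * d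
        e²≤4d = ∣⇒≤ {{m*n≢0 4 d}} (coprime-divisor e²⊥z (coprime-divisor e²⊥z (subst (e * e ∣_) eq
          (∣-combination (+ 4) (+ n) (ℤ.- + 1) (+ 2 ℤ.* x₀ ℤ.* (+ 2 ℤ.* x₀)) e²∣n
            (subst (e * e ∣_) (sym (ℤ.abs-* (+ 2 ℤ.* x₀) (+ 2 ℤ.* x₀))) (*-pres-∣ e∣2x₀ e∣2x₀))))))
          where
          e²⊥z : Coprime (e * e) ∣ z₀ ∣
          e²⊥z = coprime-∣ e²∣n (primitive⇒coprime d x₀ z₀ r₀ (proj₂ P₀))
          ring : ∀ d x z → + 4 ℤ.* (x ℤ.* x ℤ.+ d ℤ.* (z ℤ.* z)) ℤ.+ ℤ.- + 1 ℤ.* (+ 2 ℤ.* x ℤ.* (+ 2 ℤ.* x)) ≡ z ℤ.* (z ℤ.* (+ 4 ℤ.* d))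
          ring = ℤ-Solver.solve-∀
          eq : ∣ + 4 ℤ.* + n ℤ.+ ℤ.- + 1 ℤ.* (+ 2 ℤ.* x₀ ℤ.* (+ 2 ℤ.* x₀)) ∣ ≡ ∣ z₀ ∣ * (∣ z₀ ∣ * (4 * d))
          eq = begin
            ∣ + 4 ℤ.* + n ℤ.+ ℤ.- + 1 ℤ.* (+ 2 ℤ.* x₀ ℤ.* (+ 2 ℤ.* x₀)) ∣
              ≡⟨ cong (λ u → ∣ + 4 ℤ.* u ℤ.+ ℤ.- + 1 ℤ.* (+ 2 ℤ.* x₀ ℤ.* (+ 2 ℤ.* x₀)) ∣) r₀ ⟨
            ∣ + 4 ℤ.* (x₀ ℤ.* x₀ ℤ.+ + d ℤ.* (z₀ ℤ.* z₀)) ℤ.+ ℤ.- + 1 ℤ.* (+ 2 ℤ.* x₀ ℤ.* (+ 2 ℤ.* x₀)) ∣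
              ≡⟨ cong ∣_∣ (ring (+ d) x₀ z₀) ⟩
            ∣ z₀ ℤ.* (z₀ ℤ.* (+ 4 ℤ.* + d)) ∣
              ≡⟨ trans (ℤ.abs-* z₀ _) (cong (∣ z₀ ∣ *_) (ℤ.abs-* z₀ _)) ⟩
            ∣ z₀ ∣ * (∣ z₀ ∣ * ∣ + 4 ℤ.* + d ∣)
              ≡⟨ cong (λ u → ∣ z₀ ∣ * (∣ z₀ ∣ * u)) (ℤ.abs-* (+ 4) (+ d)) ⟩
            ∣ z₀ ∣ * (∣ z₀ ∣ * (4 * d)) ∎
            where open ≡-Reasoning

        -- z₀ times `minus p₁ q` is an integral combination of two multiples of `g`, and also of two
        -- multiples of `h`. As z₀ is coprime to `n`, both `g` and `h` divide `minus p₁ q`, and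
        -- `*-∣-gcd-*` combines them.
        n∣e*minus : ∀ q → Rep d n q → key p₀ q ≡ g → n ∣ e * ∣ minus p₁ q ∣
        n∣e*minus q@(x , z) r k≡ = subst (_∣ e * ∣ minus p₁ q ∣) (sym n≡h*g) (*-∣-gcd-* {g} {h}
          (coprime-divisor (coprime-∣ g∣n n⊥z₀) (subst (g ∣_) (trans (cong ∣_∣ (ring₁ x₀ z₀ x₁ z₁ x z)) (ℤ.abs-* z₀ (minus p₁ q)))
            (∣-combination z₁ (minus p₀ q) (ℤ.- z) (minus p₀ p₁) (g∣minus q k≡) (g∣minus p₁ refl))))
          (coprime-divisor (coprime-∣ (quotient-∣ g∣n) n⊥z₀) (subst (h ∣_) (trans (cong ∣_∣ (ring₂ x₀ z₀ x₁ z₁ x z)) (ℤ.abs-* z₀ (minus p₁ q)))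
            (∣-combination z (plus p₀ p₁) (ℤ.- z₁) (plus p₀ q) (h∣plus p₁ r₁ refl) (h∣plus q r k≡)))))
          where
          n⊥z₀ : Coprime n ∣ z₀ ∣
          n⊥z₀ = primitive⇒coprime d x₀ z₀ r₀ (proj₂ P₀)
          ring₁ : ∀ x z x′ z′ x″ z″ → z′ ℤ.* (x ℤ.* z″ ℤ.- x″ ℤ.* z) ℤ.+ ℤ.- z″ ℤ.* (x ℤ.* z′ ℤ.- x′ ℤ.* z) ≡ z ℤ.* (x′ ℤ.* z″ ℤ.- x″ ℤ.* z′)
          ring₁ = ℤ-Solver.solve-∀
          ring₂ : ∀ x z x′ z′ x″ z″ → z″ ℤ.* (x ℤ.* z′ ℤ.+ x′ ℤ.* z) ℤ.+ ℤ.- z′ ℤ.* (x ℤ.* z″ ℤ.+ x″ ℤ.* z) ≡ z ℤ.* (x′ ℤ.* z″ ℤ.- x″ ℤ.* z′)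
          ring₂ = ℤ-Solver.solve-∀

        AllowedMinus : ℤ → Set
        AllowedMinus D = n ∣ e * ∣ D ∣ × e * ∣ D ∣ ≤ 2 * n

        allowed : ∀ q → Rep d n q × key p₀ q ≡ g → AllowedMinus (minus p₁ q)
        allowed q (r , k≡) = n∣e*minus q r k≡ , m²≤n²⇒m≤n (begin
          e * D * (e * D)          ≡⟨ [m*n]*[o*p]≡[m*o]*[n*p] e D e D ⟩
          e * e * (D * D)          ≤⟨ *-monoˡ-≤ (D * D) e²≤4d ⟩
          4 * d * (D * D)          ≡⟨ *-assoc 4 d (D * D) ⟩
          4 * (d * (D * D))        ≤⟨ *-monoʳ-≤ 4 (m≤n+m (d * (D * D)) (∣ dot p₁ q ∣ * ∣ dot p₁ q ∣)) ⟩
          4 * (∣ dot p₁ q ∣ * ∣ dot p₁ q ∣ + d * (D * D)) ≡⟨ cong (4 *_) (rep-ℕ d (dot p₁ q) (minus p₁ q) (dot²+d*minus² p₁ q r₁ r)) ⟨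
          4 * (n * n)              ≡⟨ [m*n]*[o*p]≡[m*o]*[n*p] 2 2 n n ⟩
          2 * n * (2 * n) ∎)
          where
          open ≤-Reasoning
          D = ∣ minus p₁ q ∣

        Small-allowed : Small 5 AllowedMinus
        Small-allowed = Small-inj (λ D j → + e ℤ.* D ≡ j ℤ.* + n) image
          (λ {D} {D′} _ _ eq eq′ → ℤ.*-cancelˡ-≡ (+ e) D D′ (trans eq (sym eq′)))
          (Small-∈ (+ 0 ∷ + 1 ∷ + 2 ∷ ℤ.-[1+ 0 ] ∷ ℤ.-[1+ 1 ] ∷ []) λ {j} → small j)
          where
          small : ∀ j → ∣ j ∣ ≤ 2 → j ∈ + 0 ∷ + 1 ∷ + 2 ∷ ℤ.-[1+ 0 ] ∷ ℤ.-[1+ 1 ] ∷ []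
          small (+ 0) _ = here refl
          small (+ 1) _ = there (here refl)
          small (+ 2) _ = there (there (here refl))
          small (+ suc (suc (suc _))) (s≤s (s≤s ()))
          small ℤ.-[1+ 0 ] _ = there (there (there (here refl)))
          small ℤ.-[1+ 1 ] _ = there (there (there (there (here refl))))
          small ℤ.-[1+ suc (suc _) ] (s≤s (s≤s ()))
          image : ∀ D → AllowedMinus D → ∃[ j ] + e ℤ.* D ≡ j ℤ.* + n × ∣ j ∣ ≤ 2
          image D (n∣ , ≤2n) with ∣ℤ.∣ᵤ⇒∣ {+ n} {+ e ℤ.* D} (subst (n ∣_) (sym (ℤ.abs-* (+ e) D)) n∣)
          ... | ∣ℤ.divides j eq = j , eq , *-cancelʳ-≤ ∣ j ∣ 2 n (subst (_≤ 2 * n)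
            (trans (sym (ℤ.abs-* (+ e) D)) (trans (cong ∣_∣ eq) (ℤ.abs-* j (+ n)))) ≤2n)

      -- 10 = 5 · 2: five determinants, and for each of them two signs of `dot p₁ q`.
      Small-fibre : Small 10 (λ q → PRep q × key p₀ q ≡ key p₀ p₁)
      Small-fibre = Small-fibred ℤ._≟_ (minus p₁) (λ {q} ((r , _) , k≡) → allowed q (r , k≡)) Small-allowed λ D _ →
        Small-fibred ℤ._≟_ (dot p₁) (λ {q} (((r , _) , _) , D≡) → dot²≡ q r D≡) (Small-roots (+ (n * n) ℤ.- + d ℤ.* (D ℤ.* D))) λ s _ →
        Small-subsingleton λ {q} {q′} ((_ , D≡) , s≡) ((_ , D≡′) , s≡′) →
          dot,minus-injective p₁ q q′ r₁ (trans D≡ (sym D≡′)) (trans s≡ (sym s≡′))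
        where
        dot²≡ : ∀ q {D} → Rep d n q → minus p₁ q ≡ D → dot p₁ q ℤ.* dot p₁ q ≡ + (n * n) ℤ.- + d ℤ.* (D ℤ.* D)
        dot²≡ q r refl = trans (ring (dot p₁ q ℤ.* dot p₁ q) (+ d ℤ.* (minus p₁ q ℤ.* minus p₁ q)))
          (cong (ℤ._- + d ℤ.* (minus p₁ q ℤ.* minus p₁ q)) (dot²+d*minus² p₁ q r₁ r))
          where
          ring : ∀ a b → a ≡ a ℤ.+ b ℤ.- b
          ring = ℤ-Solver.solve-∀

  -- Two base points: p₀ serves to define the key, whose values divide `n`, and p₁ is a member of
  -- one fibre of the key.
  Small-primitive-Rep : ∀ {H} → Small H (_∣ n) → Small (H * 10) (λ p → Rep d n p × Primitive p)
  Small-primitive-Rep sH = Small-based λ p₀ P₀ →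
    Small-fibred _≟_ (key p₀) (λ {q} _ → gcd[m,n]∣n ∣ minus p₀ q ∣ n) sH λ k _ →
    Small-based λ { p₁ (P₁ , refl) → Small-fibre p₀ P₀ p₁ P₁ }

-- Lattice points common to two spheres

-- One `H` for all integers up to `W`, so that every loss of size m^ε becomes a power of the same
-- quantity.
DivisorBound : ℕ → ℕ → Set
DivisorBound W H = ∀ w .{{_ : NonZero w}} → w ≤ W → Small H (_∣ w)

ℕ⇒rep : ∀ {n} d x z → n ≡ ∣ x ∣ * ∣ x ∣ + d * (∣ z ∣ * ∣ z ∣) → Rep d n (x , z)
ℕ⇒rep d x z refl = begin
  x ℤ.* x ℤ.+ + d ℤ.* (z ℤ.* z)                       ≡⟨ cong₂ (λ u v → u ℤ.+ + d ℤ.* v) (square-abs x) (square-abs z) ⟩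
  + (∣ x ∣ * ∣ x ∣) ℤ.+ + d ℤ.* + (∣ z ∣ * ∣ z ∣)     ≡⟨ cong (ℤ._+_ (+ (∣ x ∣ * ∣ x ∣))) (sym (ℤ.pos-* d _)) ⟩
  + (∣ x ∣ * ∣ x ∣) ℤ.+ + (d * (∣ z ∣ * ∣ z ∣))       ≡⟨ ℤ.pos-+ (∣ x ∣ * ∣ x ∣) _ ⟨
  + (∣ x ∣ * ∣ x ∣ + d * (∣ z ∣ * ∣ z ∣)) ∎
  where open ≡-Reasoning

m*m≡0⇒m≡0 : ∀ m → m * m ≡ 0 → m ≡ 0
m*m≡0⇒m≡0 m eq = [ id , id ]′ (m*n≡0⇒m≡0∨n≡0 m eq)

rep-zero : ∀ d .{{_ : NonZero d}} {x z} → Rep d 0 (x , z) → (x , z) ≡ (+ 0 , + 0)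
rep-zero d {x} {z} r = cong₂ _,_ (ℤ.∣i∣≡0⇒i≡0 (m*m≡0⇒m≡0 ∣ x ∣ (m+n≡0⇒m≡0 (∣ x ∣ * ∣ x ∣) eq)))
  (ℤ.∣i∣≡0⇒i≡0 (m*m≡0⇒m≡0 ∣ z ∣ (m*n≡0⇒m≡0 (∣ z ∣ * ∣ z ∣) d (trans (*-comm _ d) (m+n≡0⇒n≡0 (∣ x ∣ * ∣ x ∣) eq)))))
  where
  eq : ∣ x ∣ * ∣ x ∣ + d * (∣ z ∣ * ∣ z ∣) ≡ 0
  eq = sym (rep-ℕ d x z r)

-- The first factor `H` pays for the content gcd(x, z), a divisor of `n`. After division by the
-- content γ, primitive representations of n / γ² remain. For n = 0 there is only the pair (0, 0).
Small-Rep : ∀ d .{{_ : NonZero d}} n {W H} → 1 ≤ H → DivisorBound W H → n ≤ W → Small (H * (H * 10)) (Rep d n)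
Small-Rep d zero 1≤H _ _ = Small-weaken (*-mono-≤ 1≤H (*-mono-≤ 1≤H (s≤s z≤n)))
  (Small-subsingleton λ r r′ → trans (rep-zero d r) (sym (rep-zero d r′)))
Small-Rep d n@(suc _) {W} {H} 1≤H bound n≤W =
  Small-fibred _≟_ content (λ {p} → content∣n p) (bound n n≤W) λ γ _ → Small-based λ { p (r , refl) → fibre p r }
  where
  content : ℤ × ℤ → ℕ
  content (x , z) = gcd ∣ x ∣ ∣ z ∣
  content∣n : ∀ p → Rep d n p → content p ∣ n
  content∣n (x , z) r = subst (content (x , z) ∣_) (sym (rep-ℕ d x z r)) (∣m∣n⇒∣m+n
    (∣m⇒∣m*n ∣ x ∣ (gcd[m,n]∣m ∣ x ∣ ∣ z ∣)) (∣n⇒∣m*n d (∣m⇒∣m*n ∣ z ∣ (gcd[m,n]∣n ∣ x ∣ ∣ z ∣))))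
  norm : ℤ × ℤ → ℕ
  norm (x , z) = ∣ x ∣ * ∣ x ∣ + d * (∣ z ∣ * ∣ z ∣)
  module _ (p : ℤ × ℤ) (r : Rep d n p) where
    γ = content p
    Scaled : ℤ × ℤ → ℤ × ℤ → Set
    Scaled (x , z) (x₁ , z₁) = x ≡ x₁ ℤ.* + γ × z ≡ z₁ ℤ.* + γ
    scale : ∀ q → content q ≡ γ → ∃[ q₁ ] Scaled q q₁
    scale (x , z) c≡ with ∣ℤ.∣ᵤ⇒∣ {+ γ} {x} (subst (_∣ ∣ x ∣) c≡ (gcd[m,n]∣m ∣ x ∣ ∣ z ∣)) | ∣ℤ.∣ᵤ⇒∣ {+ γ} {z} (subst (_∣ ∣ z ∣) c≡ (gcd[m,n]∣n ∣ x ∣ ∣ z ∣))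
    ... | ∣ℤ.divides x₁ ex | ∣ℤ.divides z₁ ez = (x₁ , z₁) , ex , ez
    n≡ : ∀ q q₁ → Rep d n q → Scaled q q₁ → n ≡ norm q₁ * (γ * γ)
    n≡ (x , z) (x₁ , z₁) r (refl , refl) = trans (rep-ℕ d x z r) (trans
      (cong₂ (λ u v → u * u + d * (v * v)) (ℤ.abs-* x₁ (+ γ)) (ℤ.abs-* z₁ (+ γ))) (ring d ∣ x₁ ∣ ∣ z₁ ∣ γ))
      where
      ring : ∀ d x z g → x * g * (x * g) + d * (z * g * (z * g)) ≡ (x * x + d * (z * z)) * (g * g)
      ring = ℕ-Solver.solve-∀
    p₁ = proj₁ (scale p refl)
    n₁ = norm p₁
    n≡n₁*γ² : n ≡ n₁ * (γ * γ)
    n≡n₁*γ² = n≡ p p₁ r (proj₂ (scale p refl))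
    instance
      n₁≢0 : NonZero n₁
      n₁≢0 = m*n≢0⇒m≢0 n₁ {{subst NonZero n≡n₁*γ² _}}
    γ²≢0 : NonZero (γ * γ)
    γ²≢0 = m*n≢0⇒n≢0 n₁ {{subst NonZero n≡n₁*γ² _}}
    γ≢0 : NonZero γ
    γ≢0 = m*n≢0⇒m≢0 γ {{γ²≢0}}
    n₁∣n : n₁ ∣ n
    n₁∣n = subst (n₁ ∣_) (sym n≡n₁*γ²) (m∣m*n (γ * γ))
    primitive₁ : ∀ q q₁ → content q ≡ γ → Scaled q q₁ → Primitive q₁
    primitive₁ (x , z) (x₁ , z₁) c≡ (refl , refl) = Coprime.gcd≡1⇒coprime (*-cancelˡ-≡ _ 1 γ {{γ≢0}} (begin
      γ * content (x₁ , z₁)                         ≡⟨ c*gcd[m,n]≡gcd[cm,cn] γ (∣ x₁ ∣) (∣ z₁ ∣) ⟩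
      gcd (γ * (∣ x₁ ∣)) (γ * (∣ z₁ ∣))             ≡⟨ cong₂ gcd (trans (*-comm γ _) (sym (ℤ.abs-* x₁ (+ γ)))) (trans (*-comm γ _) (sym (ℤ.abs-* z₁ (+ γ)))) ⟩
      content (x₁ ℤ.* + γ , z₁ ℤ.* + γ)             ≡⟨ c≡ ⟩
      γ                                             ≡⟨ *-identityʳ γ ⟨
      γ * 1 ∎))
      where open ≡-Reasoning
    fibre : Small (H * 10) (λ q → Rep d n q × content q ≡ γ)
    fibre = Small-inj Scaled
      (λ q@(x , z) (r′ , c≡) → let q₁@(x₁ , z₁) , s = scale q c≡ in q₁ , s ,
        ℕ⇒rep d x₁ z₁ (*-cancelʳ-≡ n₁ (norm q₁) (γ * γ) {{γ²≢0}} (trans (sym n≡n₁*γ²) (n≡ q q₁ r′ s))) ,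
        primitive₁ q q₁ c≡ s)
      (λ _ _ (ex , ez) (ex′ , ez′) → cong₂ _,_ (trans ex (sym ex′)) (trans ez (sym ez′)))
      (Small-primitive-Rep d n₁ (bound n₁ (≤-trans (∣⇒≤ n₁∣n) n≤W)))

subP : ∀ {d} → Point d → Point d → Point d
subP = zipWith ℤ._-_

*-cancelˡ-≢0 : ∀ {i j k} → i ≢ + 0 → i ℤ.* j ≡ i ℤ.* k → j ≡ k
*-cancelˡ-≢0 {i} {j} {k} i≢0 = ℤ.*-cancelˡ-≡ i j k {{ℤ.≢-nonZero i≢0}}

squares-sum≡0 : ∀ x y → x ℤ.* x ℤ.+ y ℤ.* y ≡ + 0 → x ≡ + 0 × y ≡ + 0
squares-sum≡0 x y eq = cong proj₁ xy≡0 , cong proj₂ xy≡0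
  where
  xy≡0 : (x , y) ≡ (+ 0 , + 0)
  xy≡0 = rep-zero 1 (trans (cong (ℤ._+_ (x ℤ.* x)) (ℤ.*-identityˡ (y ℤ.* y))) eq)

normSqℕ : Point 3 → ℕ
normSqℕ (x ∷ y ∷ z ∷ []) = ∣ x ∣ * ∣ x ∣ + (∣ y ∣ * ∣ y ∣ + ∣ z ∣ * ∣ z ∣)

normSq≡ : ∀ p → normSq p ≡ + normSqℕ p
normSq≡ (x ∷ y ∷ z ∷ []) = begin
  x ℤ.* x ℤ.+ (y ℤ.* y ℤ.+ (z ℤ.* z ℤ.+ + 0))                        ≡⟨ cong (λ w → x ℤ.* x ℤ.+ (y ℤ.* y ℤ.+ w)) (ℤ.+-identityʳ (z ℤ.* z)) ⟩
  x ℤ.* x ℤ.+ (y ℤ.* y ℤ.+ z ℤ.* z)                                  ≡⟨ cong₂ ℤ._+_ (square-abs x) (cong₂ ℤ._+_ (square-abs y) (square-abs z)) ⟩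
  + (∣ x ∣ * ∣ x ∣) ℤ.+ (+ (∣ y ∣ * ∣ y ∣) ℤ.+ + (∣ z ∣ * ∣ z ∣))     ≡⟨ cong (ℤ._+_ (+ (∣ x ∣ * ∣ x ∣))) (ℤ.pos-+ (∣ y ∣ * ∣ y ∣) _) ⟨
  + (∣ x ∣ * ∣ x ∣) ℤ.+ + (∣ y ∣ * ∣ y ∣ + ∣ z ∣ * ∣ z ∣)             ≡⟨ ℤ.pos-+ (∣ x ∣ * ∣ x ∣) _ ⟨
  + normSqℕ (x ∷ y ∷ z ∷ []) ∎
  where open ≡-Reasoning

module _ {m W H : ℕ} (1≤H : 1 ≤ H) (bound : DivisorBound W H) (4m*4m*m≤W : 4 * m * (4 * m * m) ≤ W) where

  private
    OnBoth : Point 3 → Point 3 → Set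
    OnBoth p b = InSphere 3 m b × InSphere 3 m (subP p b)

    dotP : Point 3 → Point 3 → ℤ
    dotP (p₁ ∷ p₂ ∷ p₃ ∷ []) (b₁ ∷ b₂ ∷ b₃ ∷ []) = p₁ ℤ.* b₁ ℤ.+ p₂ ℤ.* b₂ ℤ.+ p₃ ℤ.* b₃

    -- Subtracting the equations of the two spheres leaves the equation of their radical plane.
    2dot≡normSq : ∀ p b → OnBoth p b → + 2 ℤ.* dotP p b ≡ normSq p
    2dot≡normSq p@(p₁ ∷ p₂ ∷ p₃ ∷ []) b@(b₁ ∷ b₂ ∷ b₃ ∷ []) (on , on′) = begin
      + 2 ℤ.* dotP p b                            ≡⟨ ring p₁ p₂ p₃ b₁ b₂ b₃ ⟩
      normSq p ℤ.+ normSq b ℤ.- normSq (subP p b)  ≡⟨ cong₂ (λ u v → normSq p ℤ.+ u ℤ.- v) on on′ ⟩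
      normSq p ℤ.+ + m ℤ.- + m                    ≡⟨ cancel (normSq p) (+ m) ⟩
      normSq p ∎
      where
      open ≡-Reasoning
      ring : ∀ a b c x y z → + 2 ℤ.* (a ℤ.* x ℤ.+ b ℤ.* y ℤ.+ c ℤ.* z) ≡
        a ℤ.* a ℤ.+ (b ℤ.* b ℤ.+ (c ℤ.* c ℤ.+ + 0)) ℤ.+ (x ℤ.* x ℤ.+ (y ℤ.* y ℤ.+ (z ℤ.* z ℤ.+ + 0)))
        ℤ.- ((a ℤ.- x) ℤ.* (a ℤ.- x) ℤ.+ ((b ℤ.- y) ℤ.* (b ℤ.- y) ℤ.+ ((c ℤ.- z) ℤ.* (c ℤ.- z) ℤ.+ + 0)))
      ring = ℤ-Solver.solve-∀
      cancel : ∀ a b → a ℤ.+ b ℤ.- b ≡ a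
      cancel = ℤ-Solver.solve-∀

    dot-const : ∀ p b b′ → OnBoth p b → OnBoth p b′ → dotP p b ≡ dotP p b′
    dot-const p b b′ o o′ = ℤ.*-cancelˡ-≡ (+ 2) (dotP p b) (dotP p b′) (trans (2dot≡normSq p b o) (sym (2dot≡normSq p b′ o′)))

    -- The parallelogram law |p|² + |p - 2b|² = 2 |p - b|² + 2 |b|², whose right side is 4 m.
    normSqℕ≤4m : ∀ p b → OnBoth p b → normSqℕ p ≤ 4 * m
    normSqℕ≤4m p@(p₁ ∷ p₂ ∷ p₃ ∷ []) b@(b₁ ∷ b₂ ∷ b₃ ∷ []) (on , on′) =
      ≤-trans (m≤m+n (normSqℕ p) (normSqℕ c)) (≤-reflexive (ℤ.+-injective (begin
        + (normSqℕ p + normSqℕ c)                           ≡⟨ ℤ.pos-+ (normSqℕ p) (normSqℕ c) ⟩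
        + normSqℕ p ℤ.+ + normSqℕ c                         ≡⟨ cong₂ ℤ._+_ (normSq≡ p) (normSq≡ c) ⟨
        normSq p ℤ.+ normSq c                               ≡⟨ ring p₁ p₂ p₃ b₁ b₂ b₃ ⟩
        + 2 ℤ.* normSq (subP p b) ℤ.+ + 2 ℤ.* normSq b      ≡⟨ cong₂ (λ u v → + 2 ℤ.* u ℤ.+ + 2 ℤ.* v) on′ on ⟩
        + 2 ℤ.* + m ℤ.+ + 2 ℤ.* + m                         ≡⟨ four (+ m) ⟩
        + 4 ℤ.* + m                                         ≡⟨ ℤ.pos-* 4 m ⟨
        + (4 * m) ∎)))
      where
      open ≡-Reasoning
      c : Point 3
      c = subP (subP p b) b
      four : ∀ x → + 2 ℤ.* x ℤ.+ + 2 ℤ.* x ≡ + 4 ℤ.* x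
      four = ℤ-Solver.solve-∀
      ring : ∀ a b c x y z →
        a ℤ.* a ℤ.+ (b ℤ.* b ℤ.+ (c ℤ.* c ℤ.+ + 0)) ℤ.+ ((a ℤ.- x ℤ.- x) ℤ.* (a ℤ.- x ℤ.- x) ℤ.+ ((b ℤ.- y ℤ.- y) ℤ.* (b ℤ.- y ℤ.- y) ℤ.+ ((c ℤ.- z ℤ.- z) ℤ.* (c ℤ.- z ℤ.- z) ℤ.+ + 0)))
        ≡ + 2 ℤ.* ((a ℤ.- x) ℤ.* (a ℤ.- x) ℤ.+ ((b ℤ.- y) ℤ.* (b ℤ.- y) ℤ.+ ((c ℤ.- z) ℤ.* (c ℤ.- z) ℤ.+ + 0)))
          ℤ.+ + 2 ℤ.* (x ℤ.* x ℤ.+ (y ℤ.* y ℤ.+ (z ℤ.* z ℤ.+ + 0)))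
      ring = ℤ-Solver.solve-∀

    -- The points lie on the plane ⟨p, b⟩ = |p|² / 2. If p is vertical, its trace on the sphere is a circle x² + y² = n;
    -- otherwise b ↦ (|p|² b₃ − ⟨p, b⟩ p₃, p₁ b₂ − p₂ b₁) sends it injectively into X² + |p|² Z² = n.
    module Vertical (p₃ : ℤ) (p₃≢0 : p₃ ≢ + 0) (b : Point 3) (o : OnBoth (+ 0 ∷ + 0 ∷ p₃ ∷ []) b) where

      p : Point 3
      p = + 0 ∷ + 0 ∷ p₃ ∷ []

      third : Point 3 → ℤ
      third (_ ∷ _ ∷ b₃ ∷ []) = b₃

      third-const : ∀ c → OnBoth p c → third c ≡ third b
      third-const c oc = *-cancelˡ-≢0 p₃≢0 (trans (sym (drop c)) (trans (dot-const p c b oc o) (drop b)))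
        where
        ring : ∀ x y z w → + 0 ℤ.* x ℤ.+ + 0 ℤ.* y ℤ.+ w ℤ.* z ≡ w ℤ.* z
        ring = ℤ-Solver.solve-∀
        drop : ∀ c → dotP p c ≡ p₃ ℤ.* third c
        drop (x ∷ y ∷ z ∷ []) = ring x y z p₃

      planar : Point 3 → ℕ
      planar (x ∷ y ∷ _ ∷ []) = ∣ x ∣ * ∣ x ∣ + 1 * (∣ y ∣ * ∣ y ∣)

      m≡ : ∀ c → OnBoth p c → m ≡ planar c + ∣ third c ∣ * ∣ third c ∣
      m≡ c@(x ∷ y ∷ z ∷ []) (on , _) = ℤ.+-injective (trans (sym on) (trans (normSq≡ c) (cong +_ (ring (∣ x ∣ * ∣ x ∣) (∣ y ∣ * ∣ y ∣) (∣ z ∣ * ∣ z ∣)))))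
        where
        ring : ∀ a b c → a + (b + c) ≡ a + 1 * b + c
        ring = ℕ-Solver.solve-∀

      planar-const : ∀ c → OnBoth p c → planar b ≡ planar c
      planar-const c oc = +-cancelʳ-≡ (∣ third b ∣ * ∣ third b ∣) (planar b) (planar c)
        (trans (sym (m≡ b o)) (trans (m≡ c oc) (cong (λ z → planar c + ∣ z ∣ * ∣ z ∣) (third-const c oc))))

      small : m ≤ W → Small (H * (H * 10)) (OnBoth p)
      small m≤W = Small-inj (λ { (x ∷ y ∷ _ ∷ []) q → q ≡ (x , y) })
        (λ { c@(x ∷ y ∷ z ∷ []) oc → (x , y) , refl , ℕ⇒rep 1 x y (planar-const c oc) })
        (λ { {c@(_ ∷ _ ∷ _ ∷ [])} {c′@(_ ∷ _ ∷ _ ∷ [])} oc oc′ refl refl →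
             cong (λ z → _ ∷ _ ∷ z ∷ []) (trans (third-const c oc) (sym (third-const c′ oc′))) })
        (Small-Rep 1 (planar b) 1≤H bound (≤-trans (≤-trans (m≤m+n _ _) (≤-reflexive (sym (m≡ b o)))) m≤W))

    module Slanted (p₁ p₂ p₃ : ℤ) (s≢0 : p₁ ℤ.* p₁ ℤ.+ p₂ ℤ.* p₂ ≢ + 0) (b : Point 3) (o : OnBoth (p₁ ∷ p₂ ∷ p₃ ∷ []) b) where

      p : Point 3
      p = p₁ ∷ p₂ ∷ p₃ ∷ []
      d s : ℕ
      d = normSqℕ p
      s = ∣ p₁ ∣ * ∣ p₁ ∣ + ∣ p₂ ∣ * ∣ p₂ ∣
      k : ℤ
      k = dotP p b

      s≡ : p₁ ℤ.* p₁ ℤ.+ p₂ ℤ.* p₂ ≡ + s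
      s≡ = trans (cong₂ ℤ._+_ (square-abs p₁) (square-abs p₂)) (sym (ℤ.pos-+ (∣ p₁ ∣ * ∣ p₁ ∣) _))

      s≤d : s ≤ d
      s≤d = subst (s ≤_) (+-assoc (∣ p₁ ∣ * ∣ p₁ ∣) _ _) (m≤m+n s (∣ p₃ ∣ * ∣ p₃ ∣))

      instance
        d≢0 : NonZero d
        d≢0 = >-nonZero (<-≤-trans (n≢0⇒n>0 λ s≡0 → s≢0 (trans s≡ (cong +_ s≡0))) s≤d)

      flat : Point 3 → ℤ × ℤ
      flat (x ∷ y ∷ z ∷ []) = + d ℤ.* z ℤ.- k ℤ.* p₃ , p₁ ℤ.* y ℤ.- p₂ ℤ.* x

      target : ℤ
      target = (p₁ ℤ.* p₁ ℤ.+ p₂ ℤ.* p₂) ℤ.* (+ d ℤ.* + m ℤ.- k ℤ.* k)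

      -- With u = p₁x + p₂y and v = p₁y − p₂x, Lagrange's identity u² + v² = (p₁² + p₂²)(x² + y²)
      -- eliminates v, and what remains is a completed square in the third coordinate.
      form-flat : ∀ c → OnBoth p c → proj₁ (flat c) ℤ.* proj₁ (flat c) ℤ.+ + d ℤ.* (proj₂ (flat c) ℤ.* proj₂ (flat c)) ≡ target
      form-flat c@(x ∷ y ∷ z ∷ []) oc@(on , _) = begin
        (+ d ℤ.* z ℤ.- k ℤ.* p₃) ℤ.* (+ d ℤ.* z ℤ.- k ℤ.* p₃) ℤ.+ + d ℤ.* (v ℤ.* v)
          ≡⟨ cong₂ (λ D K → (D ℤ.* z ℤ.- K ℤ.* p₃) ℤ.* (D ℤ.* z ℤ.- K ℤ.* p₃) ℤ.+ D ℤ.* (v ℤ.* v)) d≡ (dot-const p b c o oc) ⟩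
        (D ℤ.* z ℤ.- K ℤ.* p₃) ℤ.* (D ℤ.* z ℤ.- K ℤ.* p₃) ℤ.+ D ℤ.* (v ℤ.* v)
          ≡⟨ cong (λ w → (D ℤ.* z ℤ.- K ℤ.* p₃) ℤ.* (D ℤ.* z ℤ.- K ℤ.* p₃) ℤ.+ D ℤ.* w) (lagrange p₁ p₂ x y) ⟩
        (D ℤ.* z ℤ.- K ℤ.* p₃) ℤ.* (D ℤ.* z ℤ.- K ℤ.* p₃) ℤ.+ D ℤ.* (S ℤ.* T ℤ.- u ℤ.* u)
          ≡⟨ complete-square S p₃ z u T ⟩
        S ℤ.* (D ℤ.* (T ℤ.+ z ℤ.* z) ℤ.- K ℤ.* K)
          ≡⟨ cong₂ (λ D K → S ℤ.* (D ℤ.* (T ℤ.+ z ℤ.* z) ℤ.- K ℤ.* K)) (sym d≡) (dot-const p c b oc o) ⟩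
        S ℤ.* (+ d ℤ.* (T ℤ.+ z ℤ.* z) ℤ.- k ℤ.* k)
          ≡⟨ cong (λ M → S ℤ.* (+ d ℤ.* M ℤ.- k ℤ.* k)) (trans (regroup (x ℤ.* x) (y ℤ.* y) (z ℤ.* z)) on) ⟩
        target ∎
        where
        open ≡-Reasoning
        u = p₁ ℤ.* x ℤ.+ p₂ ℤ.* y
        v = p₁ ℤ.* y ℤ.- p₂ ℤ.* x
        S = p₁ ℤ.* p₁ ℤ.+ p₂ ℤ.* p₂
        T = x ℤ.* x ℤ.+ y ℤ.* y
        D = S ℤ.+ p₃ ℤ.* p₃
        K = u ℤ.+ p₃ ℤ.* z
        regroup : ∀ a b c → a ℤ.+ b ℤ.+ c ≡ a ℤ.+ (b ℤ.+ (c ℤ.+ + 0))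
        regroup = ℤ-Solver.solve-∀
        d≡ : + d ≡ D
        d≡ = trans (sym (normSq≡ p)) (sym (regroup (p₁ ℤ.* p₁) (p₂ ℤ.* p₂) (p₃ ℤ.* p₃)))
        lagrange : ∀ a b x y → (a ℤ.* y ℤ.- b ℤ.* x) ℤ.* (a ℤ.* y ℤ.- b ℤ.* x)
          ≡ (a ℤ.* a ℤ.+ b ℤ.* b) ℤ.* (x ℤ.* x ℤ.+ y ℤ.* y) ℤ.- (a ℤ.* x ℤ.+ b ℤ.* y) ℤ.* (a ℤ.* x ℤ.+ b ℤ.* y)
        lagrange = ℤ-Solver.solve-∀
        complete-square : ∀ S c z u T →
          ((S ℤ.+ c ℤ.* c) ℤ.* z ℤ.- (u ℤ.+ c ℤ.* z) ℤ.* c) ℤ.* ((S ℤ.+ c ℤ.* c) ℤ.* z ℤ.- (u ℤ.+ c ℤ.* z) ℤ.* c)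
            ℤ.+ (S ℤ.+ c ℤ.* c) ℤ.* (S ℤ.* T ℤ.- u ℤ.* u)
          ≡ S ℤ.* ((S ℤ.+ c ℤ.* c) ℤ.* (T ℤ.+ z ℤ.* z) ℤ.- (u ℤ.+ c ℤ.* z) ℤ.* (u ℤ.+ c ℤ.* z))
        complete-square = ℤ-Solver.solve-∀

      n : ℕ
      n = ∣ proj₁ (flat b) ∣ * ∣ proj₁ (flat b) ∣ + d * (∣ proj₂ (flat b) ∣ * ∣ proj₂ (flat b) ∣)

      n≡target : + n ≡ target
      n≡target = trans (sym (ℕ⇒rep d (proj₁ (flat b)) (proj₂ (flat b)) refl)) (form-flat b o)

      n≤ : n ≤ s * (d * m)
      n≤ = ≤-trans (m≤m+n n (s * (∣ k ∣ * ∣ k ∣))) (≤-reflexive (ℤ.+-injective (begin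
        + (n + s * (∣ k ∣ * ∣ k ∣))                      ≡⟨ ℤ.pos-+ n _ ⟩
        + n ℤ.+ + (s * (∣ k ∣ * ∣ k ∣))                  ≡⟨ cong₂ ℤ._+_ n≡target (ℤ.pos-* s _) ⟩
        target ℤ.+ + s ℤ.* + (∣ k ∣ * ∣ k ∣)             ≡⟨ cong₂ (λ u v → u ℤ.* (+ d ℤ.* + m ℤ.- k ℤ.* k) ℤ.+ + s ℤ.* v) s≡ (sym (square-abs k)) ⟩
        + s ℤ.* (+ d ℤ.* + m ℤ.- k ℤ.* k) ℤ.+ + s ℤ.* (k ℤ.* k) ≡⟨ ring (+ s) (+ d ℤ.* + m) (k ℤ.* k) ⟩
        + s ℤ.* (+ d ℤ.* + m)                            ≡⟨ cong (ℤ._*_ (+ s)) (ℤ.pos-* d m) ⟨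
        + s ℤ.* + (d * m)                                ≡⟨ ℤ.pos-* s (d * m) ⟨
        + (s * (d * m)) ∎)))
        where
        open ≡-Reasoning
        ring : ∀ a b c → a ℤ.* (b ℤ.- c) ℤ.+ a ℤ.* c ≡ a ℤ.* b
        ring = ℤ-Solver.solve-∀

      -- The first coordinate of `flat` returns z, since d is not zero. The plane equation then
      -- returns p₁x + p₂y, and together with p₁y - p₂x this is a linear system for x and y with
      -- determinant p₁² + p₂².
      flat-injective : ∀ c c′ → OnBoth p c → OnBoth p c′ → flat c ≡ flat c′ → c ≡ c′
      flat-injective c@(x ∷ y ∷ z ∷ []) c′@(x′ ∷ y′ ∷ z′ ∷ []) oc oc′ eq =
        cong₂ _∷_ (*-cancelˡ-≢0 s≢0 (trans (ring₁ p₁ p₂ x y) (trans (cong₂ (λ u v → p₁ ℤ.* u ℤ.- p₂ ℤ.* v) u≡ v≡) (sym (ring₁ p₁ p₂ x′ y′)))))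
          (cong₂ _∷_ (*-cancelˡ-≢0 s≢0 (trans (ring₂ p₁ p₂ x y) (trans (cong₂ (λ u v → p₂ ℤ.* u ℤ.+ p₁ ℤ.* v) u≡ v≡) (sym (ring₂ p₁ p₂ x′ y′)))))
            (cong (_∷ []) z≡))
        where
        v≡ : p₁ ℤ.* y ℤ.- p₂ ℤ.* x ≡ p₁ ℤ.* y′ ℤ.- p₂ ℤ.* x′
        v≡ = cong proj₂ eq
        add : ∀ a b → a ≡ a ℤ.- b ℤ.+ b
        add = ℤ-Solver.solve-∀
        z≡ : z ≡ z′
        z≡ = ℤ.*-cancelˡ-≡ (+ d) z z′ (trans (add (+ d ℤ.* z) (k ℤ.* p₃)) (trans (cong (ℤ._+ k ℤ.* p₃) (cong proj₁ eq)) (sym (add (+ d ℤ.* z′) (k ℤ.* p₃)))))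
        drop : ∀ a b c → a ℤ.+ b ≡ a ℤ.+ b ℤ.+ c ℤ.- c
        drop = ℤ-Solver.solve-∀
        u≡ : p₁ ℤ.* x ℤ.+ p₂ ℤ.* y ≡ p₁ ℤ.* x′ ℤ.+ p₂ ℤ.* y′
        u≡ = trans (drop (p₁ ℤ.* x) (p₂ ℤ.* y) (p₃ ℤ.* z)) (trans (cong₂ (λ a b → a ℤ.- p₃ ℤ.* b) (dot-const p c c′ oc oc′) z≡)
               (sym (drop (p₁ ℤ.* x′) (p₂ ℤ.* y′) (p₃ ℤ.* z′))))
        ring₁ : ∀ a b x y → (a ℤ.* a ℤ.+ b ℤ.* b) ℤ.* x ≡ a ℤ.* (a ℤ.* x ℤ.+ b ℤ.* y) ℤ.- b ℤ.* (a ℤ.* y ℤ.- b ℤ.* x)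
        ring₁ = ℤ-Solver.solve-∀
        ring₂ : ∀ a b x y → (a ℤ.* a ℤ.+ b ℤ.* b) ℤ.* y ≡ b ℤ.* (a ℤ.* x ℤ.+ b ℤ.* y) ℤ.+ a ℤ.* (a ℤ.* y ℤ.- b ℤ.* x)
        ring₂ = ℤ-Solver.solve-∀

      small : Small (H * (H * 10)) (OnBoth p)
      small = Small-inj (λ c q → q ≡ flat c)
        (λ c oc → flat c , refl , trans (form-flat c oc) (sym n≡target))
        (λ {c} {c′} oc oc′ eq eq′ → flat-injective c c′ oc oc′ (trans (sym eq) eq′))
        -- The represented number is at most `s * (d * m)` with `s ≤ d ≤ 4 * m`; this is the origin
        -- of the hypothesis on `W`.
        (Small-Rep d n 1≤H bound (≤-trans n≤ (≤-trans (*-mono-≤ (≤-trans s≤d d≤4m) (*-monoˡ-≤ m d≤4m)) 4m*4m*m≤W)))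
        where
        d≤4m = normSqℕ≤4m p b o

  Small-two-spheres : ∀ {p} → p ≢ zeroP → Small (H * (H * 10)) (λ b → InSphere 3 m b × InSphere 3 m (subP p b))
  Small-two-spheres {p@(p₁ ∷ p₂ ∷ p₃ ∷ [])} p≢0 = Small-based based
    where
    m≤W : m ≤ W
    m≤W = ≤-trans (m≤4m*4m*m m) 4m*4m*m≤W
      where
      m≤4m*4m*m : ∀ m → m ≤ 4 * m * (4 * m * m)
      m≤4m*4m*m zero       = z≤n
      m≤4m*4m*m m@(suc _) = ≤-trans (m≤n*m m (4 * m)) (m≤n*m (4 * m * m) (4 * m))
    based : ∀ b → OnBoth p b → Small (H * (H * 10)) (OnBoth p)
    based b o with p₁ ℤ.* p₁ ℤ.+ p₂ ℤ.* p₂ ℤ.≟ + 0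
    ... | no  s≢0 = Slanted.small p₁ p₂ p₃ s≢0 b o
    ... | yes s≡0 with squares-sum≡0 p₁ p₂ s≡0
    ...   | refl , refl = Vertical.small p₃ (λ { refl → p≢0 refl }) b o m≤W

-- Sumsets and residue classes

_≟ᴾ_ : ∀ {d} → DecidableEquality (Point d)
_≟ᴾ_ = ≡-dec ℤ._≟_

energy : List (Point 3) → ℕ
energy L = ∑[ u ← L ] ∑[ v ← L ] ⟦ u ≟ᴾ v ⟧

_⊕_ : List (Point 3) → List (Point 3) → List (Point 3)
A ⊕ F = concatMap (λ a → map (addP a) F) A

∑-⊕ : ∀ A F (φ : Point 3 → ℕ) → ∑ (A ⊕ F) φ ≡ (∑[ a ← A ] ∑[ u ← F ] φ (addP a u))
∑-⊕ A F φ = trans (∑-concatMap (λ a → map (addP a) F) A φ) (∑-cong A λ a → ∑-map (addP a) F φ)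

length-⊕ : ∀ A F → length (A ⊕ F) ≡ length A * length F
length-⊕ A F = trans (sym (length-∑ (A ⊕ F))) (trans (∑-⊕ A F (λ _ → 1))
  (trans (∑-cong A λ _ → length-∑ F) (∑-const A (length F))))

length-cartesianProduct : ∀ {X Y : Set} (xs : List X) (ys : List Y) → length (cartesianProduct xs ys) ≡ length xs * length ys
length-cartesianProduct xs ys = trans (sym (length-∑ (cartesianProduct xs ys))) (trans (∑-cartesianProduct xs ys (λ _ → 1))
  (trans (∑-cong xs λ _ → length-∑ ys) (∑-const xs (length ys))))

∑*∑ : ∀ {X Y : Set} (xs : List X) (ys : List Y) (f : X → ℕ) (g : Y → ℕ) → ∑ xs f * ∑ ys g ≡ (∑[ x ← xs ] ∑[ y ← ys ] (f x * g y))
∑*∑ xs ys f g = trans (∑-*ʳ xs (∑ ys g) f) (∑-cong xs λ x → ∑-*ˡ ys (f x) g)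

addP≡⇒≡subP : ∀ {x a v : Point 3} → x ≡ addP a v → a ≡ subP x v
addP≡⇒≡subP {a = a₁ ∷ a₂ ∷ a₃ ∷ []} {v₁ ∷ v₂ ∷ v₃ ∷ []} refl =
  cong₂ _∷_ (ring a₁ v₁) (cong₂ _∷_ (ring a₂ v₂) (cong (_∷ []) (ring a₃ v₃)))
  where
  ring : ∀ a v → a ≡ a ℤ.+ v ℤ.- v
  ring = ℤ-Solver.solve-∀

subP≡0⇒≡ : ∀ {u v : Point 3} → subP u v ≡ zeroP → u ≡ v
subP≡0⇒≡ {u₁ ∷ u₂ ∷ u₃ ∷ []} {v₁ ∷ v₂ ∷ v₃ ∷ []} eq = cong₂ _∷_ (ℤ.i-j≡0⇒i≡j u₁ v₁ (cong head eq))
  (cong₂ _∷_ (ℤ.i-j≡0⇒i≡j u₂ v₂ (cong (λ p → head (tail p)) eq))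
    (cong (_∷ []) (ℤ.i-j≡0⇒i≡j u₃ v₃ (cong (λ p → head (tail (tail p))) eq))))

normSq-subP-comm : ∀ (u v : Point 3) → normSq (subP u v) ≡ normSq (subP v u)
normSq-subP-comm (a ∷ b ∷ c ∷ []) (x ∷ y ∷ z ∷ []) = ring a b c x y z
  where
  ring : ∀ a b c x y z → (a ℤ.- x) ℤ.* (a ℤ.- x) ℤ.+ ((b ℤ.- y) ℤ.* (b ℤ.- y) ℤ.+ ((c ℤ.- z) ℤ.* (c ℤ.- z) ℤ.+ + 0))
    ≡ (x ℤ.- a) ℤ.* (x ℤ.- a) ℤ.+ ((y ℤ.- b) ℤ.* (y ℤ.- b) ℤ.+ ((z ℤ.- c) ℤ.* (z ℤ.- c) ℤ.+ + 0))
  ring = ℤ-Solver.solve-∀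

subP-shift : ∀ {a u b v : Point 3} → addP a u ≡ addP b v → b ≡ subP a (subP v u)
subP-shift {a₁ ∷ a₂ ∷ a₃ ∷ []} {u₁ ∷ u₂ ∷ u₃ ∷ []} {b₁ ∷ b₂ ∷ b₃ ∷ []} {v₁ ∷ v₂ ∷ v₃ ∷ []} eq =
  trans (addP≡⇒≡subP eq) (cong₂ _∷_ (ring a₁ u₁ v₁) (cong₂ _∷_ (ring a₂ u₂ v₂) (cong (_∷ []) (ring a₃ u₃ v₃))))
  where
  ring : ∀ a u v → a ℤ.+ u ℤ.- v ≡ a ℤ.- (v ℤ.- u)
  ring = ℤ-Solver.solve-∀

toPoint : ℕ × ℕ × ℕ → Point 3
toPoint (x , y , z) = + x ∷ + y ∷ + z ∷ []

-- Representatives of the classes modulo `q`, chosen so that the boxes are nested: one integer point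
-- can then be followed through all moduli.
box : ℕ → List (Point 3)
box q = map toPoint (cartesianProduct (upTo q) (cartesianProduct (upTo q) (upTo q)))

box! : ∀ q → Unique (box q)
box! q = Unique.map⁺ (λ { refl → refl }) (Unique.cartesianProduct⁺ (Unique.upTo⁺ q) (Unique.cartesianProduct⁺ (Unique.upTo⁺ q) (Unique.upTo⁺ q)))

∈-box⁺ : ∀ {q x y z} → x < q → y < q → z < q → toPoint (x , y , z) ∈ box q
∈-box⁺ x< y< z< = ∈-map⁺ toPoint (∈-cartesianProduct⁺ (∈-upTo⁺ x<) (∈-cartesianProduct⁺ (∈-upTo⁺ y<) (∈-upTo⁺ z<)))

∈-box⁻ : ∀ q {c} → c ∈ box q → ∃[ x ] ∃[ y ] ∃[ z ] c ≡ toPoint (x , y , z) × x < q × y < q × z < q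
∈-box⁻ q c∈ with ∈-map⁻ toPoint c∈
... | (x , y , z) , p∈ , eq =
  let x∈ , yz∈ = ∈-cartesianProduct⁻ (upTo q) (cartesianProduct (upTo q) (upTo q)) p∈
      y∈ , z∈ = ∈-cartesianProduct⁻ (upTo q) (upTo q) yz∈
  in x , y , z , eq , ∈-upTo⁻ x∈ , ∈-upTo⁻ y∈ , ∈-upTo⁻ z∈

box-mono : ∀ {q K c} → q ≤ K → c ∈ box q → c ∈ box K
box-mono {q} q≤K c∈ with ∈-box⁻ q c∈
... | _ , _ , _ , refl , x< , y< , z< = ∈-box⁺ (<-≤-trans x< q≤K) (<-≤-trans y< q≤K) (<-≤-trans z< q≤K)

length-box : ∀ q → length (box q) ≡ q * (q * q)
length-box q = begin
  length (box q)                                        ≡⟨ List.length-map toPoint (cartesianProduct (upTo q) (cartesianProduct (upTo q) (upTo q))) ⟩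
  length (cartesianProduct (upTo q) (cartesianProduct (upTo q) (upTo q))) ≡⟨ length-cartesianProduct (upTo q) _ ⟩
  length (upTo q) * length (cartesianProduct (upTo q) (upTo q)) ≡⟨ cong (length (upTo q) *_) (length-cartesianProduct (upTo q) (upTo q)) ⟩
  length (upTo q) * (length (upTo q) * length (upTo q)) ≡⟨ cong (λ l → l * (l * l)) (List.length-upTo q) ⟩
  q * (q * q) ∎
  where open ≡-Reasoning

residue : ∀ q .{{_ : NonZero q}} → Point 3 → Point 3
residue q (x ∷ y ∷ z ∷ []) = toPoint (x %ℕ q , y %ℕ q , z %ℕ q)

residue∈box : ∀ q .{{_ : NonZero q}} u → residue q u ∈ box q
residue∈box q (x ∷ y ∷ z ∷ []) = ∈-box⁺ (n%ℕd<d x q) (n%ℕd<d y q) (n%ℕd<d z q)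

-- The power of the point `u` with respect to the sphere of radius √m around `n`.
offset : ℕ → Point 3 → Point 3 → ℤ
offset m n u = normSq (subP n u) ℤ.- + m

offset-residue : ∀ m q .{{_ : NonZero q}} n u → ∃[ k ] offset m n u ≡ offset m n (residue q u) ℤ.+ k ℤ.* + q
offset-residue m q (n₁ ∷ n₂ ∷ n₃ ∷ []) (x ∷ y ∷ z ∷ []) = carry n₁ x ℤ.+ carry n₂ y ℤ.+ carry n₃ z , trans
  (cong (ℤ._- + m) (cong₂ ℤ._+_ (coordinate n₁ x) (cong₂ ℤ._+_ (coordinate n₂ y) (cong (ℤ._+ + 0) (coordinate n₃ z)))))
  (collect (sq (n₁ ℤ.- + (x %ℕ q))) (sq (n₂ ℤ.- + (y %ℕ q))) (sq (n₃ ℤ.- + (z %ℕ q))) (carry n₁ x) (carry n₂ y) (carry n₃ z) (+ q) (+ m))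
  where
  sq : ℤ → ℤ
  sq a = a ℤ.* a
  carry : ℤ → ℤ → ℤ
  carry n x = (x /ℕ q) ℤ.* ((x /ℕ q) ℤ.* + q ℤ.- + 2 ℤ.* (n ℤ.- + (x %ℕ q)))
  ring : ∀ n r k q → (n ℤ.- (r ℤ.+ k ℤ.* q)) ℤ.* (n ℤ.- (r ℤ.+ k ℤ.* q)) ≡ (n ℤ.- r) ℤ.* (n ℤ.- r) ℤ.+ k ℤ.* (k ℤ.* q ℤ.- + 2 ℤ.* (n ℤ.- r)) ℤ.* q
  ring = ℤ-Solver.solve-∀
  coordinate : ∀ n x → sq (n ℤ.- x) ≡ sq (n ℤ.- + (x %ℕ q)) ℤ.+ carry n x ℤ.* + q
  coordinate n x = trans (cong (λ x → sq (n ℤ.- x)) (a≡a%ℕn+[a/ℕn]*n x q)) (ring n (+ (x %ℕ q)) (x /ℕ q) (+ q))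
  collect : ∀ a b c i j k q m → a ℤ.+ i ℤ.* q ℤ.+ (b ℤ.+ j ℤ.* q ℤ.+ (c ℤ.+ k ℤ.* q ℤ.+ + 0)) ℤ.- m
    ≡ a ℤ.+ (b ℤ.+ (c ℤ.+ + 0)) ℤ.- m ℤ.+ (i ℤ.+ j ℤ.+ k) ℤ.* q
  collect = ℤ-Solver.solve-∀

∣offset⇔ : ∀ m q .{{_ : NonZero q}} n u → (q ∣ ∣ offset m n u ∣ → q ∣ ∣ offset m n (residue q u) ∣) × (q ∣ ∣ offset m n (residue q u) ∣ → q ∣ ∣ offset m n u ∣)
∣offset⇔ m q n u with offset-residue m q n u
... | k , eq = (λ d → ∣ℤ.∣⇒∣ᵤ (∣ℤ.∣m+n∣n⇒∣m {m = offset m n (residue q u)} (subst (+ q ∣ℤ.∣_) eq (∣ℤ.∣ᵤ⇒∣ {+ q} {offset m n u} d)) (∣ℤ.∣n⇒∣m*n k ∣ℤ.∣-refl))) ,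
  (λ d → ∣ℤ.∣⇒∣ᵤ (subst (+ q ∣ℤ.∣_) (sym eq) (∣ℤ.∣m∣n⇒∣m+n (∣ℤ.∣ᵤ⇒∣ {+ q} {offset m n (residue q u)} d) (∣ℤ.∣n⇒∣m*n k ∣ℤ.∣-refl))))

-- Two coordinates leave two choices for the third. This crude bound is enough: these points are
-- counted for all K moduli, and K · 2K² has the same order as the count of the remaining points.
Small-lattice-sphere : ∀ m K n → Small (K * K * 2) (λ c → c ∈ box K × offset m n c ≡ + 0)
Small-lattice-sphere m K (n₁ ∷ n₂ ∷ n₃ ∷ []) =
  Small-fibred (×-≡-dec ℤ._≟_ ℤ._≟_) first-two (λ { (c∈ , _) → first-two∈ c∈ }) (Small-weaken (≤-reflexive len) (Small-∈ grid id)) λ xy _ →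
  Small-based λ { (x ∷ y ∷ z₀ ∷ []) ((_ , on₀) , refl) →
    Small-inj (λ { (_ ∷ _ ∷ z ∷ []) r → r ≡ n₃ ℤ.- z })
      (λ { (x ∷ y ∷ z ∷ []) ((_ , on) , refl) → n₃ ℤ.- z , refl , third x y z z₀ on on₀ })
      (λ { {_ ∷ _ ∷ z ∷ []} {_ ∷ _ ∷ z′ ∷ []} ((_ , _) , refl) ((_ , _) , refl) eq eq′ →
        cong (λ z → _ ∷ _ ∷ z ∷ []) (ℤ.neg-injective (ℤ-cancel n₃ (ℤ.- z) (ℤ.- z′) (trans (sym eq) eq′))) })
      (Small-roots ((n₃ ℤ.- z₀) ℤ.* (n₃ ℤ.- z₀))) }
  where
  ints : List ℤ
  ints = map +_ (upTo K)
  grid : List (ℤ × ℤ)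
  grid = cartesianProduct ints ints
  len : length grid ≡ K * K
  len = trans (length-cartesianProduct ints ints) (cong (λ l → l * l) (trans (List.length-map +_ (upTo K)) (List.length-upTo K)))
  first-two : Point 3 → ℤ × ℤ
  first-two (x ∷ y ∷ _ ∷ []) = x , y
  first-two∈ : ∀ {c} → c ∈ box K → first-two c ∈ grid
  first-two∈ c∈ with ∈-box⁻ K c∈
  ... | _ , _ , _ , refl , x< , y< , _ = ∈-cartesianProduct⁺ (∈-map⁺ +_ (∈-upTo⁺ x<)) (∈-map⁺ +_ (∈-upTo⁺ y<))
  ℤ-cancel : ∀ a b c → a ℤ.+ b ≡ a ℤ.+ c → b ≡ c
  ℤ-cancel a b c eq = trans (ring a b) (trans (cong (ℤ._- a) eq) (sym (ring a c)))
    where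
    ring : ∀ a b → b ≡ a ℤ.+ b ℤ.- a
    ring = ℤ-Solver.solve-∀
  third : ∀ x y z z₀ → offset m (n₁ ∷ n₂ ∷ n₃ ∷ []) (x ∷ y ∷ z ∷ []) ≡ + 0 → offset m (n₁ ∷ n₂ ∷ n₃ ∷ []) (x ∷ y ∷ z₀ ∷ []) ≡ + 0 →
          (n₃ ℤ.- z) ℤ.* (n₃ ℤ.- z) ≡ (n₃ ℤ.- z₀) ℤ.* (n₃ ℤ.- z₀)
  third x y z z₀ on on₀ = trans (ring (sq (n₁ ℤ.- x)) (sq (n₂ ℤ.- y)) (sq (n₃ ℤ.- z)) (+ m))
    (trans (cong (λ w → w ℤ.- sq (n₁ ℤ.- x) ℤ.- sq (n₂ ℤ.- y) ℤ.+ + m) (trans on (sym on₀)))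
      (sym (ring (sq (n₁ ℤ.- x)) (sq (n₂ ℤ.- y)) (sq (n₃ ℤ.- z₀)) (+ m))))
    where
    sq : ℤ → ℤ
    sq a = a ℤ.* a
    ring : ∀ a b c m → c ≡ a ℤ.+ (b ℤ.+ (c ℤ.+ + 0)) ℤ.- m ℤ.- a ℤ.- b ℤ.+ m
    ring = ℤ-Solver.solve-∀

divisor-count : ∀ {W H} → DivisorBound W H → ∀ K w → w ≤ W → (∑[ i ← upTo K ] ⟦ suc i ∣? w ⟧) ≤ K * ⟦ w ≟ 0 ⟧ + H
divisor-count bound K zero    _   = ≤-trans (∑-≤const (upTo K) {c = 1} (λ {i} _ → ⟦⟧≤1 (suc i ∣? 0)))
  (≤-trans (≤-reflexive (cong (_* 1) (List.length-upTo K))) (m≤m+n (K * 1) _))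
divisor-count bound K w@(suc _) w≤W = ≤-trans (≤-reflexive (sym (∑-map suc (upTo K) (λ q → ⟦ q ∣? w ⟧))))
  (≤-trans (∑⟦⟧≤ (_∣? w) (Unique.map⁺ suc-injective (Unique.upTo⁺ K)) (λ _ → id) (bound w w≤W)) (m≤n+m _ (K * 0)))

-- The incidence inequality

module Incidence (m : ℕ) (A F : List (Point 3)) (A! : Unique A) (A⊂S : All (InSphere 3 m) A) (t : ℕ)
  (two-spheres : ∀ {p} → p ≢ zeroP → Small t (λ b → InSphere 3 m b × InSphere 3 m (subP p b))) where

  private
    N M e : ℕ
    N = length A
    M = length F
    e = energy F
    G 𝒩 : List (Point 3)
    G = A ⊕ F
    𝒩 = deduplicate _≟ᴾ_ G

    𝒩! : Unique 𝒩
    𝒩! = deduplicate-! _≟ᴾ_ G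

  -- hits u n is the indicator of n − u ∈ A, so rep n counts the representations of n in A ⊕ F.
  hits : Point 3 → Point 3 → ℕ
  hits u n = ∑[ a ← A ] ⟦ n ≟ᴾ addP a u ⟧

  rep : Point 3 → ℕ
  rep n = ∑[ u ← F ] hits u n

  hits≤1 : ∀ u n → hits u n ≤ 1
  hits≤1 u n = ≤-trans (∑-mono A λ a → ⟦⟧-mono (n ≟ᴾ addP a u) (a ≟ᴾ subP n u) addP≡⇒≡subP) (∑-⟦≟⟧-≤1 _≟ᴾ_ (subP n u) A!)

  hits-≤ : ∀ {D : Set} u n (D? : Dec D) → (∀ {a} → a ∈ A → n ≡ addP a u → D) → hits u n ≤ ⟦ D? ⟧
  hits-≤ u n (yes _) _ = hits≤1 u n
  hits-≤ u n (no ¬d) f = ≤-trans (∑-≤const A λ {a} a∈ → ≤-reflexive (⟦⟧-no (n ≟ᴾ addP a u) λ eq → ¬d (f a∈ eq))) (≤-reflexive (*-zeroʳ N))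

  rep-G : ∀ n → (∑[ x ← G ] ⟦ n ≟ᴾ x ⟧) ≡ rep n
  rep-G n = trans (∑-⊕ A F (λ x → ⟦ n ≟ᴾ x ⟧)) (∑-swap A F λ a u → ⟦ n ≟ᴾ addP a u ⟧)

  energy≡∑rep² : energy G ≡ (∑[ n ← 𝒩 ] (rep n * rep n))
  energy≡∑rep² = begin
    (∑[ x ← G ] ∑[ y ← G ] ⟦ x ≟ᴾ y ⟧)             ≡⟨ ∑-cong G rep-G ⟩
    (∑[ x ← G ] rep x)                             ≡⟨ ∑-cong∈ G (λ x∈ → ∑-pick _≟ᴾ_ rep 𝒩! (∈-deduplicate⁺ _≟ᴾ_ x∈)) ⟨
    (∑[ x ← G ] ∑[ n ← 𝒩 ] (⟦ n ≟ᴾ x ⟧ * rep n))    ≡⟨ ∑-swap G 𝒩 _ ⟩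
    (∑[ n ← 𝒩 ] ∑[ x ← G ] (⟦ n ≟ᴾ x ⟧ * rep n))    ≡⟨ ∑-cong 𝒩 (λ n → ∑-*ʳ G (rep n) λ x → ⟦ n ≟ᴾ x ⟧) ⟨
    (∑[ n ← 𝒩 ] ((∑[ x ← G ] ⟦ n ≟ᴾ x ⟧) * rep n))  ≡⟨ ∑-cong 𝒩 (λ n → cong (_* rep n) (rep-G n)) ⟩
    (∑[ n ← 𝒩 ] (rep n * rep n)) ∎
    where open ≡-Reasoning

  common : Point 3 → Point 3 → ℕ
  common u v = ∑[ n ← 𝒩 ] (hits u n * hits v n)

  common≤∑hits : ∀ u v → common u v ≤ (∑[ a ← A ] hits v (addP a u))
  common≤∑hits u v = begin
    (∑[ n ← 𝒩 ] (hits u n * hits v n))                       ≡⟨ ∑-cong 𝒩 (λ n → ∑-*ʳ A (hits v n) λ a → ⟦ n ≟ᴾ addP a u ⟧) ⟩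
    (∑[ n ← 𝒩 ] ∑[ a ← A ] (⟦ n ≟ᴾ addP a u ⟧ * hits v n))    ≡⟨ ∑-swap 𝒩 A _ ⟩
    (∑[ a ← A ] ∑[ n ← 𝒩 ] (⟦ n ≟ᴾ addP a u ⟧ * hits v n))    ≤⟨ ∑-mono A (λ a → ∑-pick-≤ _≟ᴾ_ (addP a u) (hits v) 𝒩!) ⟩
    (∑[ a ← A ] hits v (addP a u)) ∎
    where open ≤-Reasoning

  -- For distinct `u` and `v`, an equality a + u = b + v with `b` in `A` puts `a` on the spheres
  -- around 0 and around v - u. For `u ≡ v` the trivial bound `N` is all there is.
  ∑hits≤ : ∀ u v → (∑[ a ← A ] hits v (addP a u)) ≤ t + N * ⟦ u ≟ᴾ v ⟧
  ∑hits≤ u v with u ≟ᴾ v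
  ... | yes _  = ≤-trans (∑-≤const A λ {a} _ → hits≤1 v (addP a u)) (m≤n+m (N * 1) t)
  ... | no u≢v = ≤-trans (∑-mono A λ a → hits-≤ v (addP a u) (normSq (subP (subP v u) a) ℤ.≟ + m) (on-sphere a))
    (≤-trans (∑⟦⟧≤ (λ a → normSq (subP (subP v u) a) ℤ.≟ + m) A! (λ a∈ on → All.lookup A⊂S a∈ , on)
      (two-spheres λ eq → u≢v (sym (subP≡0⇒≡ eq)))) (m≤m+n t _))
    where
    on-sphere : ∀ a {b} → b ∈ A → addP a u ≡ addP b v → normSq (subP (subP v u) a) ≡ + m
    on-sphere a {b} b∈ eq = trans (normSq-subP-comm (subP v u) a)
      (trans (cong normSq (sym (subP-shift {a} {u} {b} {v} eq))) (All.lookup A⊂S b∈))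

  module Modulo (q : ℕ) .{{_ : NonZero q}} where

    inClass : Point 3 → Point 3 → ℕ
    inClass c u = ⟦ c ≟ᴾ residue q u ⟧

    repᶜ : Point 3 → Point 3 → ℕ
    repᶜ c n = ∑[ u ← F ] (inClass c u * hits u n)

    -- A necessary condition for the sphere around n to meet the class c, which depends on n and c modulo q only.
    touches : Point 3 → Point 3 → ℕ
    touches c n = ⟦ q ∣? ∣ offset m n c ∣ ⟧

    -- `χ c`, `f c` and `φ c` are the shares of the class `c` in `energy G`, in `M` and in `e`.
    -- `α c` and `β c` are the two factors into which Cauchy-Schwarz over `n` splits `χ c`.
    α β χ f φ : Point 3 → ℕ
    α c = ∑[ n ← 𝒩 ] (touches c n * (rep n * rep n))
    β c = ∑[ n ← 𝒩 ] (repᶜ c n * repᶜ c n)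
    χ c = ∑[ n ← 𝒩 ] (rep n * repᶜ c n)
    f c = ∑[ u ← F ] inClass c u
    φ c = ∑[ u ← F ] (inClass c u * (∑[ v ← F ] ⟦ u ≟ᴾ v ⟧))

    ∑-inClass : ∀ (ψ : Point 3 → Point 3 → ℕ) → (∑[ c ← box q ] ∑[ u ← F ] (inClass c u * ψ c u)) ≡ (∑[ u ← F ] ψ (residue q u) u)
    ∑-inClass ψ = trans (∑-swap (box q) F _)
      (∑-cong F λ u → ∑-pick _≟ᴾ_ (λ c → ψ c u) (box! q) (residue∈box q u))

    ∑f : (∑[ c ← box q ] f c) ≡ M
    ∑f = trans (∑-cong (box q) λ c → ∑-cong F λ u → sym (*-identityʳ (inClass c u)))
      (trans (∑-inClass λ _ _ → 1) (length-∑ F))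

    ∑φ : (∑[ c ← box q ] φ c) ≡ e
    ∑φ = ∑-inClass λ _ u → ∑ F λ v → ⟦ u ≟ᴾ v ⟧

    ∑χ : (∑[ c ← box q ] χ c) ≡ energy G
    ∑χ = begin
      (∑[ c ← box q ] ∑[ n ← 𝒩 ] (rep n * repᶜ c n))   ≡⟨ ∑-swap (box q) 𝒩 _ ⟩
      (∑[ n ← 𝒩 ] ∑[ c ← box q ] (rep n * repᶜ c n))   ≡⟨ ∑-cong 𝒩 (λ n → ∑-*ˡ (box q) (rep n) λ c → repᶜ c n) ⟨
      (∑[ n ← 𝒩 ] (rep n * (∑[ c ← box q ] repᶜ c n))) ≡⟨ ∑-cong 𝒩 (λ n → cong (rep n *_) (∑-inClass λ _ u → hits u n)) ⟩
      (∑[ n ← 𝒩 ] (rep n * rep n))                     ≡⟨ energy≡∑rep² ⟨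
      energy G ∎
      where open ≡-Reasoning

    addP-touches : ∀ {a u n} → a ∈ A → n ≡ addP a u → q ∣ ∣ offset m n (residue q u) ∣
    addP-touches {a} {u} {n} a∈ eq = proj₁ (∣offset⇔ m q n u) (subst (q ∣_) (cong ∣_∣ (sym offset≡0)) (q ∣0))
      where
      offset≡0 : offset m n u ≡ + 0
      offset≡0 = ℤ.i≡j⇒i-j≡0 (trans (cong normSq (sym (addP≡⇒≡subP eq))) (All.lookup A⊂S a∈))

    repᶜ-touches : ∀ c n → repᶜ c n ≡ touches c n * repᶜ c n
    repᶜ-touches c n with q ∣? ∣ offset m n c ∣
    ... | yes _ = sym (*-identityˡ (repᶜ c n))
    ... | no q∤ = n≤0⇒n≡0 (≤-trans (∑-mono F λ u → ⟦⟧-*-mono (c ≟ᴾ residue q u) λ { refl →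
        hits-≤ u n (no q∤) λ a∈ eq → addP-touches {u = u} a∈ eq })
      (≤-trans (∑-≤const F λ {u} _ → ≤-reflexive (*-zeroʳ (inClass c u))) (≤-reflexive (*-zeroʳ M))))

    -- Since `repᶜ c n` vanishes unless the sphere around `n` touches the class, `touches` can be
    -- inserted before Cauchy-Schwarz. It ends up in `α`, which thereby sees only the touching
    -- spheres.
    χ²≤αβ : ∀ c → χ c * χ c ≤ α c * β c
    χ²≤αβ c = subst (_≤ α c * β c) (*-identityˡ (χ c * χ c)) (cauchy-schwarz 1 𝒩 _ _ _ λ n → begin
      1 * (rep n * repᶜ c n * (rep n * repᶜ c n))                  ≡⟨ regroup (rep n) (repᶜ c n) ⟩
      rep n * rep n * (repᶜ c n * repᶜ c n)                        ≡⟨ cong (λ r → rep n * rep n * (r * repᶜ c n)) (repᶜ-touches c n) ⟩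
      rep n * rep n * (touches c n * repᶜ c n * repᶜ c n)          ≡⟨ regroup′ (rep n) (touches c n) (repᶜ c n) ⟩
      touches c n * (rep n * rep n) * (repᶜ c n * repᶜ c n) ∎)
      where
      open ≤-Reasoning
      regroup : ∀ a b → 1 * (a * b * (a * b)) ≡ a * a * (b * b)
      regroup = ℕ-Solver.solve-∀
      regroup′ : ∀ a b c → a * a * (b * c * c) ≡ b * (a * a) * (c * c)
      regroup′ = ℕ-Solver.solve-∀

    -- Opening the square counts spheres through two points of the class: at most `t` for distinct
    -- points, at most `N` for coinciding ones. In the latter case one of the two class indicators
    -- is bounded by 1.
    β≤ : ∀ c → β c ≤ t * (f c * f c) + N * φ c
    β≤ c = begin
      (∑[ n ← 𝒩 ] (repᶜ c n * repᶜ c n))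
        ≡⟨ ∑-cong 𝒩 (λ n → ∑*∑ F F (λ u → inClass c u * hits u n) (λ v → inClass c v * hits v n)) ⟩
      (∑[ n ← 𝒩 ] ∑[ u ← F ] ∑[ v ← F ] (inClass c u * hits u n * (inClass c v * hits v n)))
        ≡⟨ trans (∑-swap 𝒩 F _) (∑-cong F λ u → ∑-swap 𝒩 F _) ⟩
      (∑[ u ← F ] ∑[ v ← F ] ∑[ n ← 𝒩 ] (inClass c u * hits u n * (inClass c v * hits v n)))
        ≡⟨ ∑-cong F (λ u → ∑-cong F λ v → trans (∑-cong 𝒩 λ n → regroup (inClass c u) (hits u n) (inClass c v) (hits v n))
             (sym (∑-*ˡ 𝒩 (inClass c u * inClass c v) _))) ⟩
      (∑[ u ← F ] ∑[ v ← F ] (inClass c u * inClass c v * common u v))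
        ≤⟨ ∑-mono F (λ u → ∑-mono F λ v → *-monoʳ-≤ (inClass c u * inClass c v) (≤-trans (common≤∑hits u v) (∑hits≤ u v))) ⟩
      (∑[ u ← F ] ∑[ v ← F ] (inClass c u * inClass c v * (t + N * ⟦ u ≟ᴾ v ⟧)))
        ≤⟨ ∑-mono F (λ u → ∑-mono F λ v → pointwise (inClass c u) (inClass c v) ⟦ u ≟ᴾ v ⟧ (⟦⟧≤1 (c ≟ᴾ residue q v))) ⟩
      (∑[ u ← F ] ∑[ v ← F ] (t * (inClass c u * inClass c v) + N * (inClass c u * ⟦ u ≟ᴾ v ⟧)))
        ≡⟨ ∑-cong F (λ u → ∑-+ F _ _) ⟩
      (∑[ u ← F ] ((∑[ v ← F ] (t * (inClass c u * inClass c v))) + (∑[ v ← F ] (N * (inClass c u * ⟦ u ≟ᴾ v ⟧)))))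
        ≡⟨ ∑-+ F _ _ ⟩
      (∑[ u ← F ] ∑[ v ← F ] (t * (inClass c u * inClass c v))) + (∑[ u ← F ] ∑[ v ← F ] (N * (inClass c u * ⟦ u ≟ᴾ v ⟧)))
        ≡⟨ cong₂ _+_ (trans (∑-cong F λ u → sym (∑-*ˡ F t _)) (sym (∑-*ˡ F t _)))
             (trans (∑-cong F λ u → sym (∑-*ˡ F N _)) (sym (∑-*ˡ F N _))) ⟩
      t * (∑[ u ← F ] ∑[ v ← F ] (inClass c u * inClass c v)) + N * (∑[ u ← F ] ∑[ v ← F ] (inClass c u * ⟦ u ≟ᴾ v ⟧))
        ≡⟨ cong₂ (λ x y → t * x + N * y) (sym (∑*∑ F F (inClass c) (inClass c))) (∑-cong F λ u → sym (∑-*ˡ F (inClass c u) _)) ⟩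
      t * (f c * f c) + N * φ c ∎
      where
      open ≤-Reasoning
      regroup : ∀ a b c d → a * b * (c * d) ≡ a * c * (b * d)
      regroup = ℕ-Solver.solve-∀
      expand : ∀ i j t N w → i * j * (t + N * w) ≡ t * (i * j) + N * (i * w) * j
      expand = ℕ-Solver.solve-∀
      pointwise : ∀ i j w → j ≤ 1 → i * j * (t + N * w) ≤ t * (i * j) + N * (i * w)
      pointwise i j w j≤1 = ≤-trans (≤-reflexive (expand i j t N w))
        (+-monoʳ-≤ (t * (i * j)) (≤-trans (*-monoʳ-≤ (N * (i * w)) j≤1) (≤-reflexive (*-identityʳ _))))

    -- The weights e f + M φ are normalised so that f and φ contribute equally to their sum 2 e M.
    energy²≤ : .{{NonZero (e * M)}} → energy G * energy G ≤ 2 * (∑[ c ← box q ] (α c * (t * M * f c + N * e)))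
    energy²≤ = *-cancelˡ-≤ (e * M) (begin
      e * M * (energy G * energy G)                        ≡⟨ cong (λ E → e * M * (E * E)) ∑χ ⟨
      e * M * (∑ (box q) χ * ∑ (box q) χ)                  ≤⟨ cauchy-schwarz (e * M) (box q) χ _ _ pointwise ⟩
      (∑[ c ← box q ] (e * f c + M * φ c)) * R             ≡⟨ cong (_* R) (trans (∑-+ (box q) _ _) (cong₂ _+_ (trans (sym (∑-*ˡ (box q) e f)) (cong (e *_) ∑f)) (trans (sym (∑-*ˡ (box q) M φ)) (cong (M *_) ∑φ)))) ⟩
      (e * M + M * e) * R                                  ≡⟨ double e M R ⟩
      e * M * (2 * R) ∎)
      where
      open ≤-Reasoning
      R = ∑ (box q) λ c → α c * (t * M * f c + N * e)
      double : ∀ e M R → (e * M + M * e) * R ≡ e * M * (2 * R)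
      double = ℕ-Solver.solve-∀
      expand : ∀ e M a t f N φ → e * M * (a * (t * (f * f) + N * φ)) + (e * f * (a * (N * e)) + M * φ * (a * (t * M * f)))
        ≡ (e * f + M * φ) * (a * (t * M * f + N * e))
      expand = ℕ-Solver.solve-∀
      pointwise : ∀ c → e * M * (χ c * χ c) ≤ (e * f c + M * φ c) * (α c * (t * M * f c + N * e))
      pointwise c = ≤-trans (*-monoʳ-≤ (e * M) (≤-trans (χ²≤αβ c) (*-monoʳ-≤ (α c) (β≤ c))))
        (≤-trans (m≤m+n _ _) (≤-reflexive (expand e M (α c) t (f c) N (φ c))))

    -- Touching the class of `u` is a condition on `offset m n u` itself. The classes thus
    -- disappear, and for fixed `n` and `u` only the divisors `q` of one integer remain to be
    -- counted.
    ∑αf : (∑[ c ← box q ] (α c * f c)) ≡ (∑[ n ← 𝒩 ] (rep n * rep n * (∑[ u ← F ] ⟦ q ∣? ∣ offset m n u ∣ ⟧)))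
    ∑αf = begin
      (∑[ c ← box q ] (α c * f c))
        ≡⟨ ∑-cong (box q) (λ c → ∑*∑ 𝒩 F (λ n → touches c n * (rep n * rep n)) (inClass c)) ⟩
      (∑[ c ← box q ] ∑[ n ← 𝒩 ] ∑[ u ← F ] (touches c n * (rep n * rep n) * inClass c u))
        ≡⟨ ∑-swap (box q) 𝒩 _ ⟩
      (∑[ n ← 𝒩 ] ∑[ c ← box q ] ∑[ u ← F ] (touches c n * (rep n * rep n) * inClass c u))
        ≡⟨ ∑-cong 𝒩 (λ n → trans (∑-cong (box q) λ c → ∑-cong F λ u → *-comm _ (inClass c u)) (∑-inClass λ c _ → touches c n * (rep n * rep n))) ⟩
      (∑[ n ← 𝒩 ] ∑[ u ← F ] (touches (residue q u) n * (rep n * rep n)))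
        ≡⟨ ∑-cong 𝒩 (λ n → trans (∑-cong F λ u → trans (*-comm _ (rep n * rep n)) (cong (rep n * rep n *_)
             (⟦⟧-cong (q ∣? ∣ offset m n (residue q u) ∣) (q ∣? ∣ offset m n u ∣) (proj₂ (∣offset⇔ m q n u)) (proj₁ (∣offset⇔ m q n u)))))
             (sym (∑-*ˡ F (rep n * rep n) _))) ⟩
      (∑[ n ← 𝒩 ] (rep n * rep n * (∑[ u ← F ] ⟦ q ∣? ∣ offset m n u ∣ ⟧))) ∎
      where open ≡-Reasoning

    ∑α : (∑[ c ← box q ] α c) ≡ (∑[ n ← 𝒩 ] (rep n * rep n * (∑[ c ← box q ] touches c n)))
    ∑α = trans (∑-swap (box q) 𝒩 _) (∑-cong 𝒩 λ n → trans (∑-cong (box q) λ c → *-comm (touches c n) _) (sym (∑-*ˡ (box q) (rep n * rep n) λ c → touches c n)))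

    energy²≤∑α : .{{NonZero (e * M)}} → energy G * energy G ≤ 2 * (t * M * (∑[ c ← box q ] (α c * f c)) + N * e * (∑[ c ← box q ] α c))
    energy²≤∑α = ≤-trans energy²≤ (≤-reflexive (cong (2 *_) (begin
      (∑[ c ← box q ] (α c * (t * M * f c + N * e)))                            ≡⟨ ∑-cong (box q) (λ c → distribute (α c) (t * M) (f c) (N * e)) ⟩
      (∑[ c ← box q ] (t * M * (α c * f c) + N * e * α c))                      ≡⟨ ∑-+ (box q) _ _ ⟩
      (∑[ c ← box q ] (t * M * (α c * f c))) + (∑[ c ← box q ] (N * e * α c))    ≡⟨ cong₂ _+_ (∑-*ˡ (box q) (t * M) _) (∑-*ˡ (box q) (N * e) α) ⟨
      t * M * (∑[ c ← box q ] (α c * f c)) + N * e * (∑[ c ← box q ] α c) ∎)))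
      where
      open ≡-Reasoning
      distribute : ∀ a b c d → a * (b * c + d) ≡ b * (a * c) + d * a
      distribute = ℕ-Solver.solve-∀

  module _ {W H Γ : ℕ} (bound : DivisorBound W H)
    (near : ∀ {n} → n ∈ G → (∑[ u ← F ] ⟦ ∣ offset m n u ∣ ≟ 0 ⟧) ≤ Γ)
    (sizeF : ∀ {n u} → n ∈ G → u ∈ F → ∣ offset m n u ∣ ≤ W)
    (K : ℕ) (size-box : ∀ {n c} → n ∈ G → c ∈ box K → ∣ offset m n c ∣ ≤ W) where

    private
      G∋ : ∀ {n} → n ∈ 𝒩 → n ∈ G
      G∋ = ∈-deduplicate⁻ _≟ᴾ_ G

      points-hit : ∀ {n} → n ∈ 𝒩 → (∑[ i ← upTo K ] ∑[ u ← F ] ⟦ suc i ∣? ∣ offset m n u ∣ ⟧) ≤ K * Γ + H * M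
      points-hit {n} n∈ = begin
        (∑[ i ← upTo K ] ∑[ u ← F ] ⟦ suc i ∣? ∣ offset m n u ∣ ⟧)  ≡⟨ ∑-swap (upTo K) F _ ⟩
        (∑[ u ← F ] ∑[ i ← upTo K ] ⟦ suc i ∣? ∣ offset m n u ∣ ⟧)  ≤⟨ ∑-mono∈ F (λ {u} u∈ → divisor-count bound K ∣ offset m n u ∣ (sizeF (G∋ n∈) u∈)) ⟩
        (∑[ u ← F ] (K * ⟦ ∣ offset m n u ∣ ≟ 0 ⟧ + H))             ≡⟨ ∑-+ F _ _ ⟩
        (∑[ u ← F ] (K * ⟦ ∣ offset m n u ∣ ≟ 0 ⟧)) + (∑[ _ ← F ] H) ≡⟨ cong₂ _+_ (sym (∑-*ˡ F K _)) (trans (∑-const F H) (*-comm M H)) ⟩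
        K * (∑[ u ← F ] ⟦ ∣ offset m n u ∣ ≟ 0 ⟧) + H * M            ≤⟨ +-monoˡ-≤ (H * M) (*-monoʳ-≤ K (near (G∋ n∈))) ⟩
        K * Γ + H * M ∎
        where open ≤-Reasoning

      -- All boxes are enlarged to `box K` so that the sum over moduli can be taken first. A point
      -- off the sphere has at most `H` moduli, a point on it has all `K`, and there are at most 2K²
      -- of the latter.
      boxes-hit : ∀ {n} → n ∈ 𝒩 → (∑[ i ← upTo K ] ∑[ c ← box (suc i) ] ⟦ suc i ∣? ∣ offset m n c ∣ ⟧) ≤ (H + 2) * (K * K * K)
      boxes-hit {n} n∈ = begin
        (∑[ i ← upTo K ] ∑[ c ← box (suc i) ] ⟦ suc i ∣? ∣ offset m n c ∣ ⟧)
          ≤⟨ ∑-mono∈ (upTo K) (λ {i} i∈ → ∑-⊆ (λ c → ⟦ suc i ∣? ∣ offset m n c ∣ ⟧) (box! (suc i)) (box-mono (∈-upTo⁻ i∈))) ⟩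
        (∑[ i ← upTo K ] ∑[ c ← box K ] ⟦ suc i ∣? ∣ offset m n c ∣ ⟧)
          ≡⟨ ∑-swap (upTo K) (box K) _ ⟩
        (∑[ c ← box K ] ∑[ i ← upTo K ] ⟦ suc i ∣? ∣ offset m n c ∣ ⟧)
          ≤⟨ ∑-mono∈ (box K) (λ {c} c∈ → divisor-count bound K ∣ offset m n c ∣ (size-box (G∋ n∈) c∈)) ⟩
        (∑[ c ← box K ] (K * ⟦ ∣ offset m n c ∣ ≟ 0 ⟧ + H))
          ≡⟨ trans (∑-+ (box K) _ _) (cong₂ _+_ (sym (∑-*ˡ (box K) K _)) (trans (∑-const (box K) H) (cong (_* H) (length-box K)))) ⟩
        K * (∑[ c ← box K ] ⟦ ∣ offset m n c ∣ ≟ 0 ⟧) + K * (K * K) * H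
          ≤⟨ +-monoˡ-≤ (K * (K * K) * H) (*-monoʳ-≤ K (∑⟦⟧≤ (λ c → ∣ offset m n c ∣ ≟ 0) (box! K)
               (λ c∈ eq → c∈ , ℤ.∣i∣≡0⇒i≡0 eq) (Small-lattice-sphere m K n))) ⟩
        K * (K * K * 2) + K * (K * K) * H
          ≡⟨ ring K H ⟩
        (H + 2) * (K * K * K) ∎
        where
        open ≤-Reasoning
        ring : ∀ K H → K * (K * K * 2) + K * (K * K) * H ≡ (H + 2) * (K * K * K)
        ring = ℕ-Solver.solve-∀

      weighted : ∀ (ψ : ℕ → Point 3 → ℕ) b → (∀ {n} → n ∈ 𝒩 → (∑[ i ← upTo K ] ψ i n) ≤ b) →
                 (∑[ i ← upTo K ] ∑[ n ← 𝒩 ] (rep n * rep n * ψ i n)) ≤ energy G * b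
      weighted ψ b h = begin
        (∑[ i ← upTo K ] ∑[ n ← 𝒩 ] (rep n * rep n * ψ i n))  ≡⟨ ∑-swap (upTo K) 𝒩 _ ⟩
        (∑[ n ← 𝒩 ] ∑[ i ← upTo K ] (rep n * rep n * ψ i n))  ≡⟨ ∑-cong 𝒩 (λ n → sym (∑-*ˡ (upTo K) (rep n * rep n) λ i → ψ i n)) ⟩
        (∑[ n ← 𝒩 ] (rep n * rep n * (∑[ i ← upTo K ] ψ i n))) ≤⟨ ∑-mono∈ 𝒩 (λ {n} n∈ → *-monoʳ-≤ (rep n * rep n) (h n∈)) ⟩
        (∑[ n ← 𝒩 ] (rep n * rep n * b))                      ≡⟨ ∑-*ʳ 𝒩 b _ ⟨
        (∑[ n ← 𝒩 ] (rep n * rep n)) * b                      ≡⟨ cong (_* b) energy≡∑rep² ⟨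
        energy G * b ∎
        where open ≤-Reasoning

    -- Both averages over the moduli carry the weights `rep n * rep n`, whose sum is `energy G`; so
    -- one factor of the squared energy on the left cancels.
    energy-bound : .{{NonZero (e * M)}} → .{{NonZero (energy G)}} →
      K * energy G ≤ 2 * (t * M * (K * Γ + H * M) + N * e * ((H + 2) * (K * K * K)))
    energy-bound = *-cancelʳ-≤ (K * ε) _ ε (begin
      K * ε * ε                                            ≡⟨ trans (*-assoc K ε ε) (cong (_* (ε * ε)) (sym (List.length-upTo K))) ⟩
      length (upTo K) * (ε * ε)                            ≡⟨ ∑-const (upTo K) (ε * ε) ⟨
      (∑[ _ ← upTo K ] (ε * ε))                            ≤⟨ ∑-mono (upTo K) (λ i → Modulo.energy²≤∑α (suc i)) ⟩
      (∑[ i ← upTo K ] (2 * (t * M * T₁ i + N * e * T₂ i))) ≡⟨ trans (sym (∑-*ˡ (upTo K) 2 _)) (cong (2 *_) (trans (∑-+ (upTo K) _ _)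
                                                                (cong₂ _+_ (sym (∑-*ˡ (upTo K) (t * M) T₁)) (sym (∑-*ˡ (upTo K) (N * e) T₂))))) ⟩
      2 * (t * M * ∑ (upTo K) T₁ + N * e * ∑ (upTo K) T₂)  ≤⟨ *-monoʳ-≤ 2 (+-mono-≤ (*-monoʳ-≤ (t * M) T₁≤) (*-monoʳ-≤ (N * e) T₂≤)) ⟩
      2 * (t * M * (ε * (K * Γ + H * M)) + N * e * (ε * ((H + 2) * (K * K * K))))
                                                           ≡⟨ ring (t * M) (N * e) ε (K * Γ + H * M) ((H + 2) * (K * K * K)) ⟩
      2 * (t * M * (K * Γ + H * M) + N * e * ((H + 2) * (K * K * K))) * ε ∎)
      where
      open ≤-Reasoning
      ε = energy G
      T₁ T₂ : ℕ → ℕ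
      T₁ i = ∑ (box (suc i)) λ c → Modulo.α (suc i) c * Modulo.f (suc i) c
      T₂ i = ∑ (box (suc i)) (Modulo.α (suc i))
      T₁≤ : ∑ (upTo K) T₁ ≤ ε * (K * Γ + H * M)
      T₁≤ = ≤-trans (≤-reflexive (∑-cong (upTo K) λ i → Modulo.∑αf (suc i))) (weighted (λ i n → ∑ F λ u → ⟦ suc i ∣? ∣ offset m n u ∣ ⟧) _ points-hit)
      T₂≤ : ∑ (upTo K) T₂ ≤ ε * ((H + 2) * (K * K * K))
      T₂≤ = ≤-trans (≤-reflexive (∑-cong (upTo K) λ i → Modulo.∑α (suc i))) (weighted (λ i n → ∑ (box (suc i)) λ c → ⟦ suc i ∣? ∣ offset m n c ∣ ⟧) _ boxes-hit)
      ring : ∀ a b ε x y → 2 * (a * (ε * x) + b * (ε * y)) ≡ 2 * (a * x + b * y) * ε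
      ring = ℕ-Solver.solve-∀

-- The choice of the moduli

least : ∀ {P : ℕ → Set} → (∀ n → Dec (P n)) → ∀ b → P b → ∃[ k ] k ≤ b × P k × (∀ {j} → k ≡ suc j → ¬ P j)
least P? zero    p = 0 , z≤n , p , λ ()
least P? (suc b) p with P? b
... | yes q = let k , k≤b , r , min = least P? b q in k , ≤-trans k≤b (n≤1+n b) , r , min
... | no ¬q = suc b , ≤-refl , p , λ { refl → ¬q }

cube : ℕ → ℕ
cube x = x * x * x

cube-mono : ∀ {x y} → x ≤ y → cube x ≤ cube y
cube-mono h = *-mono-≤ (*-mono-≤ h h) h

cube-* : ∀ x y → cube (x * y) ≡ cube x * cube y
cube-* = ring
  where
  ring : ∀ x y → x * y * (x * y) * (x * y) ≡ x * x * x * (y * y * y)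
  ring = ℕ-Solver.solve-∀

cube-suc≤8* : ∀ j → cube (2 + j) ≤ 8 * cube (1 + j)
cube-suc≤8* j = ≤-trans (cube-mono (m≤m+n (2 + j) j)) (≤-reflexive (ring j))
  where
  ring : ∀ j → (2 + j + j) * (2 + j + j) * (2 + j + j) ≡ 8 * ((1 + j) * (1 + j) * (1 + j))
  ring = ℕ-Solver.solve-∀

-- The modulus bound K balances the two terms M²/K and w K², where w = N e.
balance : ∀ M w .{{_ : NonZero M}} .{{_ : NonZero w}} → w ≤ M * M →
          ∃[ K ] K ≤ M * M × NonZero K × M * M ≤ cube K * w × cube K * w ≤ 8 * (M * M)
balance M w w≤M² with least (λ K → M * M ≤? cube K * w) (M * M) top
  where
  instance _ = m*n≢0 M M
  top : M * M ≤ cube (M * M) * w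
  top = ≤-trans (m≤n*m (M * M) (M * M * (M * M)) {{m*n≢0 (M * M) (M * M)}}) (m≤m*n (cube (M * M)) w)
... | zero  , _ , p , _ = contradiction (n≤0⇒n≡0 p) (≢-nonZero⁻¹ (M * M) {{m*n≢0 M M}})
-- Minimality of K = 1 says nothing about the upper bound, as its predecessor is 0; `w ≤ M * M`
-- steps in.
... | suc zero , K≤ , p , _ = 1 , K≤ , _ , p , ≤-trans (≤-reflexive (+-identityʳ w)) (≤-trans w≤M² (m≤n*m (M * M) 8))
... | suc (suc j) , K≤ , p , min = suc (suc j) , K≤ , _ , p , (begin
  cube (2 + j) * w       ≤⟨ *-monoˡ-≤ w (cube-suc≤8* j) ⟩
  8 * cube (1 + j) * w   ≡⟨ *-assoc 8 (cube (1 + j)) w ⟩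
  8 * (cube (1 + j) * w) ≤⟨ *-monoʳ-≤ 8 (<⇒≤ (≰⇒> (min refl))) ⟩
  8 * (M * M) ∎)
  where open ≤-Reasoning

-- If the first alternative fails, the `Γ` term takes up at most half of `K * ε`, and
-- `K * ε ≤ 4 * Q` is left. As H + 2 ≤ 3 t H, this is at most 4 · (1 + 24) · t H M², whence 100.
-- After cubing, one of the three factors M² is replaced by K³ w, so that K³ cancels.
optimise : ∀ {ε t H M w Γ} .{{_ : NonZero M}} .{{_ : NonZero w}} → 1 ≤ t → 1 ≤ H → w ≤ M * M →
           (∀ K → K ≤ M * M → K * ε ≤ 2 * (t * M * (K * Γ + H * M) + w * ((H + 2) * (K * K * K)))) →
           ε ≤ 4 * (t * M * Γ) ⊎ cube ε ≤ cube (100 * (t * H)) * (M * M * (M * M) * w)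
optimise {ε} {t} {H} {M} {w} {Γ} 1≤t 1≤H w≤M² bound with balance M w w≤M²
... | K , K≤ , K≢0 , M²≤ , ≤8M² with ε ≤? 4 * (t * M * Γ)
...   | yes h = inj₁ h
...   | no ¬h = inj₂ (*-cancelˡ-≤ (cube K) {{cube≢0}} (begin
  cube K * cube ε                                            ≡⟨ cube-* K ε ⟨
  cube (K * ε)                                               ≤⟨ cube-mono Kε≤ ⟩
  cube (100 * (t * H) * (M * M))                             ≡⟨ cube-* (100 * (t * H)) (M * M) ⟩
  cube (100 * (t * H)) * cube (M * M)                        ≤⟨ *-monoʳ-≤ (cube (100 * (t * H))) (*-monoʳ-≤ (M * M * (M * M)) M²≤) ⟩
  cube (100 * (t * H)) * (M * M * (M * M) * (cube K * w))    ≡⟨ regroup (cube (100 * (t * H))) (M * M * (M * M)) (cube K) w ⟩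
  cube K * (cube (100 * (t * H)) * (M * M * (M * M) * w)) ∎))
  where
  open ≤-Reasoning
  .cube≢0 : NonZero (cube K)
  cube≢0 = m*n≢0 (K * K) K {{m*n≢0 K K {{K≢0}} {{K≢0}}}} {{K≢0}}
  regroup : ∀ a b c d → a * (b * (c * d)) ≡ c * (a * (b * d))
  regroup = ℕ-Solver.solve-∀
  Q : ℕ
  Q = t * H * (M * M) + 8 * (M * M) * (H + 2)
  split : ∀ t M K Γ H w → 2 * (t * M * (K * Γ + H * M) + w * ((H + 2) * (K * K * K)))
        ≡ 2 * (K * (t * M * Γ)) + 2 * (t * H * (M * M) + K * K * K * w * (H + 2))
  split = ℕ-Solver.solve-∀
  double : ∀ K x → 2 * (2 * (K * x)) ≡ K * (4 * x)
  double = ℕ-Solver.solve-∀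
  once : K * ε ≤ 2 * (K * (t * M * Γ)) + 2 * Q
  once = ≤-trans (bound K K≤) (≤-trans (≤-reflexive (split t M K Γ H w))
    (+-monoʳ-≤ (2 * (K * (t * M * Γ))) (*-monoʳ-≤ 2 (+-monoʳ-≤ (t * H * (M * M)) (*-monoˡ-≤ (H + 2) ≤8M²)))))
  Q≤ : 4 * Q ≤ 100 * (t * H) * (M * M)
  Q≤ = begin
    4 * (t * H * (M * M) + 8 * (M * M) * (H + 2))          ≤⟨ *-monoʳ-≤ 4 (+-monoʳ-≤ (t * H * (M * M)) (*-monoʳ-≤ (8 * (M * M)) (begin
      H + 2                  ≤⟨ +-monoʳ-≤ H (*-monoʳ-≤ 2 1≤H) ⟩
      3 * H                  ≤⟨ *-monoʳ-≤ 3 (≤-trans (≤-reflexive (sym (*-identityˡ H))) (*-monoˡ-≤ H 1≤t)) ⟩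
      3 * (t * H) ∎))) ⟩
    4 * (t * H * (M * M) + 8 * (M * M) * (3 * (t * H)))    ≡⟨ collect (t * H) (M * M) ⟩
    100 * (t * H) * (M * M) ∎
    where
    collect : ∀ x y → 4 * (x * y + 8 * y * (3 * x)) ≡ 100 * x * y
    collect = ℕ-Solver.solve-∀
  Kε≤ : K * ε ≤ 100 * (t * H) * (M * M)
  Kε≤ = ≤-trans (+-cancelˡ-≤ (K * ε) (K * ε) (4 * Q) (begin
    K * ε + K * ε                            ≡⟨ cong (_+_ (K * ε)) (+-identityʳ (K * ε)) ⟨
    2 * (K * ε)                              ≤⟨ *-monoʳ-≤ 2 once ⟩
    2 * (2 * (K * (t * M * Γ)) + 2 * Q)      ≡⟨ *-distribˡ-+ 2 (2 * (K * (t * M * Γ))) (2 * Q) ⟩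
    2 * (2 * (K * (t * M * Γ))) + 2 * (2 * Q) ≡⟨ cong₂ _+_ (double K (t * M * Γ)) (sym (*-assoc 2 2 Q)) ⟩
    K * (4 * (t * M * Γ)) + 4 * Q            ≤⟨ +-monoˡ-≤ (4 * Q) (*-monoʳ-≤ K (<⇒≤ (≰⇒> ¬h))) ⟩
    K * ε + 4 * Q ∎)) Q≤

-- Iterated sumsets of a set on a sphere

-- Kept with multiplicity: a point occurs once for each of its representations.
sums : ℕ → List (Point 3) → List (Point 3)
sums zero    A = zeroP ∷ []
sums (suc s) A = A ⊕ sums s A

∑-tuples : ∀ s A (φ : Point 3 → ℕ) → (∑[ σ ← tuples s A ] φ (sumP σ)) ≡ ∑ (sums s A) φ
∑-tuples zero    A φ = refl
∑-tuples (suc s) A φ = begin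
  (∑[ σ ← tuples (suc s) A ] φ (sumP σ))                    ≡⟨ ∑-concatMap (λ a → map (a ∷_) (tuples s A)) A (φ ∘ sumP) ⟩
  (∑[ a ← A ] ∑[ σ ← map (a ∷_) (tuples s A) ] φ (sumP σ))  ≡⟨ ∑-cong A (λ a → trans (∑-map (a ∷_) (tuples s A) (φ ∘ sumP)) (∑-tuples s A (φ ∘ addP a))) ⟩
  (∑[ a ← A ] ∑[ u ← sums s A ] φ (addP a u))               ≡⟨ ∑-⊕ A (sums s A) φ ⟨
  ∑ (sums (suc s) A) φ ∎
  where open ≡-Reasoning

E≡energy : ∀ s A → E s A ≡ energy (sums s A)
E≡energy s A = begin
  E s A                                                              ≡⟨ length-filter-∑ (λ p → sumP (proj₁ p) ≟ᴾ sumP (proj₂ p)) (cartesianProduct T T) ⟩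
  (∑[ p ← cartesianProduct T T ] ⟦ sumP (proj₁ p) ≟ᴾ sumP (proj₂ p) ⟧) ≡⟨ ∑-cartesianProduct T T _ ⟩
  (∑[ σ ← T ] ∑[ σ′ ← T ] ⟦ sumP σ ≟ᴾ sumP σ′ ⟧)                     ≡⟨ ∑-cong T (λ σ → ∑-tuples s A (λ v → ⟦ sumP σ ≟ᴾ v ⟧)) ⟩
  (∑[ σ ← T ] ∑[ v ← sums s A ] ⟦ sumP σ ≟ᴾ v ⟧)                     ≡⟨ ∑-tuples s A (λ u → ∑ (sums s A) λ v → ⟦ u ≟ᴾ v ⟧) ⟩
  energy (sums s A) ∎
  where
  open ≡-Reasoning
  T = tuples s A

length-sums : ∀ s A → length (sums s A) ≡ length A ^ s
length-sums zero    A = refl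
length-sums (suc s) A = trans (length-⊕ A (sums s A)) (cong (length A *_) (length-sums s A))

-- The other `r` summands determine the first one.
∑-≟-sums : ∀ {A} → Unique A → ∀ r n → (∑[ v ← sums (suc r) A ] ⟦ n ≟ᴾ v ⟧) ≤ length A ^ r
∑-≟-sums {A} A! r n = begin
  (∑[ v ← sums (suc r) A ] ⟦ n ≟ᴾ v ⟧)              ≡⟨ trans (∑-⊕ A (sums r A) _) (∑-swap A (sums r A) _) ⟩
  (∑[ u ← sums r A ] ∑[ a ← A ] ⟦ n ≟ᴾ addP a u ⟧)  ≤⟨ ∑-≤const (sums r A) (λ {u} _ → ≤-trans
                                                         (∑-mono A λ a → ⟦⟧-mono (n ≟ᴾ addP a u) (a ≟ᴾ subP n u) addP≡⇒≡subP)
                                                         (∑-⟦≟⟧-≤1 _≟ᴾ_ (subP n u) A!)) ⟩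
  length (sums r A) * 1                             ≡⟨ trans (*-identityʳ _) (length-sums r A) ⟩
  length A ^ r ∎
  where open ≤-Reasoning

energy-sums≤ : ∀ {A} → Unique A → ∀ r → energy (sums (suc r) A) ≤ length A ^ suc r * length A ^ r
energy-sums≤ {A} A! r = ≤-trans (∑-≤const (sums (suc r) A) λ {u} _ → ∑-≟-sums A! r u)
  (≤-reflexive (cong (_* length A ^ r) (length-sums (suc r) A)))

length≤energy : ∀ L → length L ≤ energy L
length≤energy L = subst (_≤ energy L) (length-∑ L) (∑-mono∈ L λ {u} u∈ →
  ≤-trans (≤-reflexive (sym (⟦⟧-yes (u ≟ᴾ u) refl))) (term-≤-∑ u∈))
  where
  term-≤-∑ : ∀ {f : Point 3 → ℕ} {L u} → u ∈ L → f u ≤ ∑ L f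
  term-≤-∑ (here refl) = m≤m+n _ _
  term-≤-∑ (there u∈)  = ≤-trans (term-≤-∑ u∈) (m≤n+m _ _)

subP-addP : ∀ (n a v : Point 3) → subP n (addP a v) ≡ subP (subP n v) a
subP-addP (n₁ ∷ n₂ ∷ n₃ ∷ []) (a₁ ∷ a₂ ∷ a₃ ∷ []) (v₁ ∷ v₂ ∷ v₃ ∷ []) =
  cong₂ _∷_ (ring n₁ a₁ v₁) (cong₂ _∷_ (ring n₂ a₂ v₂) (cong (_∷ []) (ring n₃ a₃ v₃)))
  where
  ring : ∀ n a v → n ℤ.- (a ℤ.+ v) ≡ n ℤ.- v ℤ.- a
  ring = ℤ-Solver.solve-∀

-- With all summands but the first fixed to the sum `v`, the first one lies on the spheres around 0
-- and around n - v. These are distinct unless n = v, when all of `A` may count.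
sphere-hits : ∀ {m t A} → Unique A → All (InSphere 3 m) A →
  (∀ {p} → p ≢ zeroP → Small t (λ b → InSphere 3 m b × InSphere 3 m (subP p b))) →
  ∀ r n → (∑[ u ← sums (suc r) A ] ⟦ ∣ offset m n u ∣ ≟ 0 ⟧) ≤ length A ^ r * t + length A * (∑[ v ← sums r A ] ⟦ n ≟ᴾ v ⟧)
sphere-hits {m} {t} {A} A! A⊂S two-spheres r n = begin
  (∑[ u ← sums (suc r) A ] ⟦ ∣ offset m n u ∣ ≟ 0 ⟧)                  ≡⟨ trans (∑-⊕ A (sums r A) _) (∑-swap A (sums r A) _) ⟩
  (∑[ v ← sums r A ] ∑[ a ← A ] ⟦ ∣ offset m n (addP a v) ∣ ≟ 0 ⟧)    ≤⟨ ∑-mono (sums r A) fibre ⟩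
  (∑[ v ← sums r A ] (t + length A * ⟦ n ≟ᴾ v ⟧))                     ≡⟨ ∑-+ (sums r A) _ _ ⟩
  (∑[ _ ← sums r A ] t) + (∑[ v ← sums r A ] (length A * ⟦ n ≟ᴾ v ⟧)) ≡⟨ cong₂ _+_ (trans (∑-const (sums r A) t) (cong (_* t) (length-sums r A))) (sym (∑-*ˡ (sums r A) (length A) _)) ⟩
  length A ^ r * t + length A * (∑[ v ← sums r A ] ⟦ n ≟ᴾ v ⟧) ∎
  where
  open ≤-Reasoning
  fibre : ∀ v → (∑[ a ← A ] ⟦ ∣ offset m n (addP a v) ∣ ≟ 0 ⟧) ≤ t + length A * ⟦ n ≟ᴾ v ⟧
  fibre v with n ≟ᴾ v
  ... | yes _  = ≤-trans (∑-≤const A λ {a} _ → ⟦⟧≤1 (∣ offset m n (addP a v) ∣ ≟ 0)) (m≤n+m _ t)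
  ... | no n≢v = ≤-trans (∑⟦⟧≤ (λ a → ∣ offset m n (addP a v) ∣ ≟ 0) A!
    (λ {a} a∈ eq → All.lookup A⊂S a∈ , trans (cong normSq (sym (subP-addP n a v))) (ℤ.i-j≡0⇒i≡j _ _ (ℤ.∣i∣≡0⇒i≡0 eq)))
    (two-spheres λ eq → n≢v (subP≡0⇒≡ eq))) (m≤m+n t _)

Bounded : ℕ → Point 3 → Set
Bounded R (x ∷ y ∷ z ∷ []) = ∣ x ∣ ≤ R × ∣ y ∣ ≤ R × ∣ z ∣ ≤ R

Bounded-weaken : ∀ {R R′} → R ≤ R′ → ∀ p → Bounded R p → Bounded R′ p
Bounded-weaken h (_ ∷ _ ∷ _ ∷ []) (x , y , z) = ≤-trans x h , ≤-trans y h , ≤-trans z h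

InSphere⇒Bounded : ∀ {m} p → InSphere 3 m p → Bounded m p
InSphere⇒Bounded {m} p@(x ∷ y ∷ z ∷ []) on =
  root (≤-trans (m≤m+n _ _) ≤m) , root (≤-trans (m≤m+n (∣ y ∣ * ∣ y ∣) _) yz≤) , root (≤-trans (m≤n+m (∣ z ∣ * ∣ z ∣) _) yz≤)
  where
  ≤m : normSqℕ p ≤ m
  ≤m = ≤-reflexive (ℤ.+-injective (trans (sym (normSq≡ p)) on))
  yz≤ : ∣ y ∣ * ∣ y ∣ + ∣ z ∣ * ∣ z ∣ ≤ m
  yz≤ = ≤-trans (m≤n+m _ (∣ x ∣ * ∣ x ∣)) ≤m
  root : ∀ {k} → k * k ≤ m → k ≤ m
  root {zero}  _ = z≤n
  root {suc k} h = ≤-trans (m≤m*n (suc k) (suc k)) h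

Bounded-addP : ∀ {R R′} p p′ → Bounded R p → Bounded R′ p′ → Bounded (R + R′) (addP p p′)
Bounded-addP (x ∷ y ∷ z ∷ []) (x′ ∷ y′ ∷ z′ ∷ []) (a , b , c) (a′ , b′ , c′) =
  ≤-trans (ℤ.∣i+j∣≤∣i∣+∣j∣ x x′) (+-mono-≤ a a′) , ≤-trans (ℤ.∣i+j∣≤∣i∣+∣j∣ y y′) (+-mono-≤ b b′) , ≤-trans (ℤ.∣i+j∣≤∣i∣+∣j∣ z z′) (+-mono-≤ c c′)

Bounded-sums : ∀ {m A} → All (InSphere 3 m) A → ∀ s {u} → u ∈ sums s A → Bounded (s * m) u
Bounded-sums A⊂S zero (here refl) = z≤n , z≤n , z≤n
Bounded-sums {m} {A} A⊂S (suc s) u∈ with ∈-concatMap⁻ (λ a → map (addP a) (sums s A)) {xs = A} u∈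
... | any with find any
...   | a , a∈ , u∈′ with ∈-map⁻ (addP a) u∈′
...     | v , v∈ , refl = Bounded-addP a v (InSphere⇒Bounded a (All.lookup A⊂S a∈)) (Bounded-sums A⊂S s v∈)

Bounded-box : ∀ K {c} → c ∈ box K → Bounded K c
Bounded-box K c∈ with ∈-box⁻ K c∈
... | _ , _ , _ , refl , x< , y< , z< = <⇒≤ x< , <⇒≤ y< , <⇒≤ z<

offset-size : ∀ {m R} n u → Bounded R n → Bounded R u → ∣ offset m n u ∣ ≤ 12 * (R * R) + m
offset-size {m} {R} n@(n₁ ∷ n₂ ∷ n₃ ∷ []) u@(x ∷ y ∷ z ∷ []) (a , b , c) (a′ , b′ , c′) = begin
  ∣ offset m n u ∣                      ≤⟨ ℤ.∣i-j∣≤∣i∣+∣j∣ (normSq (subP n u)) (+ m) ⟩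
  ∣ normSq (subP n u) ∣ + m             ≡⟨ cong (λ i → ∣ i ∣ + m) (normSq≡ (subP n u)) ⟩
  normSqℕ (subP n u) + m                ≤⟨ +-monoˡ-≤ m (+-mono-≤ (sq (n₁ ℤ.- x) (diff n₁ x a a′)) (+-mono-≤ (sq (n₂ ℤ.- y) (diff n₂ y b b′)) (sq (n₃ ℤ.- z) (diff n₃ z c c′)))) ⟩
  (R + R) * (R + R) + ((R + R) * (R + R) + (R + R) * (R + R)) + m ≡⟨ cong (_+ m) (ring R) ⟩
  12 * (R * R) + m ∎
  where
  open ≤-Reasoning
  diff : ∀ i j → ∣ i ∣ ≤ R → ∣ j ∣ ≤ R → ∣ i ℤ.- j ∣ ≤ R + R
  diff i j h h′ = ≤-trans (ℤ.∣i-j∣≤∣i∣+∣j∣ i j) (+-mono-≤ h h′)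
  sq : ∀ i → ∣ i ∣ ≤ R + R → ∣ i ∣ * ∣ i ∣ ≤ (R + R) * (R + R)
  sq i h = *-mono-≤ h h
  ring : ∀ R → (R + R) * (R + R) + ((R + R) * (R + R) + (R + R) * (R + R)) ≡ 12 * (R * R)
  ring = ℕ-Solver.solve-∀

-- The count (2m + 1)³ of a cube. Crude, but it makes every power of |A|, and with it the bound for
-- the moduli, polynomial in `m`.
sphere-length : ∀ {m A} .{{_ : NonZero m}} → Unique A → All (InSphere 3 m) A → length A ≤ (3 * m) ^ 3
sphere-length {m} {A} A! A⊂S = ≤-trans (Small-∈ points (λ {p} → ∈-points p) A A! (All.map (λ {p} → InSphere⇒Bounded p) A⊂S))
  (≤-trans (≤-reflexive len) (≤-trans (*-mono-≤ l≤ (*-mono-≤ l≤ l≤)) (≤-reflexive (cong (λ x → 3 * m * (3 * m * x)) (sym (*-identityʳ (3 * m)))))))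
  where
  ints : List ℤ
  ints = map +_ (upTo (suc m)) ++ map ℤ.-[1+_] (upTo m)
  l = length ints
  l≤ : l ≤ 3 * m
  l≤ = begin
    l                                                              ≡⟨ List.length-++ (map +_ (upTo (suc m))) ⟩
    length (map +_ (upTo (suc m))) + length (map ℤ.-[1+_] (upTo m)) ≡⟨ cong₂ _+_ (trans (List.length-map +_ (upTo (suc m))) (List.length-upTo (suc m)))
                                                                       (trans (List.length-map ℤ.-[1+_] (upTo m)) (List.length-upTo m)) ⟩
    1 + m + m                                                      ≤⟨ +-monoˡ-≤ m (+-monoˡ-≤ m (>-nonZero⁻¹ m)) ⟩
    m + m + m                                                      ≡⟨ ring m ⟩
    3 * m ∎
    where
    open ≤-Reasoning
    ring : ∀ m → m + m + m ≡ 3 * m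
    ring = ℕ-Solver.solve-∀
  ∈-ints : ∀ i → ∣ i ∣ ≤ m → i ∈ ints
  ∈-ints (+ n)      h = ∈-++⁺ˡ (∈-map⁺ +_ (∈-upTo⁺ (s≤s h)))
  ∈-ints ℤ.-[1+ n ] h = ∈-++⁺ʳ (map +_ (upTo (suc m))) (∈-map⁺ ℤ.-[1+_] (∈-upTo⁺ h))
  toP : ℤ × ℤ × ℤ → Point 3
  toP (x , y , z) = x ∷ y ∷ z ∷ []
  points : List (Point 3)
  points = map toP (cartesianProduct ints (cartesianProduct ints ints))
  ∈-points : ∀ p → Bounded m p → p ∈ points
  ∈-points (x ∷ y ∷ z ∷ []) (a , b , c) = ∈-map⁺ toP (∈-cartesianProduct⁺ (∈-ints x a) (∈-cartesianProduct⁺ (∈-ints y b) (∈-ints z c)))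
  len : length points ≡ l * (l * l)
  len = trans (List.length-map toP (cartesianProduct ints (cartesianProduct ints ints)))
    (trans (length-cartesianProduct ints (cartesianProduct ints ints)) (cong (l *_) (length-cartesianProduct ints ints)))

-- The recursion for the energies

collect-linear : ∀ {ε t M x B} → 3 * t * (3 * t) ≤ B → ε ≤ 4 * (t * M * (2 * t * x)) → ε ≤ B * (M * x)
collect-linear {ε} {t} {M} {x} {B} 9t²≤B h = begin
  ε                                            ≤⟨ h ⟩
  -- The coefficient 8 t² is padded to the square of 3 t.
  4 * (t * M * (2 * t * x))                    ≤⟨ m≤m+n _ (t * t * (M * x)) ⟩
  4 * (t * M * (2 * t * x)) + t * t * (M * x)  ≡⟨ ring t M x ⟩
  3 * t * (3 * t) * (M * x)                    ≤⟨ *-monoˡ-≤ (M * x) 9t²≤B ⟩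
  B * (M * x) ∎
  where
  open ≤-Reasoning
  ring : ∀ t M x → 4 * (t * M * (2 * t * x)) + t * t * (M * x) ≡ 3 * t * (3 * t) * (M * x)
  ring = ℕ-Solver.solve-∀

collect-cube : ∀ {ε c N e B} k → c ≤ B → cube ε ≤ cube c * (N ^ k * N ^ k * (N ^ k * N ^ k) * (N * e)) →
               ε ^ 3 ≤ B ^ 3 * N ^ (4 * k + 1) * e
collect-cube {ε} {c} {N} {e} {B} k c≤B h = begin
  ε ^ 3                                                        ≡⟨ ^3≡cube ε ⟩
  cube ε                                                       ≤⟨ h ⟩
  cube c * (N ^ k * N ^ k * (N ^ k * N ^ k) * (N * e))         ≤⟨ *-monoˡ-≤ (N ^ k * N ^ k * (N ^ k * N ^ k) * (N * e)) (cube-mono c≤B) ⟩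
  cube B * (N ^ k * N ^ k * (N ^ k * N ^ k) * (N * e))         ≡⟨ cong (_* (N ^ k * N ^ k * (N ^ k * N ^ k) * (N * e))) (^3≡cube B) ⟨
  B ^ 3 * (N ^ k * N ^ k * (N ^ k * N ^ k) * (N * e))          ≡⟨ regroup (B ^ 3) (N ^ k) N e ⟩
  B ^ 3 * ((N ^ k) ^ 4 * N ^ 1) * e                            ≡⟨ cong (λ x → B ^ 3 * (x * N ^ 1) * e) (trans (^-*-assoc N k 4) (cong (N ^_) (*-comm k 4))) ⟩
  B ^ 3 * (N ^ (4 * k) * N ^ 1) * e                            ≡⟨ cong (λ x → B ^ 3 * x * e) (^-distribˡ-+-* N (4 * k) 1) ⟨
  B ^ 3 * N ^ (4 * k + 1) * e ∎
  where
  open ≤-Reasoning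
  ^3≡cube : ∀ x → x * (x * (x * 1)) ≡ x * x * x
  ^3≡cube = ℕ-Solver.solve-∀
  regroup : ∀ a M N e → a * (M * M * (M * M) * (N * e)) ≡ a * (M * (M * (M * (M * 1))) * (N * 1)) * e
  regroup = ℕ-Solver.solve-∀

-- The first alternative is the contribution of the spheres that really pass through many points of F.
alternatives : ∀ {ε t H N e x B} k .{{_ : NonZero (N ^ k)}} .{{_ : NonZero (N * e)}} → 1 ≤ t → 1 ≤ H →
               N * e ≤ N ^ k * N ^ k → 3 * t * (3 * t) ≤ B → 100 * (t * H) ≤ B →
               (∀ K → K ≤ N ^ k * N ^ k → K * ε ≤ 2 * (t * N ^ k * (K * (2 * t * x) + H * N ^ k) + N * e * ((H + 2) * (K * K * K)))) →
               ε ≤ B * (N ^ k * x) ⊎ ε ^ 3 ≤ B ^ 3 * N ^ (4 * k + 1) * e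
alternatives {ε} {t} {H} {N} {e} {x} {B} k 1≤t 1≤H w≤ 9t²≤B 100tH≤B bound =
  [ inj₁ ∘ collect-linear {ε} {t} {N ^ k} {x} {B} 9t²≤B
  , inj₂ ∘ collect-cube {ε} {100 * (t * H)} {N} {e} {B} k 100tH≤B
  ]′ (optimise {ε} {t} {H} {N ^ k} {N * e} {2 * t * x} 1≤t 1≤H w≤ bound)

-- `R` dominates the coordinates of s-fold sums, by `sm≤R`, and the moduli K ≤ N^(2s-2) ≤ (3m)^(6s),
-- by `m^6s≤R`. Every offset is then at most 12 R² + m ≤ 16 R². The same `R` and `H` serve all
-- smaller s.
record Controlled (s m R H : ℕ) (A : List (Point 3)) : Set where
  field
    {{m≢0}}   : NonZero m
    {{A≢[]}}  : NonZero (length A)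
    1≤H       : 1 ≤ H
    divisorsH : DivisorBound (16 * (R * R)) H
    sm≤R      : s * m ≤ R
    m^6s≤R    : (3 * m) ^ (6 * s) ≤ R
    A!        : Unique A
    A⊂S       : All (InSphere 3 m) A

Controlled-pred : ∀ {s m R H A} → Controlled (suc s) m R H A → Controlled s m R H A
Controlled-pred {s} {m} c = record
  { 1≤H = 1≤H ; divisorsH = divisorsH ; A! = A! ; A⊂S = A⊂S
  ; sm≤R = ≤-trans (m≤n+m (s * m) m) sm≤R
  ; m^6s≤R = ≤-trans (^-monoʳ-≤ (3 * m) {{m*n≢0 3 m}} (*-monoʳ-≤ 6 (n≤1+n s))) m^6s≤R }
  where open Controlled c

module Recursion {r m R H A} (controlled : Controlled (2 + r) m R H A) where

  open Controlled controlled

  private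
    N M t L : ℕ
    N = length A
    M = N ^ suc r
    t = H * (H * 10)
    L = 10 * H
    F = sums (suc r) A
    W = 16 * (R * R)

    instance
      N^≢0 : ∀ {k} → NonZero (N ^ k)
      N^≢0 {k} = m^n≢0 N k
      3m≢0 : NonZero (3 * m)
      3m≢0 = m*n≢0 3 m

    R≢0 : NonZero R
    R≢0 = >-nonZero (<-≤-trans (m^n>0 (3 * m) (6 * (2 + r))) m^6s≤R)

    m³≤R : m * (m * m) ≤ R
    m³≤R = begin
      m * (m * m)              ≡⟨ cong (λ x → m * (m * x)) (*-identityʳ m) ⟨
      m ^ 3                    ≤⟨ ^-monoˡ-≤ 3 (m≤n*m m 3) ⟩
      (3 * m) ^ 3              ≤⟨ ^-monoʳ-≤ (3 * m) (≤-trans (m≤m+n 3 3) (m≤m*n 6 (2 + r))) ⟩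
      (3 * m) ^ (6 * (2 + r))  ≤⟨ m^6s≤R ⟩
      R ∎
      where open ≤-Reasoning

    M²≤R : M * M ≤ R
    M²≤R = begin
      N ^ suc r * N ^ suc r       ≡⟨ ^-distribˡ-+-* N (suc r) (suc r) ⟨
      N ^ (suc r + suc r)         ≤⟨ ^-monoˡ-≤ (suc r + suc r) (sphere-length A! A⊂S) ⟩
      ((3 * m) ^ 3) ^ (suc r + suc r) ≡⟨ ^-*-assoc (3 * m) 3 (suc r + suc r) ⟩
      (3 * m) ^ (3 * (suc r + suc r)) ≤⟨ ^-monoʳ-≤ (3 * m) (≤-trans (m≤m+n _ 6) (≤-reflexive (exponent r))) ⟩
      (3 * m) ^ (6 * (2 + r))     ≤⟨ m^6s≤R ⟩
      R ∎
      where
      open ≤-Reasoning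
      exponent : ∀ r → 3 * (suc r + suc r) + 6 ≡ 6 * (2 + r)
      exponent = ℕ-Solver.solve-∀

    m≤R : m ≤ R
    m≤R = ≤-trans (m≤m+n m (suc r * m)) sm≤R

    small-size : ∀ {x} → x ≤ 12 * (R * R) + m → x ≤ W
    small-size h = ≤-trans h (≤-trans (+-monoʳ-≤ (12 * (R * R)) (≤-trans m≤R (≤-trans (m≤m*n R R {{R≢0}}) (m≤n*m (R * R) 4))))
      (≤-reflexive (sym (*-distribʳ-+ (R * R) 12 4))))

    two-spheres : ∀ {p} → p ≢ zeroP → Small t (λ b → InSphere 3 m b × InSphere 3 m (subP p b))
    two-spheres = Small-two-spheres 1≤H divisorsH (≤-trans (≤-reflexive (ring m)) (*-monoʳ-≤ 16 (≤-trans m³≤R (m≤m*n R R {{R≢0}}))))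
      where
      ring : ∀ m → 4 * m * (4 * m * m) ≡ 16 * (m * (m * m))
      ring = ℕ-Solver.solve-∀

    1≤t : 1 ≤ t
    1≤t = *-mono-≤ 1≤H (*-mono-≤ 1≤H (s≤s z≤n))

    1≤L : 1 ≤ L
    1≤L = *-mono-≤ {1} {10} (s≤s z≤n) 1≤H

    -- Since t = 10 H² and L = 10 H, one has 3 t ≤ L² and 100 t H = L³; so L⁴ dominates the
    -- constants of both alternatives.
    3t≤L² : 3 * t ≤ L * L
    3t≤L² = ≤-trans (≤-reflexive (ring H)) (*-monoˡ-≤ L (*-monoˡ-≤ H {3} {10} (s≤s (s≤s (s≤s z≤n)))))
      where
      ring : ∀ H → 3 * (H * (H * 10)) ≡ 3 * H * (10 * H)
      ring = ℕ-Solver.solve-∀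

    9t²≤L⁴ : 3 * t * (3 * t) ≤ L ^ 4
    9t²≤L⁴ = ≤-trans (*-mono-≤ 3t≤L² 3t≤L²) (≤-reflexive (ring L))
      where
      ring : ∀ L → L * L * (L * L) ≡ L * (L * (L * (L * 1)))
      ring = ℕ-Solver.solve-∀

    100tH≤L⁴ : 100 * (t * H) ≤ L ^ 4
    100tH≤L⁴ = ≤-trans (≤-reflexive (ring H)) (^-monoʳ-≤ L {{>-nonZero 1≤L}} (n≤1+n 3))
      where
      ring : ∀ H → 100 * (H * (H * 10) * H) ≡ 10 * H * (10 * H * (10 * H * 1))
      ring = ℕ-Solver.solve-∀

    -- The exponent r ⊔ 1 is due to r = 0, where the sphere around n = 0 contains all of A.
    near : ∀ n → (∑[ u ← F ] ⟦ ∣ offset m n u ∣ ≟ 0 ⟧) ≤ 2 * t * N ^ (r ⊔ 1)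
    near n = ≤-trans (sphere-hits A! A⊂S two-spheres r n) (go r)
      where
      open ≤-Reasoning
      go : ∀ r → N ^ r * t + N * (∑[ v ← sums r A ] ⟦ n ≟ᴾ v ⟧) ≤ 2 * t * N ^ (r ⊔ 1)
      go zero = begin
        1 * t + N * (⟦ n ≟ᴾ zeroP ⟧ + 0)  ≤⟨ +-mono-≤ (*-monoˡ-≤ t (>-nonZero⁻¹ N)) (*-monoʳ-≤ N (≤-trans (≤-reflexive (+-identityʳ _)) (≤-trans (⟦⟧≤1 (n ≟ᴾ zeroP)) 1≤t))) ⟩
        N * t + N * t                     ≡⟨ ring N t ⟩
        2 * t * (N * 1) ∎
        where
        ring : ∀ N t → N * t + N * t ≡ 2 * t * (N * 1)
        ring = ℕ-Solver.solve-∀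
      go (suc r) = begin
        N * N ^ r * t + N * (∑[ v ← sums (suc r) A ] ⟦ n ≟ᴾ v ⟧) ≤⟨ +-monoʳ-≤ (N * N ^ r * t) (*-monoʳ-≤ N (∑-≟-sums A! r n)) ⟩
        N * N ^ r * t + N * N ^ r          ≤⟨ +-monoʳ-≤ (N * N ^ r * t) (m≤m*n (N * N ^ r) t {{>-nonZero 1≤t}}) ⟩
        N * N ^ r * t + N * N ^ r * t      ≡⟨ ring (N * N ^ r) t ⟩
        2 * t * (N * N ^ r)                ≡⟨ cong (λ k → 2 * t * (N * N ^ k)) (⊔-identityʳ r) ⟨
        2 * t * (N * N ^ (r ⊔ 0)) ∎
        where
        ring : ∀ x t → x * t + x * t ≡ 2 * t * x
        ring = ℕ-Solver.solve-∀

    e≤ : energy F ≤ N ^ suc r * N ^ r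
    e≤ = energy-sums≤ A! r

    energy≢0 : ∀ s → NonZero (energy (sums s A))
    energy≢0 s = >-nonZero (<-≤-trans (m^n>0 N s) (≤-trans (≤-reflexive (sym (length-sums s A))) (length≤energy (sums s A))))

  dichotomy : E (2 + r) A ≤ L ^ 4 * (N ^ suc r * N ^ (r ⊔ 1)) ⊎
              E (2 + r) A ^ 3 ≤ (L ^ 4) ^ 3 * N ^ (4 * suc r + 1) * E (1 + r) A
  dichotomy rewrite E≡energy (2 + r) A | E≡energy (1 + r) A = case
    where
    ε = energy (sums (2 + r) A)
    e = energy F
    open ≤-Reasoning
    module I = Incidence m A F A! A⊂S t two-spheres
    w≤M² : N * e ≤ N ^ suc r * N ^ suc r
    w≤M² = ≤-trans (*-monoʳ-≤ N e≤) (≤-reflexive (ring N (N ^ r)))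
      where
      ring : ∀ N x → N * (N * x * x) ≡ N * x * (N * x)
      ring = ℕ-Solver.solve-∀
    bounded : ∀ {n u} → n ∈ sums (2 + r) A → u ∈ F → ∣ offset m n u ∣ ≤ W
    bounded {n} {u} n∈ u∈ = small-size (offset-size {m} n u (Bounded-weaken sm≤R n (Bounded-sums A⊂S (2 + r) n∈))
      (Bounded-weaken (≤-trans (m≤n+m (suc r * m) m) sm≤R) u (Bounded-sums A⊂S (suc r) u∈)))
    bounded-box : ∀ {K} → K ≤ N ^ suc r * N ^ suc r → ∀ {n c} → n ∈ sums (2 + r) A → c ∈ box K → ∣ offset m n c ∣ ≤ W
    bounded-box {K} K≤ {n} {c} n∈ c∈ = small-size (offset-size {m} n c (Bounded-weaken sm≤R n (Bounded-sums A⊂S (2 + r) n∈))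
      (Bounded-weaken (≤-trans K≤ M²≤R) c (Bounded-box K c∈)))
    inequality : ∀ K → K ≤ N ^ suc r * N ^ suc r → K * ε ≤ 2 * (t * N ^ suc r * (K * (2 * t * N ^ (r ⊔ 1)) + H * N ^ suc r) + N * e * ((H + 2) * (K * K * K)))
    inequality K K≤ = subst (λ M → K * ε ≤ 2 * (t * M * (K * (2 * t * N ^ (r ⊔ 1)) + H * M) + N * e * ((H + 2) * (K * K * K)))) (length-sums (suc r) A)
      (I.energy-bound divisorsH (λ {n} _ → near n) bounded K (bounded-box K≤) {{e*M≢0}} {{energy≢0 (2 + r)}})
      where
      e*M≢0 : NonZero (e * length F)
      e*M≢0 = m*n≢0 e (length F) {{energy≢0 (suc r)}} {{subst NonZero (sym (length-sums (suc r) A)) (N^≢0 {suc r})}}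
    case : ε ≤ L ^ 4 * (N ^ suc r * N ^ (r ⊔ 1)) ⊎ ε ^ 3 ≤ (L ^ 4) ^ 3 * N ^ (4 * suc r + 1) * e
    case = alternatives {ε} {t} {H} {N} {e} {N ^ (r ⊔ 1)} {L ^ 4} (suc r) {{N^≢0 {suc r}}} {{m*n≢0 N e {{A≢[]}} {{energy≢0 (suc r)}}}}
      1≤t 1≤H w≤M² 9t²≤L⁴ 100tH≤L⁴ inequality

-- Solving the recursion for the exponents

^-cancelˡ-≤ : ∀ {m n} k .{{_ : NonZero k}} → m ^ k ≤ n ^ k → m ≤ n
^-cancelˡ-≤ k h = ≮⇒≥ λ n<m → <⇒≱ (^-monoˡ-< k n<m) h

x≤x^k : ∀ x k .{{_ : NonZero k}} → x ≤ x ^ k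
x≤x^k zero      k       = z≤n
x≤x^k x@(suc _) (suc k) = m≤m*n x (x ^ k) {{m^n≢0 x k}}

^-*-^ : ∀ a x b y k → (a ^ x * b ^ y) ^ k ≡ a ^ (x * k) * b ^ (y * k)
^-*-^ a x b y k = trans (^-distribʳ-* (a ^ x) (b ^ y) k) (cong₂ _*_ (^-*-assoc a x k) (^-*-assoc b y k))

cube-root : ∀ {ε e N B} → ε ^ 3 ≤ B ^ 3 * N ^ 5 * e → e ≤ N ^ 1 → ε ≤ B * N ^ 2
cube-root {ε} {e} {N} {B} h e≤ = ^-cancelˡ-≤ 3 (begin
  ε ^ 3                  ≤⟨ h ⟩
  B ^ 3 * N ^ 5 * e      ≤⟨ *-monoʳ-≤ (B ^ 3 * N ^ 5) e≤ ⟩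
  B ^ 3 * N ^ 5 * N ^ 1  ≡⟨ trans (*-assoc (B ^ 3) (N ^ 5) (N ^ 1)) (cong (B ^ 3 *_) (sym (^-distribˡ-+-* N 5 1))) ⟩
  B ^ 3 * N ^ 6          ≡⟨ cong (B ^ 3 *_) (^-*-assoc N 2 3) ⟨
  B ^ 3 * (N ^ 2) ^ 3    ≡⟨ ^-distribʳ-* B (N ^ 2) 3 ⟨
  (B * N ^ 2) ^ 3 ∎)
  where open ≤-Reasoning

-- The exponent here is 2s - 3 with s = j + 3. It misses the target by 1/2 + η_s, which after
-- scaling by 2 · 3T with T = 3^j is the slack `3 * T + 1`.
linear-step : ∀ {ε L N k} .{{_ : NonZero L}} .{{_ : NonZero N}} j T p → k ≡ suc j → ε ≤ L ^ 4 * (N ^ (2 + j) * N ^ k) →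
              ε ^ (2 * (3 * T)) ≤ L ^ (4 * (2 * (3 * T)) + p) * N ^ ((4 * suc j + 3) * (3 * T) + 1)
linear-step {ε} {L} {N} j T p refl h = begin
  ε ^ X                                              ≤⟨ ^-monoˡ-≤ X h ⟩
  (L ^ 4 * (N ^ (2 + j) * N ^ suc j)) ^ X            ≡⟨ cong (λ x → (L ^ 4 * x) ^ X) (^-distribˡ-+-* N (2 + j) (suc j)) ⟨
  (L ^ 4 * N ^ (2 + j + suc j)) ^ X                  ≡⟨ ^-*-^ L 4 N (2 + j + suc j) X ⟩
  L ^ (4 * X) * N ^ ((2 + j + suc j) * X)            ≤⟨ *-mono-≤ (^-monoʳ-≤ L {4 * X} (m≤m+n (4 * X) p)) (^-monoʳ-≤ N {(2 + j + suc j) * X} (≤-trans (m≤m+n _ (3 * T + 1)) (≤-reflexive (ring j T)))) ⟩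
  L ^ (4 * X + p) * N ^ ((4 * suc j + 3) * (3 * T) + 1) ∎
  where
  open ≤-Reasoning
  X : ℕ
  X = 2 * (3 * T)
  ring : ∀ j T → (2 + j + suc j) * (2 * (3 * T)) + (3 * T + 1) ≡ (4 * suc j + 3) * (3 * T) + 1
  ring = ℕ-Solver.solve-∀

-- The final `+ 1` in the exponent is η scaled by `2 * T`. It is inherited unchanged while the scale
-- triples, which is the rule η_s = η_{s-1} / 3.
cubic-step : ∀ {ε e L N} j T p → ε ^ 3 ≤ (L ^ 4) ^ 3 * N ^ (4 * (2 + j) + 1) * e → e ^ (2 * T) ≤ L ^ p * N ^ ((4 * j + 3) * T + 1) →
             ε ^ (2 * (3 * T)) ≤ L ^ (4 * (2 * (3 * T)) + p) * N ^ ((4 * suc j + 3) * (3 * T) + 1)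
cubic-step {ε} {e} {L} {N} j T p h ih = begin
  ε ^ (2 * (3 * T))                                                    ≡⟨ cong (ε ^_) (X≡ T) ⟩
  ε ^ (3 * X)                                                          ≡⟨ ^-*-assoc ε 3 X ⟨
  (ε ^ 3) ^ X                                                          ≤⟨ ^-monoˡ-≤ X h ⟩
  ((L ^ 4) ^ 3 * N ^ Y * e) ^ X                                        ≡⟨ ^-distribʳ-* ((L ^ 4) ^ 3 * N ^ Y) e X ⟩
  ((L ^ 4) ^ 3 * N ^ Y) ^ X * e ^ X                                    ≤⟨ *-mono-≤ (≤-reflexive (^-*-^ (L ^ 4) 3 N Y X)) ih ⟩
  (L ^ 4) ^ (3 * X) * N ^ (Y * X) * (L ^ p * N ^ Z)                    ≡⟨ [m*n]*[o*p]≡[m*o]*[n*p] ((L ^ 4) ^ (3 * X)) _ (L ^ p) _ ⟩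
  (L ^ 4) ^ (3 * X) * L ^ p * (N ^ (Y * X) * N ^ Z)                    ≡⟨ cong₂ _*_ L-powers (trans (sym (^-distribˡ-+-* N (Y * X) Z)) (cong (N ^_) (exponent j T))) ⟩
  L ^ (4 * (2 * (3 * T)) + p) * N ^ ((4 * suc j + 3) * (3 * T) + 1) ∎
  where
  open ≤-Reasoning
  X Y Z : ℕ
  X = 2 * T
  Y = 4 * (2 + j) + 1
  Z = (4 * j + 3) * T + 1
  X≡ : ∀ T → 2 * (3 * T) ≡ 3 * (2 * T)
  X≡ = ℕ-Solver.solve-∀
  L-powers : (L ^ 4) ^ (3 * X) * L ^ p ≡ L ^ (4 * (2 * (3 * T)) + p)
  L-powers = trans (cong (_* L ^ p) (trans (^-*-assoc L 4 (3 * X)) (cong (λ x → L ^ (4 * x)) (sym (X≡ T))))) (sym (^-distribˡ-+-* L (4 * (2 * (3 * T))) p))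
  exponent : ∀ j T → (4 * (2 + j) + 1) * (2 * T) + ((4 * j + 3) * T + 1) ≡ (4 * suc j + 3) * (3 * T) + 1
  exponent = ℕ-Solver.solve-∀

-- Both alternatives give N²: the first as N · N, the second as the cube root of N⁵ · E_1 with E_1 ≤
-- N.
energy-two : ∀ {m R H A} → Controlled 2 m R H A → E 2 A ≤ (10 * H) ^ 4 * length A ^ 2
energy-two {m} {R} {H} {A} c = [ subst (λ x → E 2 A ≤ (10 * H) ^ 4 * x) (sym (^-distribˡ-+-* (length A) 1 1))
  , (λ h → cube-root {E 2 A} {E 1 A} {length A} {(10 * H) ^ 4} h E₁≤) ]′ (Recursion.dichotomy {0} c)
  where
  E₁≤ : E 1 A ≤ length A ^ 1
  E₁≤ = ≤-trans (≤-reflexive (E≡energy 1 A)) (≤-trans (energy-sums≤ (Controlled.A! c) 0) (≤-reflexive (*-identityʳ (length A ^ 1))))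

-- For s = j + 2 the exponent of |A| is 2 · 3^j times 2s - 5/2 + η_s. The power `p` of the divisor
-- bound depends on `j` alone, so it may enter the later choice of `H`.
energy-exponent : ∀ j → ∃[ p ] ∀ {m R H A} → Controlled (2 + j) m R H A →
                  E (2 + j) A ^ (2 * 3 ^ j) ≤ (10 * H) ^ p * length A ^ ((4 * j + 3) * 3 ^ j + 1)
energy-exponent zero = 8 , λ {m} {R} {H} {A} c →
  ≤-trans (^-monoˡ-≤ 2 (energy-two c)) (≤-reflexive (^-*-^ (10 * H) 4 (length A) 2 2))
energy-exponent (suc j) = let p , ih = energy-exponent j in 4 * (2 * (3 * 3 ^ j)) + p , λ {m} {R} {H} {A} c →
  let open Controlled c
      instance _ = >-nonZero (*-mono-≤ {1} {10} (s≤s z≤n) 1≤H)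
  in [ linear-step {E (3 + j) A} {10 * H} {length A} j (3 ^ j) p (cong suc (⊔-identityʳ j))
     , (λ h → cubic-step {E (3 + j) A} {E (2 + j) A} {10 * H} {length A} j (3 ^ j) p h (ih (Controlled-pred c)))
     ]′ (Recursion.dichotomy {suc j} c)

-- From the divisor bound to powers of m

max-τ : ℕ → ℕ
max-τ zero    = 1
max-τ (suc W) = max-τ W ⊔ τ (suc W)

1≤max-τ : ∀ W → 1 ≤ max-τ W
1≤max-τ zero    = ≤-refl
1≤max-τ (suc W) = ≤-trans (1≤max-τ W) (m≤m⊔n (max-τ W) _)

max-τ-bound : ∀ W → DivisorBound W (max-τ W)
max-τ-bound zero    (suc w) ()
max-τ-bound (suc W) w w≤ with m≤n⇒m<n∨m≡n w≤
... | inj₁ (s≤s w≤W) = Small-weaken (m≤m⊔n (max-τ W) _) (max-τ-bound W w w≤W)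
... | inj₂ refl      = Small-weaken (m≤n⊔m (max-τ W) _) (Small-divisors (suc W))

max-τ^k≤ : ∀ {k C} W → (∀ n .{{_ : NonZero n}} → τ n ^ k ≤ C * n) → max-τ W ^ k ≤ suc C * suc W
max-τ^k≤ {k} zero    h = ≤-trans (≤-reflexive (^-zeroˡ k)) (s≤s z≤n)
max-τ^k≤ {k} {C} (suc W) h with ⊔-sel (max-τ W) (τ (suc W))
... | inj₁ eq rewrite eq = ≤-trans (max-τ^k≤ {k} {C} W h) (*-monoʳ-≤ (suc C) (n≤1+n (suc W)))
... | inj₂ eq rewrite eq = ≤-trans (h (suc W)) (*-mono-≤ (n≤1+n C) (n≤1+n (suc W)))

-- With ε = a / b, both sides are raised to the power b · 2 · 3^(s-2), which makes all exponents
-- natural: (4s - 5) 3^(s-2) + 1 is 2 · 3^(s-2) times 2s - 3 + 1/2 + η_s.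
theorem1p3 : (s : ℕ) → s ≥ 2 → (a b : ℕ) → a ≥ 1 → b ≥ 1 →
    ∃ λ (C : ℕ) → (m : ℕ) → m ≥ 1 → (A : List (Point 3)) → Unique A → All (InSphere 3 m) A → ¬ (A ≡ []) →
    E s A ^ (b * (2 * 3 ^ (s ∸ 2)))
    ≤ C ^ (b * (2 * 3 ^ (s ∸ 2))) * m ^ (a * (2 * 3 ^ (s ∸ 2)))
    * length A ^ (b * ((4 * s ∸ 5) * 3 ^ (s ∸ 2) + 1))
theorem1p3 (suc (suc j)) (s≤s (s≤s z≤n)) a@(suc _) b@(suc _) _ _ = C , final
  where
  open ≤-Reasoning
  s w p k X Y₀ Y : ℕ
  s = 2 + j
  w = 12 * s
  p = proj₁ (energy-exponent j)
  -- `W` is of size m^w, as R² contains (3m)^(12s). With this `k` the divisor bound gives H^(p b w)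
  -- ≪ m^w, that is, H^(p b) ≪ m; the successor keeps `k` non-zero.
  k = suc (p * b * w)
  X = 2 * 3 ^ j
  Y₀ = (4 * j + 3) * 3 ^ j + 1
  Y = (4 * s ∸ 5) * 3 ^ j + 1
  Cτ Cʷ C : ℕ
  Cτ = proj₁ (τ-bound k)
  -- 17 bounds `suc W` by 17 R², and R² = s² (3m)^w.
  Cʷ = suc Cτ * (17 * (s * s * 3 ^ w))
  C = 10 ^ (p * b) * Cʷ
  Y₀≡Y : Y₀ ≡ Y
  Y₀≡Y = cong (λ x → x * 3 ^ j + 1) (sym (trans (cong (_∸ 5) (ring j)) (m+n∸n≡m (4 * j + 3) 5)))
    where
    ring : ∀ j → 4 * (2 + j) ≡ 4 * j + 3 + 5
    ring = ℕ-Solver.solve-∀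
  instance
    X≢0 : NonZero X
    X≢0 = m*n≢0 2 (3 ^ j) {{_}} {{m^n≢0 3 j}}
    w≢0 : NonZero w
    w≢0 = _
  module _ (m : ℕ) (m≥1 : m ≥ 1) where
    instance
      m≢0 : NonZero m
      m≢0 = >-nonZero m≥1
      3m≢0 : NonZero (3 * m)
      3m≢0 = m*n≢0 3 m
    R W H : ℕ
    R = s * (3 * m) ^ (6 * s)
    W = 16 * (R * R)
    H = max-τ W
    sm≤R : s * m ≤ R
    sm≤R = *-monoʳ-≤ s (≤-trans (m≤n*m m 3) (≤-trans (≤-reflexive (sym (^-identityʳ (3 * m)))) (^-monoʳ-≤ (3 * m) {1} {6 * s} (s≤s z≤n))))
    size : suc Cτ * suc W ≤ Cʷ * m ^ w
    size = begin
      suc Cτ * suc W                                  ≤⟨ *-monoʳ-≤ (suc Cτ) (+-monoˡ-≤ W (>-nonZero⁻¹ (R * R) {{m*n≢0 R R {{R≢0}} {{R≢0}}}})) ⟩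
      suc Cτ * (17 * (R * R))                         ≡⟨ cong (λ x → suc Cτ * (17 * x)) (R² (6 * s) s (3 * m)) ⟩
      suc Cτ * (17 * (s * s * (3 * m) ^ (6 * s + 6 * s))) ≡⟨ cong (λ x → suc Cτ * (17 * (s * s * (3 * m) ^ x))) (sym (*-distribʳ-+ s 6 6)) ⟩
      suc Cτ * (17 * (s * s * (3 * m) ^ w))           ≡⟨ cong (λ x → suc Cτ * (17 * (s * s * x))) (^-distribʳ-* 3 m w) ⟩
      suc Cτ * (17 * (s * s * (3 ^ w * m ^ w)))       ≡⟨ regroup (suc Cτ) 17 (s * s) (3 ^ w) (m ^ w) ⟩
      Cʷ * m ^ w ∎
      where
      R≢0 : NonZero R
      R≢0 = m*n≢0 s ((3 * m) ^ (6 * s)) {{_}} {{m^n≢0 (3 * m) (6 * s)}}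
      R² : ∀ e s x → s * x ^ e * (s * x ^ e) ≡ s * s * x ^ (e + e)
      R² e s x = trans ([m*n]*[o*p]≡[m*o]*[n*p] s (x ^ e) s (x ^ e)) (cong (s * s *_) (sym (^-distribˡ-+-* x e e)))
      regroup : ∀ a b c d e → a * (b * (c * (d * e))) ≡ a * (b * (c * d)) * e
      regroup = ℕ-Solver.solve-∀
    H^pb≤ : H ^ (p * b) ≤ Cʷ * m
    H^pb≤ = ^-cancelˡ-≤ w (begin
      (H ^ (p * b)) ^ w   ≡⟨ ^-*-assoc H (p * b) w ⟩
      H ^ (p * b * w)     ≤⟨ ^-monoʳ-≤ H {{>-nonZero (1≤max-τ W)}} (n≤1+n (p * b * w)) ⟩
      H ^ k               ≤⟨ max-τ^k≤ {k} {Cτ} W (proj₂ (τ-bound k)) ⟩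
      suc Cτ * suc W      ≤⟨ size ⟩
      Cʷ * m ^ w          ≤⟨ *-monoˡ-≤ (m ^ w) (x≤x^k Cʷ w) ⟩
      Cʷ ^ w * m ^ w      ≡⟨ ^-distribʳ-* Cʷ m w ⟨
      (Cʷ * m) ^ w ∎)
  final : (m : ℕ) → m ≥ 1 → (A : List (Point 3)) → Unique A → All (InSphere 3 m) A → ¬ (A ≡ []) →
    E s A ^ (b * X) ≤ C ^ (b * X) * m ^ (a * X) * length A ^ (b * Y)
  final m m≥1 []       _  _   A≢[] = contradiction refl A≢[]
  final m m≥1 A@(_ ∷ _) A! A⊂S _ = begin
    E s A ^ (b * X)                              ≡⟨ trans (cong (E s A ^_) (*-comm b X)) (sym (^-*-assoc (E s A) X b)) ⟩
    (E s A ^ X) ^ b                              ≤⟨ ^-monoˡ-≤ b (proj₂ (energy-exponent j) controlled) ⟩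
    ((10 * H m m≥1) ^ p * length A ^ Y₀) ^ b     ≡⟨ ^-*-^ (10 * H m m≥1) p (length A) Y₀ b ⟩
    (10 * H m m≥1) ^ (p * b) * length A ^ (Y₀ * b) ≡⟨ cong₂ _*_ (^-distribʳ-* 10 (H m m≥1) (p * b)) (cong (length A ^_) (trans (cong (_* b) Y₀≡Y) (*-comm Y b))) ⟩
    10 ^ (p * b) * H m m≥1 ^ (p * b) * length A ^ (b * Y) ≤⟨ *-monoˡ-≤ (length A ^ (b * Y)) (begin
      10 ^ (p * b) * H m m≥1 ^ (p * b)   ≤⟨ *-monoʳ-≤ (10 ^ (p * b)) (H^pb≤ m m≥1) ⟩
      10 ^ (p * b) * (Cʷ * m)            ≡⟨ *-assoc (10 ^ (p * b)) Cʷ m ⟨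
      -- A single power of `m` is enough, because a · X ≥ 1.
      C * m                              ≤⟨ *-mono-≤ (x≤x^k C (b * X) {{m*n≢0 b X}}) (x≤x^k m (a * X) {{m*n≢0 a X}}) ⟩
      C ^ (b * X) * m ^ (a * X) ∎) ⟩
    C ^ (b * X) * m ^ (a * X) * length A ^ (b * Y) ∎
    where
    controlled : Controlled s m (R m m≥1) (H m m≥1) A
    controlled = record
      { m≢0 = >-nonZero m≥1 ; A≢[] = _ ; 1≤H = 1≤max-τ (W m m≥1) ; divisorsH = max-τ-bound (W m m≥1)
      ; sm≤R = sm≤R m m≥1 ; m^6s≤R = m≤n*m _ s ; A! = A! ; A⊂S = A⊂S }
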